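{- Fix $d\ge3$, let $q$ be an odd prime power, $Q$ a nondegenerate quadratic form on $\mathbb F_q^d$, and use the sphere family $\mathcal S_{\mathrm{rn}}=\{S_t:t\in\mathbb F_q\}$, the set $\mathfrak A_{d,\gamma}$ and the points $p_A$ ($A\in\mathfrak A_{d,\gamma}$) constructed in the context. For every $d$-uniform hypergraph $\mathcal G\subseteq\mathfrak A_{d,\gamma}$ on the label set $\mathbb F_q$, put $P_{\mathcal G}=\{p_A:A\in\mathcal G\}$. Then, for $A\in\mathcal G$ and $t\in\mathbb F_q$, $$p_A\in S_t\iff t\in A,$$ so the point–sphere incidence graph of $(P_{\mathcal G},\mathcal S_{\mathrm{rn}})$ is exactly the membership graph of $\mathcal G$. If $m=|\mathcal G|$, then $$I(P_{\mathcal G},\mathcal S_{\mathrm{rn}})=dm,\qquad\sigma(P_{\mathcal G},\mathcal S_{\mathrm{rn}})=(d-1)m,\qquad K_{\mathcal G}=\frac{(d-1)\sqrt m}{q^{d/2}},$$ where (for $m>0$) $K_{\mathcal G}$ is defined by $\sigma(P_{\mathcal G},\mathcal S_{\mathrm{rn}})=K_{\mathcal G}q^{(d-1)/2}\sqrt{|P_{\mathcal G}||\mathcal S_{\mathrm{rn}}|}$. In particular, $$K_{\mathcal G}^2q^{d-1}|\mathcal S_{\mathrm{rn}}|=(d-1)^2m\ge4m,$$ so every nonempty member of this class satisfies $K_{\mathcal G}^2q^{d-1}|\mathcal S_{\mathrm{rn}}|\ge4|P_{\mathcal G}|$. For each fixed $\rho>0$, all systems with $m\ge\rho|\mathfrak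 A_{d,\gamma}|$ have $K_{\mathcal G}\asymp_{d,\rho}1$ (bounded above and below by positive constants depending only on $d,\rho$, as $q\to\infty$). For sufficiently large $q$ they lie in the moderate range $$\frac{4|P_{\mathcal G}|}{K_{\mathcal G}^2q^{d-1}}\le|\mathcal S_{\mathrm{rn}}|\le C_1K_{\mathcal G}q^{(d-1)/2}$$ with $C_1=1$ when $d\ge4$, and with every fixed $C_1>\sqrt{\frac3{2\rho}}$ when $d=3$.
   Context: Put $\langle x,y\rangle_Q=\frac{Q(x+y)-Q(x)-Q(y)}2$ and $S_Q(c,r)=\{x:Q(x-c)=r\}$; spheres are parametrized by pairs $(c,r)$. $I(P,\mathcal S)=|\{(p,S)\in P\times\mathcal S:p\in S\}|$, $\sigma(P,\mathcal S)=I(P,\mathcal S)-|P||\mathcal S|/q$. Construction. Use a Witt decomposition $\mathbb F_q^d=\mathbb F_qe\oplus\mathbb F_qf\oplus V_0$ with $Q(xe+yf+z)=xy+Q_\perp(z)$, $Q_\perp$ nondegenerate on the $(d-2)$-dimensional space $V_0$. Fix a basis $u_1,\dots,u_{d-2}$ of $V_0$ and put, for $t\in\mathbb F_q$, $$z_t=\sum_{j=1}^{d-2}t^ju_j,\qquad c_t=t^{d-1}f+z_t,\qquad\gamma=-1-Q(c_1),\qquad g(t)=Q(c_t)+t^d+\gamma t^{d-1}.$$ The map $g:\mathbb F_q\to\mathbb F_q$ is not surjective (as $g(0)=g(1)=0$); choose $\kappa\in\mathbb F_q$ with $-\kappa\notin g(\mathbb F_q)$ and put $$b_t=t^d+\gamma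 t^{d-1}+\kappa,\qquad r_t=Q(c_t)+b_t,\qquad S_t=S_Q(c_t,r_t).$$ The map $$\Psi(xe+yf+z)(T)=T^d+(x+\gamma)T^{d-1}+\sum_{j=1}^{d-2}2\langle z,u_j\rangle_QT^j+\kappa-Q(xe+yf+z)$$ is a bijection from $\{xe+yf+z:x\in\mathbb F_q^\times,\ y\in\mathbb F_q,\ z\in V_0\}$ onto the set of monic degree-$d$ polynomials over $\mathbb F_q$ whose $T^{d-1}$-coefficient is not $\gamma$. Let $$\mathfrak A_{d,\gamma}=\Bigl\{A\subseteq\mathbb F_q:|A|=d,\ -\sum_{a\in A}a\ne\gamma\Bigr\},$$ and for $A\in\mathfrak A_{d,\gamma}$ let $p_A$ be the point with $\Psi(p_A)=\prod_{a\in A}(T-a)$. -}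

module Defs where

open import Algebra.Apartness.Bundles using (HeytingField; HeytingCommutativeRing)
open import Algebra.Bundles using (CommutativeRing; Semiring)
open import Algebra.Core using (Op₁; Op₂)
import Algebra.Definitions.RawMonoid as RawMonoidDefs
import Algebra.Definitions.RawSemiring as RawSemiringDefs
import Algebra.Properties.Ring as RingProperties
open import Algebra.Structures using (IsCommutativeRing)
open import Data.Empty using (⊥-elim)
open import Data.Fin using (Fin; toℕ)
import Data.Fin.Properties as Fin
open import Data.Fin.Subset using (Subset; inside; outside; ∣_∣; _∈_)
open import Data.Fin.Subset.Properties using (_∈?_)
open import Data.List using (List; []; _∷_; _++_; map; filter; length; foldr; allFin; deduplicate; replicate; cartesianProduct)
import Data.List.Membership.Propositional as List
open import Data.List.Relation.Unary.Unique.Propositional using (Unique)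
import Data.List.Relation.Unary.Unique.Propositional.Properties as Unique
import Data.List.Relation.Unary.Unique.DecPropositional.Properties as DecUnique
open import Data.Nat as ℕ using (ℕ; zero; suc; _∸_; NonZero)
open import Data.Nat.Primality using (Prime)
import Data.Nat.Properties as ℕ
open import Data.Product using (Σ; ∃; ∃₂; ∃-syntax; Σ-syntax; _×_; _,_; proj₁; proj₂)
import Data.Product.Properties as Product
open import Data.Sum using (_⊎_; inj₁; inj₂; [_,_]′)
open import Data.Vec using (Vec; zipWith)
import Data.Vec as Vec
import Data.Vec.Properties as Vec
import Data.Vec.Functional as Vector
open import Function using (_↔_; _⇔_; Inverse)
open import Function.Properties.Inverse using (↔-sym; ↔⇒↣)
open import Level using (_⊔_; 0ℓ)
open import Relation.Binary.Core using (Rel)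
open import Relation.Binary.Definitions using (DecidableEquality)
open import Relation.Binary.PropositionalEquality using (_≡_; _≢_; refl; sym; trans; cong)
open import Relation.Binary.Structures using (IsStrictPartialOrder)
open import Relation.Nullary using (¬_; Dec; ¬?; _×-dec_)
open import Relation.Unary using (Pred)

------------------------------------------------------------------------
-- Finite sets and bipartite graphs

record FinSet (A : Set) : Set where
  field
    elements : List A
    unique   : Unique elements

open FinSet public

infix 4 _∈ˢ_

_∈ˢ_ : {A : Set} → A → FinSet A → Set
a ∈ˢ X = a List.∈ elements X

card : {A : Set} → FinSet A → ℕ
card X = length (elements X)

image : {A B : Set} → DecidableEquality B → (A → B) → FinSet A → FinSet B
image _≟_ f X = record
  { elements = deduplicate _≟_ (map f (elements X))
  ; unique   = DecUnique.deduplicate-! _≟_ (map f (elements X))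
  }

record BipartiteGraph (L R : Set) : Set₁ where
  field
    lefts    : FinSet L
    rights   : FinSet R
    Adjacent : L → R → Set

record BijectiveOn {A B : Set} (f : A → B) (X : FinSet A) (Y : FinSet B) : Set where
  field
    maps-to    : ∀ {a} → a ∈ˢ X → f a ∈ˢ Y
    injective  : ∀ {a a′} → a ∈ˢ X → a′ ∈ˢ X → f a ≡ f a′ → a ≡ a′
    surjective : ∀ {b} → b ∈ˢ Y → ∃[ a ] (a ∈ˢ X × f a ≡ b)

record IsGraphIsomorphism {L R L′ R′ : Set}
         (G : BipartiteGraph L R) (H : BipartiteGraph L′ R′)
         (f : L → L′) (g : R → R′) : Set where
  private
    module G = BipartiteGraph G
    module H = BipartiteGraph H
  field
    lefts-bijective  : BijectiveOn f G.lefts H.lefts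
    rights-bijective : BijectiveOn g G.rights H.rights
    adjacency        : ∀ {l r} → l ∈ˢ G.lefts → r ∈ˢ G.rights →
                       G.Adjacent l r ⇔ H.Adjacent (f l) (g r)

allSubsets : (n : ℕ) → List (Subset n)
allSubsets zero    = Vec.[] ∷ []
allSubsets (suc n) = map (outside Vec.∷_) (allSubsets n) ++ map (inside Vec.∷_) (allSubsets n)

------------------------------------------------------------------------
-- The real numbers

-- The real numbers, characterised axiomatically as the Cauchy complete
-- Archimedean ordered field. The axioms are those valid for the
-- constructive reals (the order is not assumed decidable). The square
-- root, although it is definable from completeness, is given as an
-- operation; its value on negative numbers is unspecified.
record RealField c ℓ₁ ℓ₂ : Set (Level.suc (c ⊔ ℓ₁ ⊔ ℓ₂)) where
  field
    heytingField : HeytingField c ℓ₁ ℓ₂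

  open HeytingField heytingField public

  commutativeRing : CommutativeRing c ℓ₁
  commutativeRing = HeytingCommutativeRing.commutativeRing heytingCommutativeRing

  open RawMonoidDefs (CommutativeRing.+-rawMonoid commutativeRing) public
    using () renaming (_×_ to _·_)

  fromℕ : ℕ → Carrier
  fromℕ n = n · 1#

  infix 4 _<_ _≤_
  field
    _<_                  : Rel Carrier ℓ₂
    isStrictPartialOrder : IsStrictPartialOrder _≈_ _<_
    #⇒<⊎>                : ∀ {x y} → x # y → x < y ⊎ y < x
    <⇒#                  : ∀ {x y} → x < y → x # y
    0<1                  : 0# < 1#
    +-mono-<             : ∀ {x y} z → x < y → x + z < y + z
    *-pos                : ∀ {x y} → 0# < x → 0# < y → 0# < x * y
    archimedean          : ∀ x → ∃[ n ] x < fromℕ n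

  _≤_ : Rel Carrier ℓ₂
  x ≤ y = ¬ (y < x)

  IsCauchy : (ℕ → Carrier) → Set (c ⊔ ℓ₂)
  IsCauchy s = ∀ ε → 0# < ε → ∃[ N ] (∀ i j → N ℕ.≤ i → N ℕ.≤ j → s i - s j < ε)

  ConvergesTo : (ℕ → Carrier) → Carrier → Set (c ⊔ ℓ₂)
  ConvergesTo s l = ∀ ε → 0# < ε →
    ∃[ N ] (∀ i → N ℕ.≤ i → s i - l < ε × l - s i < ε)

  field
    complete : ∀ s → IsCauchy s → ∃[ l ] ConvergesTo s l
    √        : Carrier → Carrier
    √-nonneg : ∀ {x} → 0# ≤ x → 0# ≤ √ x
    √-square : ∀ {x} → 0# ≤ x → √ x * √ x ≈ x

  open IsStrictPartialOrder isStrictPartialOrder public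
    using (<-resp-≈; <-respʳ-≈; <-respˡ-≈)
    renaming (irrefl to <-irrefl; trans to <-trans; asym to <-asym)

  -- The library provides an inverse of y - 0#, that is, of y.
  infixl 7 _/_[_]
  _/_[_] : (x y : Carrier) → 0# < y → Carrier
  x / y [ 0<y ] = x * proj₁ (#⇒invertible (#-sym (<⇒# 0<y)))

  private
    open CommutativeRing commutativeRing using (ring)
    open RingProperties ring using (-0#≈0#)
    module R = CommutativeRing commutativeRing

    x-0≈x : ∀ x → x - 0# ≈ x
    x-0≈x x = R.trans (R.+-congˡ -0#≈0#) (R.+-identityʳ x)

  fromℕ-pos : ∀ n → .{{_ : NonZero n}} → 0# < fromℕ n
  fromℕ-pos (suc zero)    = <-respʳ-≈ (R.sym (R.+-identityʳ 1#)) 0<1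
  fromℕ-pos (suc (suc n)) = <-trans 0<1 (<-respʳ-≈ (R.+-comm _ _)
    (<-respˡ-≈ (R.+-identityˡ 1#) (+-mono-< 1# (fromℕ-pos (suc n)))))

  √-pos : ∀ {x} → 0# < x → 0# < √ x
  √-pos {x} 0<x = [ (λ s<0 → ⊥-elim (√-nonneg 0≤x s<0)) , (λ 0<s → 0<s) ]′ (#⇒<⊎> s#0)
    where
    0≤x : 0# ≤ x
    0≤x x<0 = <-asym 0<x x<0

    y : Carrier
    y = proj₁ (#⇒invertible (#-sym (<⇒# 0<x)))

    xy≈1 : x * y ≈ 1#
    xy≈1 = R.trans (R.*-congʳ (R.sym (x-0≈x x))) (proj₂ (proj₂ (#⇒invertible (#-sym (<⇒# 0<x)))))

    s·sy≈1 : (√ x - 0#) * (√ x * y) ≈ 1#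
    s·sy≈1 = R.trans (R.*-congʳ (x-0≈x (√ x)))
      (R.trans (R.sym (R.*-assoc _ _ _)) (R.trans (R.*-congʳ (√-square 0≤x)) xy≈1))

    s#0 : √ x # 0#
    s#0 = invertible⇒# (√ x * y , R.trans (R.*-comm _ _) s·sy≈1 , s·sy≈1)

------------------------------------------------------------------------
-- Finite fields of odd order

OddPrimePower : ℕ → Set
OddPrimePower q = ∃₂ λ p k → Prime p × p ≢ 2 × 1 ℕ.≤ k × q ≡ p ℕ.^ k

-- The value of 0# ⁻¹ is unspecified.
record FiniteField (q : ℕ) : Set₁ where
  infix  9 _⁻¹
  infix  8 -_
  infixl 7 _*_
  infixl 6 _+_
  field
    Carrier           : Set
    _+_ _*_           : Op₂ Carrier
    -_ _⁻¹            : Op₁ Carrier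
    0# 1#             : Carrier
    isCommutativeRing : IsCommutativeRing _≡_ _+_ _*_ -_ 0# 1#
    0≢1               : 0# ≢ 1#
    *-inverse         : ∀ {x} → x ≢ 0# → x * x ⁻¹ ≡ 1#
    enumeration       : Fin q ↔ Carrier

  commutativeRing : CommutativeRing 0ℓ 0ℓ
  commutativeRing = record { isCommutativeRing = isCommutativeRing }

  open CommutativeRing commutativeRing public using (_-_)
  open RawSemiringDefs (Semiring.rawSemiring (CommutativeRing.semiring commutativeRing)) public using (_^_)

  2# : Carrier
  2# = 1# + 1#

  element : Fin q → Carrier
  element = Inverse.to enumeration

  index : Carrier → Fin q
  index = Inverse.from enumeration

  infix 4 _≟_
  _≟_ : DecidableEquality Carrier
  _≟_ = Fin.inj⇒≟ (↔⇒↣ (↔-sym enumeration))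

  q-nonZero : NonZero q
  q-nonZero = Fin.nonZeroIndex (index 0#)

  all : FinSet Carrier
  all = record
    { elements = map element (allFin q)
    ; unique   = Unique.map⁺
        (λ {i} {j} eq → trans (sym (Inverse.strictlyInverseʳ enumeration i))
                        (trans (cong index eq) (Inverse.strictlyInverseʳ enumeration j)))
        (Unique.allFin⁺ q)
    }

  -- A set of field elements is encoded as the set of their indices in
  -- the enumeration.
  infix 4 _∈ᶠ_
  _∈ᶠ_ : Carrier → Subset q → Set
  a ∈ᶠ A = index a ∈ A

  members : Subset q → List Carrier
  members A = map element (filter (_∈? A) (allFin q))

  sumOver : Subset q → Carrier
  sumOver A = foldr _+_ 0# (members A)

-- Polynomials as coefficient lists, constant term first. Trailing zeros
-- are allowed, so equality of polynomials is _≈ₚ_.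
module Polynomials {q} (F : FiniteField q) where
  open FiniteField F

  Poly : Set
  Poly = List Carrier

  coeff : Poly → ℕ → Carrier
  coeff []      _       = 0#
  coeff (a ∷ f) zero    = a
  coeff (a ∷ f) (suc n) = coeff f n

  infix 4 _≈ₚ_
  _≈ₚ_ : Rel Poly 0ℓ
  f ≈ₚ g = ∀ n → coeff f n ≡ coeff g n

  infixl 6 _+ₚ_
  _+ₚ_ : Op₂ Poly
  []      +ₚ g       = g
  (a ∷ f) +ₚ []      = a ∷ f
  (a ∷ f) +ₚ (b ∷ g) = a + b ∷ f +ₚ g

  infixl 7 _*ₚ_
  _*ₚ_ : Op₂ Poly
  []      *ₚ g = []
  (a ∷ f) *ₚ g = map (a *_) g +ₚ (0# ∷ f *ₚ g)

  infix 8 _T^_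
  _T^_ : Carrier → ℕ → Poly
  a T^ n = replicate n 0# ++ a ∷ []

  sumₚ : ∀ {n} → (Fin n → Poly) → Poly
  sumₚ = Vector.foldr _+ₚ_ []

  -- ∏_{a ∈ A} (T - a)
  fromRoots : Subset q → Poly
  fromRoots A = foldr (λ a f → (1# T^ 1 +ₚ (- a) T^ 0) *ₚ f) (1# T^ 0) (members A)

------------------------------------------------------------------------
-- Quadratic spaces and spheres

module Space {q} (F : FiniteField q) (d : ℕ) where
  open FiniteField F

  V : Set
  V = Vec Carrier d

  infixl 6 _+ᵛ_ _-ᵛ_
  infixr 7 _∙_
  _+ᵛ_ _-ᵛ_ : Op₂ V
  _+ᵛ_ = zipWith _+_
  _-ᵛ_ = zipWith _-_

  _∙_ : Carrier → V → V
  a ∙ v = Vec.map (a *_) v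

  0ᵛ : V
  0ᵛ = Vec.replicate d 0#

  sumᵛ : ∀ {n} → (Fin n → V) → V
  sumᵛ = Vector.foldr _+ᵛ_ 0ᵛ

  _≟ᵛ_ : DecidableEquality V
  _≟ᵛ_ = Vec.≡-dec _≟_

  module Form (Q : V → Carrier) where

    ⟨_,_⟩ : V → V → Carrier
    ⟨ x , y ⟩ = (Q (x +ᵛ y) - Q x - Q y) * 2# ⁻¹

    -- The form ⟨_,_⟩ is symmetric by definition, so linearity in the
    -- first argument makes it bilinear.
    record IsQuadraticForm : Set where
      field
        homogeneous    : ∀ a x → Q (a ∙ x) ≡ a * a * Q x
        ⟨⟩-additive    : ∀ x y z → ⟨ x +ᵛ y , z ⟩ ≡ ⟨ x , z ⟩ + ⟨ y , z ⟩
        ⟨⟩-homogeneous : ∀ a x y → ⟨ a ∙ x , y ⟩ ≡ a * ⟨ x , y ⟩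

    NondegenerateOn : Pred V 0ℓ → Set
    NondegenerateOn W = ∀ {x} → W x → (∀ y → W y → ⟨ x , y ⟩ ≡ 0#) → x ≡ 0ᵛ

    Nondegenerate : Set
    Nondegenerate = ∀ x → (∀ y → ⟨ x , y ⟩ ≡ 0#) → x ≡ 0ᵛ

    -- The pair (c , r) stands for S_Q(c , r).
    Sphere : Set
    Sphere = V × Carrier

    _≟ₛ_ : DecidableEquality Sphere
    _≟ₛ_ = Product.≡-dec _≟ᵛ_ _≟_

    infix 4 _∈ₛ_ _∈ₛ?_
    _∈ₛ_ : V → Sphere → Set
    x ∈ₛ (c , r) = Q (x -ᵛ c) ≡ r

    _∈ₛ?_ : ∀ x S → Dec (x ∈ₛ S)
    x ∈ₛ? (c , r) = Q (x -ᵛ c) ≟ r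

    incidences : FinSet V → FinSet Sphere → ℕ
    incidences P 𝒮 =
      length (filter (λ (x , S) → x ∈ₛ? S) (cartesianProduct (elements P) (elements 𝒮)))

    -- Since Q(xe+yf+z) = xy + Q⊥(z) forces Q⊥ to be the restriction of Q
    -- to V₀, no separate name is used for Q⊥.
    record WittDecomposition : Set₁ where
      field
        e f     : V
        V₀      : Pred V 0ℓ
        V₀-zero : V₀ 0ᵛ
        V₀-+    : ∀ {x y} → V₀ x → V₀ y → V₀ (x +ᵛ y)
        V₀-∙    : ∀ a {x} → V₀ x → V₀ (a ∙ x)

      combine : Carrier → Carrier → V → V
      combine x y z = x ∙ e +ᵛ y ∙ f +ᵛ z

      field
        spanning      : ∀ v → ∃[ x ] ∃[ y ] ∃[ z ] (V₀ z × v ≡ combine x y z)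
        direct        : ∀ {x y z} → V₀ z → combine x y z ≡ 0ᵛ → x ≡ 0# × y ≡ 0# × z ≡ 0ᵛ
        Q-split       : ∀ x y {z} → V₀ z → Q (combine x y z) ≡ x * y + Q z
        nondegenerate : NondegenerateOn V₀

    record IsBasis {n : ℕ} (W : Pred V 0ℓ) (u : Fin n → V) : Set where
      field
        inW         : ∀ j → W (u j)
        spans       : ∀ {z} → W z → Σ[ a ∈ (Fin n → Carrier) ] z ≡ sumᵛ (λ j → a j ∙ u j)
        independent : (a : Fin n → Carrier) → sumᵛ (λ j → a j ∙ u j) ≡ 0ᵛ → ∀ j → a j ≡ 0#

------------------------------------------------------------------------
-- The construction

-- All choices entering the construction, for d ≥ 3.
record Construction (d : ℕ) : Set₁ where
  field
    q             : ℕ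
    oddPrimePower : OddPrimePower q
    F             : FiniteField q

  open FiniteField F using (Carrier; _+_; _*_; -_; _-_; _^_; 0#; 1#; 2#; _≟_; sumOver; all)
  open Polynomials F
  open Space F d public using (V; _≟ᵛ_)
  open Space F d using (_+ᵛ_; _∙_; sumᵛ; module Form)

  field
    Q : V → Carrier

  open Form Q public using (Sphere; _≟ₛ_; _∈ₛ_; incidences)
  open Form Q using (⟨_,_⟩; IsQuadraticForm; Nondegenerate; WittDecomposition; IsBasis)

  field
    isQuadraticForm : IsQuadraticForm
    nondegenerate   : Nondegenerate
    witt            : WittDecomposition

  open WittDecomposition witt using (f; V₀; combine)

  field
    u       : Fin (d ∸ 2) → V
    isBasis : IsBasis V₀ u

  -- The basis is numbered from zero: the vector usually written u_j, for
  -- 1 ≤ j ≤ d - 2, is u i with deg i = j.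
  deg : Fin (d ∸ 2) → ℕ
  deg j = suc (toℕ j)

  z[_] : Carrier → V
  z[ t ] = sumᵛ (λ j → (t ^ deg j) ∙ u j)

  c[_] : Carrier → V
  c[ t ] = (t ^ (d ∸ 1)) ∙ f +ᵛ z[ t ]

  γ : Carrier
  γ = - 1# - Q c[ 1# ]

  g : Carrier → Carrier
  g t = Q c[ t ] + t ^ d + γ * t ^ (d ∸ 1)

  field
    κ   : Carrier
    κ∉g : ∀ t → g t ≢ - κ

  b r : Carrier → Carrier
  b t = t ^ d + γ * t ^ (d ∸ 1) + κ
  r t = Q c[ t ] + b t

  S[_] : Carrier → Sphere
  S[ t ] = c[ t ] , r t

  𝒮rn : FinSet Sphere
  𝒮rn = image _≟ₛ_ S[_] all

  -- Ψ(xe+yf+z) as a function of the coordinates x, y, z.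
  Ψ : Carrier → Carrier → V → Poly
  Ψ x y z = 1# T^ d
         +ₚ (x + γ) T^ (d ∸ 1)
         +ₚ sumₚ (λ j → (2# * ⟨ z , u j ⟩) T^ deg j)
         +ₚ (κ - Q (combine x y z)) T^ 0

  𝔄 : Pred (Subset q) 0ℓ
  𝔄 A = ∣ A ∣ ≡ d × - sumOver A ≢ γ

  𝔄? : ∀ A → Dec (𝔄 A)
  𝔄? A = (∣ A ∣ ℕ.≟ d) ×-dec ¬? (- sumOver A ≟ γ)

  card𝔄 : ℕ
  card𝔄 = length (filter 𝔄? (allSubsets q))

  -- v lies in the domain of Ψ and Ψ(v) = ∏_{a ∈ A} (T - a).
  IsPoint : Subset q → V → Set
  IsPoint A v = ∃[ x ] ∃[ y ] ∃[ z ]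
    (x ≢ 0# × V₀ z × v ≡ combine x y z × Ψ x y z ≈ₚ fromRoots A)

-- A construction together with the points p_A and a hypergraph 𝒢 ⊆ 𝔄.
-- The values of p outside 𝔄 are irrelevant.
record System (d : ℕ) : Set₁ where
  field
    construction : Construction d

  open Construction construction public

  field
    p       : Subset q → V
    isPoint : ∀ {A} → 𝔄 A → IsPoint A (p A)
    𝒢       : FinSet (Subset q)
    𝒢⊆𝔄     : ∀ {A} → A ∈ˢ 𝒢 → 𝔄 A

  open FiniteField F public using (_∈ᶠ_; q-nonZero)

  P𝒢 : FinSet V
  P𝒢 = image _≟ᵛ_ p 𝒢

  m : ℕ
  m = card 𝒢

  incidenceGraph : BipartiteGraph V Sphere
  incidenceGraph = record { lefts = P𝒢 ; rights = 𝒮rn ; Adjacent = _∈ₛ_ }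

  membershipGraph : BipartiteGraph (Subset q) (FiniteField.Carrier F)
  membershipGraph = record
    { lefts    = 𝒢
    ; rights   = FiniteField.all F
    ; Adjacent = λ A t → t ∈ᶠ A
    }

------------------------------------------------------------------------
-- Real quantities attached to a system

module Quantities {c ℓ₁ ℓ₂} (ℝ : RealField c ℓ₁ ℓ₂) {d : ℕ} (𝒳 : System d) where
  open RealField ℝ
  open System 𝒳

  private
    instance
      nonZero-q : NonZero q
      nonZero-q = q-nonZero

  q^_ q^½_ : ℕ → Carrier
  q^ n  = fromℕ (q ℕ.^ n)
  -- q^(n/2)
  q^½ n = √ (q^ n)

  q^-pos : ∀ n → 0# < q^ n
  q^-pos n = fromℕ-pos (q ℕ.^ n) {{ℕ.m^n≢0 q n}}

  q^½-pos : ∀ n → 0# < q^½ n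
  q^½-pos n = √-pos (q^-pos n)

  ∣P∣ ∣𝒮∣ : Carrier
  ∣P∣ = fromℕ (card P𝒢)
  ∣𝒮∣ = fromℕ (card 𝒮rn)

  σ : Carrier
  σ = fromℕ (incidences P𝒢 𝒮rn) - (∣P∣ * ∣𝒮∣) / fromℕ q [ fromℕ-pos q ]

  -- K is the number K_𝒢, which is defined only when m > 0.
  record IsK (K : Carrier) : Set ℓ₁ where
    field
      nonempty : 0 ℕ.< m
      equation : σ ≈ K * q^½ (d ∸ 1) * √ (∣P∣ * ∣𝒮∣)

  InModerateRange : Carrier → Carrier → Set ℓ₂
  InModerateRange C₁ K = Σ[ 0<K ∈ 0# < K ]
      fromℕ 4 * ∣P∣ / (K * K * q^ (d ∸ 1)) [ *-pos (*-pos 0<K 0<K) (q^-pos (d ∸ 1)) ] ≤ ∣𝒮∣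
    × ∣𝒮∣ ≤ C₁ * K * q^½ (d ∸ 1)

{-# OPTIONS --safe #-}

-- Expanding Q(v − c_t) for v = xe + yf + z shows Q(v − c_t) − r_t = − Ψ(v)(t),
-- so v lies on S_t exactly when t is a root of Ψ(v); for v = p_A the roots are
-- the elements of A. Existence of p_A needs the dual basis map
-- z ↦ (2⟨z , u_j⟩)_j to be onto, which follows from its injectivity because V₀
-- is finite. The incidence graph being the membership graph, I = dm and
-- σ = (d − 1)m, hence K² q^d = (d − 1)² m, and all remaining claims compare m
-- with powers of q. For these, |𝔄| ≤ C(q , d) ≤ q^d, and since a d-set with
-- prescribed sum is determined by d − 1 of its elements,
-- |𝔄| ≥ C(q , d) − C(q , d − 1), so d! |𝔄| ≥ (q − 2d)^d.

module Submission where

open import Defs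
open import Algebra.Bundles using (CommutativeRing)
import Algebra.Properties.AbelianGroup as AbelianGroupProperties
import Algebra.Properties.CommutativeMonoid.Sum as Sum
import Algebra.Properties.CommutativeSemigroup as CommutativeSemigroupProperties
import Algebra.Properties.Ring as RingProperties
import Algebra.Properties.Semiring.Mult as Mult
import Algebra.Properties.Semiring.Mult.TCOptimised as MultTCOptimised
import Algebra.Properties.Semiring.Sum as SemiringSum
import Algebra.Solver.Ring as RingSolver
open import Algebra.Solver.Ring.AlmostCommutativeRing using (_-Raw-AlmostCommutative⟶_; fromCommutativeRing)
open import Data.Empty using (⊥-elim)
open import Data.Fin as Fin using (Fin; toℕ; fromℕ<; punchOut; finToFun; funToFin)
import Data.Fin.Permutation as Perm
import Data.Fin.Properties as Fin
open import Data.Fin.Subset as Subset using (Subset; inside; outside; ∣_∣)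
open import Data.Fin.Subset.Properties using (_∈?_; ⊆-antisym; drop-there)
open import Data.Integer as ℤ using (ℤ; 0ℤ; 1ℤ)
import Data.Integer.Properties as ℤ
open import Data.List as List using (List; []; _∷_; _++_; length; filter; foldr; allFin; deduplicate; cartesianProduct)
open import Data.List.Membership.Propositional using (_∈_)
open import Data.List.Membership.Propositional.Properties using
  ( ∈-∃++; ∈-++⁻; ∈-++⁺ˡ; ∈-++⁺ʳ; ∈-map⁺; ∈-map⁻; ∈-filter⁺; ∈-filter⁻; ∈-allFin
  ; ∈-deduplicate⁺; ∈-deduplicate⁻ )
import Data.List.Properties as List
open import Data.List.Relation.Unary.All as All using (All)
import Data.List.Relation.Unary.All.Properties as All
open import Data.List.Relation.Unary.AllPairs using ([]; _∷_)
open import Data.List.Relation.Unary.Any using (here; there)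
open import Data.List.Relation.Unary.Unique.Propositional using (Unique)
open import Data.List.Relation.Unary.Unique.Propositional.Properties using (Unique[x∷xs]⇒x∉xs)
import Data.Maybe as Maybe
open import Data.Nat as ℕ using (ℕ; zero; suc; z≤n; s≤s; NonZero; _!; _∸_)
open import Data.Nat.Combinatorics using (_C_; nCk≡nC[n∸k]; k>n⇒nCk≡0; nCk+nC[k+1]≡[n+1]C[k+1]; nCn≡1; nC1≡n)
open import Data.Nat.Divisibility using (_∣_; ∣⇒≤; m%n≡0⇒n∣m)
open import Data.Nat.Primality using (euclidsLemma; prime[2]; prime⇒irreducible)
import Data.Nat.Properties as ℕ
open import Data.Nat.Solver using (module +-*-Solver)
open import Data.Product using (_×_; _,_; proj₁; proj₂; ∃-syntax; ∃!)
open import Data.Sum using (_⊎_; inj₁; inj₂)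
open import Data.Vec as Vec using (lookup)
import Data.Vec.Functional as Vector
import Data.Vec.Properties as Vec
open import Function using (_∘_; id; _⇔_; mk⇔; Inverse; Equivalence; Injective)
open import Level using (0ℓ)
open import Relation.Binary.Definitions using (DecidableEquality; tri<; tri≈; tri>)
open import Relation.Binary.PropositionalEquality as ≡ using (_≡_; _≢_; module ≡-Reasoning)
import Relation.Binary.Reasoning.Base.Triple as Triple
import Relation.Binary.Reasoning.Setoid as SetoidReasoning
open import Relation.Binary.Structures using (IsPreorder)
open import Relation.Nullary using (¬_; Dec; yes; no; ¬?; _×-dec_; contradiction)
open import Relation.Nullary.Decidable using (dec⇒maybe)
open import Relation.Unary using (Pred; Decidable)

-- With |S| = q and K² q^d = (d - 1)² m, the upper end of the moderate range, q ≤ C₁ K q^((d-1)/2),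
-- squares to q³ ≤ C₁² (d - 1)² m. A dense system has m of order at least q^d, so for d ≥ 4 there is
-- a factor of q to spare: any lower bound on |𝔄| of the right order will do, and q ≥ 4d turns (q -
-- 2d)^d into (q / 2)^d at the cost of `N d` = d! 2^d. For d = 3 both sides have order q³ and the
-- leading constants decide: (d - 1)² m is at least about 4 ρ q³ / 6, which is where C₁² > 3 / (2ρ)
-- comes from, so the bound 6 |𝔄| ≥ (q - 6)³ is used there without halving q. The reals are
-- constructive: the order is not decidable and x ≤ y is the negation of y < x. Hence non-strict
-- inequalities are obtained by refuting strict ones, factors are cancelled only when known to be
-- positive, and relations between square roots are proved by comparing squares of positive numbers.

-- A ring solver with integer coefficients for any commutative ring.

module IntegerSolver {c ℓ} (R : CommutativeRing c ℓ) where
  open import Data.Integer using (+_; -[1+_]; _⊖_)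
  open CommutativeRing R
  open RingProperties ring
  open AbelianGroupProperties +-abelianGroup using (⁻¹-∙-comm)
  open MultTCOptimised semiring using (×-homo-+; ×1-homo-*; 1+×) renaming (_×_ to _·_)
  open SetoidReasoning setoid

  -- With the optimised multiples `1 · 1#` is `1#` by computation, so `con 1ℤ` in a solved equation
  -- matches `1#` without a rewriting step.
  ⟦_⟧ℤ : ℤ → Carrier
  ⟦ + n ⟧ℤ      = n · 1#
  ⟦ -[1+ n ] ⟧ℤ = - (suc n · 1#)

  ⟦⟧ℤ-⊖ : ∀ m n → ⟦ m ⊖ n ⟧ℤ ≈ m · 1# - n · 1#
  ⟦⟧ℤ-⊖ m zero = begin
    ⟦ m ⊖ 0 ⟧ℤ   ≡⟨ ≡.cong ⟦_⟧ℤ (ℤ.⊖-≥ {m} ℕ.z≤n) ⟩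
    m · 1#       ≈⟨ +-identityʳ _ ⟨
    m · 1# + 0#  ≈⟨ +-congˡ -0#≈0# ⟨
    m · 1# - 0#  ∎
  ⟦⟧ℤ-⊖ zero (suc n) = sym (+-identityˡ _)
  ⟦⟧ℤ-⊖ (suc m) (suc n) = begin
    ⟦ suc m ⊖ suc n ⟧ℤ               ≡⟨ ≡.cong ⟦_⟧ℤ (ℤ.[1+m]⊖[1+n]≡m⊖n m n) ⟩
    ⟦ m ⊖ n ⟧ℤ                       ≈⟨ ⟦⟧ℤ-⊖ m n ⟩
    m · 1# - n · 1#                  ≈⟨ +-congʳ (xyx⁻¹≈y 1# (m · 1#)) ⟨
    (1# + m · 1# - 1#) - n · 1#      ≈⟨ +-assoc _ _ _ ⟩
    (1# + m · 1#) + (- 1# - n · 1#)  ≈⟨ +-congˡ (⁻¹-∙-comm 1# (n · 1#)) ⟩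
    (1# + m · 1#) - (1# + n · 1#)    ≈⟨ +-cong (sym (1+× m 1#)) (-‿cong (sym (1+× n 1#))) ⟩
    suc m · 1# - suc n · 1#          ∎

  ⟦⟧ℤ-+ : ∀ i j → ⟦ i ℤ.+ j ⟧ℤ ≈ ⟦ i ⟧ℤ + ⟦ j ⟧ℤ
  ⟦⟧ℤ-+ (+ m) (+ n)           = ×-homo-+ 1# m n
  ⟦⟧ℤ-+ (+ m) -[1+ n ]        = ⟦⟧ℤ-⊖ m (suc n)
  ⟦⟧ℤ-+ -[1+ m ] (+ n)        = trans (⟦⟧ℤ-⊖ n (suc m)) (+-comm _ _)
  ⟦⟧ℤ-+ -[1+ m ] -[1+ n ]     = begin
    - (suc (suc (m ℕ.+ n)) · 1#)  ≡⟨ ≡.cong (λ k → - (suc k · 1#)) (≡.sym (ℕ.+-suc m n)) ⟩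
    - ((suc m ℕ.+ suc n) · 1#)    ≈⟨ -‿cong (×-homo-+ 1# (suc m) (suc n)) ⟩
    - (suc m · 1# + suc n · 1#)   ≈⟨ ⁻¹-∙-comm _ _ ⟨
    - (suc m · 1#) - suc n · 1#   ∎

  ⟦⟧ℤ-neg : ∀ i → ⟦ ℤ.- i ⟧ℤ ≈ - ⟦ i ⟧ℤ
  ⟦⟧ℤ-neg (+ zero)    = sym -0#≈0#
  ⟦⟧ℤ-neg (+ suc n)   = refl
  ⟦⟧ℤ-neg -[1+ n ]    = sym (-‿involutive _)

  ⟦⟧ℤ-*⁺ : ∀ i n → ⟦ i ℤ.* + n ⟧ℤ ≈ ⟦ i ⟧ℤ * ⟦ + n ⟧ℤ
  ⟦⟧ℤ-*⁺ (+ m) n = begin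
    ⟦ + m ℤ.* + n ⟧ℤ  ≡⟨ ≡.cong ⟦_⟧ℤ (ℤ.pos-* m n) ⟨
    (m ℕ.* n) · 1#    ≈⟨ ×1-homo-* m n ⟩
    m · 1# * n · 1#   ∎
  ⟦⟧ℤ-*⁺ -[1+ m ] n = begin
    ⟦ ℤ.- (+ suc m) ℤ.* + n ⟧ℤ   ≡⟨ ≡.cong ⟦_⟧ℤ (ℤ.neg-distribˡ-* (+ suc m) (+ n)) ⟨
    ⟦ ℤ.- (+ suc m ℤ.* + n) ⟧ℤ   ≈⟨ ⟦⟧ℤ-neg (+ suc m ℤ.* + n) ⟩
    - ⟦ + suc m ℤ.* + n ⟧ℤ       ≈⟨ -‿cong (⟦⟧ℤ-*⁺ (+ suc m) n) ⟩
    - (⟦ + suc m ⟧ℤ * ⟦ + n ⟧ℤ)  ≈⟨ -‿distribˡ-* _ _ ⟩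
    ⟦ -[1+ m ] ⟧ℤ * ⟦ + n ⟧ℤ     ∎

  ⟦⟧ℤ-* : ∀ i j → ⟦ i ℤ.* j ⟧ℤ ≈ ⟦ i ⟧ℤ * ⟦ j ⟧ℤ
  ⟦⟧ℤ-* i (+ n)     = ⟦⟧ℤ-*⁺ i n
  ⟦⟧ℤ-* i -[1+ n ]  = begin
    ⟦ i ℤ.* ℤ.- (+ suc n) ⟧ℤ   ≡⟨ ≡.cong ⟦_⟧ℤ (ℤ.neg-distribʳ-* i (+ suc n)) ⟨
    ⟦ ℤ.- (i ℤ.* + suc n) ⟧ℤ   ≈⟨ ⟦⟧ℤ-neg (i ℤ.* + suc n) ⟩
    - ⟦ i ℤ.* + suc n ⟧ℤ       ≈⟨ -‿cong (⟦⟧ℤ-*⁺ i (suc n)) ⟩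
    - (⟦ i ⟧ℤ * ⟦ + suc n ⟧ℤ)  ≈⟨ -‿distribʳ-* _ _ ⟩
    ⟦ i ⟧ℤ * ⟦ -[1+ n ] ⟧ℤ     ∎

  fromℤ : ℤ.+-*-rawRing -Raw-AlmostCommutative⟶ fromCommutativeRing R
  fromℤ = record
    { ⟦_⟧    = ⟦_⟧ℤ
    ; +-homo = ⟦⟧ℤ-+
    ; *-homo = ⟦⟧ℤ-*
    ; -‿homo = ⟦⟧ℤ-neg
    ; 0-homo = refl
    ; 1-homo = refl
    }

  -- Coefficients are compared as integers, where equality is decidable; in the ring itself, for
  -- example in the reals, it need not be.
  open RingSolver ℤ.+-*-rawRing (fromCommutativeRing R) fromℤ
    (λ i j → Maybe.map (λ i≡j → reflexive (≡.cong ⟦_⟧ℤ i≡j)) (dec⇒maybe (i ℤ.≟ j))) public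
    using (solve; con; _:=_; _:+_; _:*_; _:-_; :-_)

-- Parity of q and inequalities between powers.

module Arithmetic where
  open import Data.Nat.DivMod using (_%_; _/_; m≡m%n+[m/n]*n; m%n<n)
  open ≡ using (refl; sym; trans; cong; cong₂; subst)

  oddPrimePower-odd : ∀ {q} → OddPrimePower q → ∃[ j ] q ≡ 1 ℕ.+ j ℕ.* 2
  oddPrimePower-odd (p , k , p-prime , p≢2 , _ , refl) =
    p ℕ.^ k / 2 , trans (m≡m%n+[m/n]*n (p ℕ.^ k) 2) (cong (ℕ._+ p ℕ.^ k / 2 ℕ.* 2) %2≡1)
    where
    2∤p^ : ∀ k → ¬ 2 ∣ p ℕ.^ k
    2∤p^ zero    2∣1 with ∣⇒≤ 2∣1
    ... | s≤s ()
    2∤p^ (suc k) 2∣p^1+k with euclidsLemma p (p ℕ.^ k) prime[2] 2∣p^1+k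
    ... | inj₂ 2∣p^k = 2∤p^ k 2∣p^k
    ... | inj₁ 2∣p with prime⇒irreducible p-prime 2∣p
    ...   | inj₂ 2≡p = p≢2 (sym 2≡p)

    %2≡1 : p ℕ.^ k % 2 ≡ 1
    %2≡1 with p ℕ.^ k % 2 in eq | m%n<n (p ℕ.^ k) 2
    ... | 0 | _ = contradiction (m%n≡0⇒n∣m (p ℕ.^ k) 2 eq) (2∤p^ k)
    ... | 1 | _ = refl
    ... | suc (suc _) | s≤s (s≤s ())

  ^-distribʳ-* : ∀ k m n → (m ℕ.* n) ℕ.^ k ≡ m ℕ.^ k ℕ.* n ℕ.^ k
  ^-distribʳ-* zero    m n = refl
  ^-distribʳ-* (suc k) m n =
    trans (cong (m ℕ.* n ℕ.*_) (^-distribʳ-* k m n)) (ℕ.[m*n]*[o*p]≡[m*o]*[n*p] m n (m ℕ.^ k) (n ℕ.^ k))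

  -- For q ≥ 4d the proportion |𝔄| / q ^ d is at least 1 / N d.
  N : ℕ → ℕ
  N d = d ! ℕ.* 2 ℕ.^ d

  N≢0 : ∀ d → NonZero (N d)
  N≢0 d = ℕ.m*n≢0 (d !) (2 ℕ.^ d) {{d ℕ.!≢0}} {{ℕ.m^n≢0 2 d}}

  -- When 4d ≤ q, subtracting 2d leaves at least q / 2, so replacing q - 2d by q costs at most a
  -- factor 2^d.
  q^d≤N*c : ∀ q d c → 4 ℕ.* d ℕ.≤ q → (q ∸ 2 ℕ.* d) ℕ.^ d ℕ.≤ d ! ℕ.* c → q ℕ.^ d ℕ.≤ N d ℕ.* c
  q^d≤N*c q d c 4d≤q bound = begin
    q ℕ.^ d                          ≤⟨ ℕ.^-monoˡ-≤ d q≤2[q∸2d] ⟩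
    (2 ℕ.* (q ∸ 2 ℕ.* d)) ℕ.^ d      ≡⟨ ^-distribʳ-* d 2 (q ∸ 2 ℕ.* d) ⟩
    2 ℕ.^ d ℕ.* (q ∸ 2 ℕ.* d) ℕ.^ d  ≤⟨ ℕ.*-monoʳ-≤ (2 ℕ.^ d) bound ⟩
    2 ℕ.^ d ℕ.* (d ! ℕ.* c)
      ≡⟨ solve 3 (λ a b c → a :* (b :* c) := b :* a :* c) refl (2 ℕ.^ d) (d !) c ⟩
    d ! ℕ.* 2 ℕ.^ d ℕ.* c                   ∎
    where
    open ℕ.≤-Reasoning
    open +-*-Solver using (solve; con; _:=_; _:*_; _:+_)

    q≤2[q∸2d] : q ℕ.≤ 2 ℕ.* (q ∸ 2 ℕ.* d)
    q≤2[q∸2d] = begin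
      q            ≡⟨ ℕ.m+n∸n≡m q q ⟨
      q ℕ.+ q ∸ q  ≤⟨ ℕ.∸-monoʳ-≤ (q ℕ.+ q) 4d≤q ⟩
      q ℕ.+ q ∸ 4 ℕ.* d
        ≡⟨ cong₂ _∸_ (solve 1 (λ q → q :+ q := con 2 :* q) refl q) (solve 1 (λ d → con 4 :* d := con 2 :* (con 2 :* d)) refl d) ⟩
      2 ℕ.* q ∸ 2 ℕ.* (2 ℕ.* d)  ≡⟨ ℕ.*-distribˡ-∸ 2 q (2 ℕ.* d) ⟨
      2 ℕ.* (q ∸ 2 ℕ.* d)        ∎

  -- With q = 6 + x the right side exceeds the left by 108x + 432.
  q^3≤[q∸6]^3+18q^2 : ∀ q → 6 ℕ.≤ q → q ℕ.^ 3 ℕ.≤ (q ∸ 6) ℕ.^ 3 ℕ.+ 18 ℕ.* q ℕ.^ 2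
  q^3≤[q∸6]^3+18q^2 q 6≤q = subst (λ q → q ℕ.^ 3 ℕ.≤ x ℕ.^ 3 ℕ.+ 18 ℕ.* q ℕ.^ 2) (ℕ.m+[n∸m]≡n 6≤q) (ℕ.≤-trans
    (ℕ.m≤m+n ((6 ℕ.+ x) ℕ.^ 3) (108 ℕ.* x ℕ.+ 432)) (ℕ.≤-reflexive
      (solve 1 (λ x → (con 6 :+ x) :^ 3 :+ (con 108 :* x :+ con 432) := x :^ 3 :+ con 18 :* (con 6 :+ x) :^ 2) refl x)))
    where
    open +-*-Solver using (solve; con; _:=_; _:*_; _:+_; _:^_)
    x = q ∸ 6

module Combinatorics where
  open import Data.Nat using (_+_; _*_; _^_; _≤_)
  open CommutativeSemigroupProperties ℕ.*-commutativeSemigroup using (x∙yz≈y∙xz; x∙yz≈yx∙z)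
  open ≡ using (refl; sym; trans; cong; cong₂; subst)

  -- Counting in lists, and images under injective maps.

  module _ {A : Set} where

    count : {P : Pred A 0ℓ} → Decidable P → List A → ℕ
    count P? xs = length (filter P? xs)

    count-++ : ∀ {P : Pred A 0ℓ} (P? : Decidable P) xs ys → count P? (xs ++ ys) ≡ count P? xs + count P? ys
    count-++ P? xs ys = trans (cong length (List.filter-++ P? xs ys)) (List.length-++ (filter P? xs))

    count-≐ : ∀ {P Q : Pred A 0ℓ} (P? : Decidable P) (Q? : Decidable Q) →
              (∀ {x} → P x → Q x) → (∀ {x} → Q x → P x) → ∀ xs → count P? xs ≡ count Q? xs
    count-≐ P? Q? P⇒Q Q⇒P xs = cong length (List.filter-≐ P? Q? (P⇒Q , Q⇒P) xs)

    count-none : ∀ {P : Pred A 0ℓ} (P? : Decidable P) → (∀ {x} → ¬ P x) → ∀ xs → count P? xs ≡ 0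
    count-none P? ¬P xs = cong length (List.filter-none P? (All.universal (λ _ → ¬P) xs))

    count-⊆ : ∀ {P Q : Pred A 0ℓ} (P? : Decidable P) (Q? : Decidable Q) →
              (∀ {x} → P x → Q x) → ∀ xs → count P? xs ≤ count Q? xs
    count-⊆ P? Q? P⇒Q []       = z≤n
    count-⊆ P? Q? P⇒Q (x ∷ xs) with count-⊆ P? Q? P⇒Q xs | P? x | Q? x
    ... | ih | no _  | no _  = ih
    ... | ih | no _  | yes _ = ℕ.m≤n⇒m≤1+n ih
    ... | ih | yes _ | yes _ = s≤s ih
    ... | ih | yes p | no ¬q = contradiction (P⇒Q p) ¬q

    count-⊎ : ∀ {P Q R : Pred A 0ℓ} (P? : Decidable P) (Q? : Decidable Q) (R? : Decidable R) →
              (∀ {x} → P x → Q x ⊎ R x) → ∀ xs → count P? xs ≤ count Q? xs + count R? xs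
    count-⊎ P? Q? R? P⇒Q⊎R []       = z≤n
    count-⊎ P? Q? R? P⇒Q⊎R (x ∷ xs) with count-⊎ P? Q? R? P⇒Q⊎R xs | P? x | Q? x | R? x
    ... | ih | no _  | no _   | no _   = ih
    ... | ih | no _  | no _   | yes _  = ℕ.≤-trans (ℕ.m≤n⇒m≤1+n ih) (ℕ.≤-reflexive (sym (ℕ.+-suc _ _)))
    ... | ih | no _  | yes _  | no _   = ℕ.m≤n⇒m≤1+n ih
    ... | ih | no _  | yes _  | yes _  = ℕ.m≤n⇒m≤1+n (ℕ.≤-trans ih (ℕ.+-monoʳ-≤ _ (ℕ.n≤1+n _)))
    ... | ih | yes _ | yes _  | no _   = s≤s ih
    ... | ih | yes _ | yes _  | yes _  = s≤s (ℕ.≤-trans ih (ℕ.+-monoʳ-≤ _ (ℕ.n≤1+n _)))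
    ... | ih | yes _ | no _   | yes _  = ℕ.≤-trans (s≤s ih) (ℕ.≤-reflexive (sym (ℕ.+-suc _ _)))
    ... | ih | yes p | no ¬q  | no ¬r with P⇒Q⊎R p
    ...   | inj₁ q = contradiction q ¬q
    ...   | inj₂ r = contradiction r ¬r

    -- Each element of xs is cut out of ys at one of its occurrences; uniqueness of xs keeps the
    -- later elements in what is left.
    unique-⊆⇒length-≤ : ∀ {xs ys : List A} → Unique xs → (∀ {x} → x ∈ xs → x ∈ ys) → length xs ≤ length ys
    unique-⊆⇒length-≤ {[]}     _              _     = z≤n
    unique-⊆⇒length-≤ {x ∷ xs} x∷xs!@(_ ∷ xs!) xs⊆ys with ∈-∃++ (xs⊆ys (here refl))
    ... | as , bs , refl = ℕ.≤-trans (s≤s (unique-⊆⇒length-≤ xs! xs⊆as++bs)) (ℕ.≤-reflexive lengths)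
      where
      xs⊆as++bs : ∀ {y} → y ∈ xs → y ∈ as ++ bs
      xs⊆as++bs y∈xs with ∈-++⁻ as (xs⊆ys (there y∈xs))
      ... | inj₁ y∈as         = ∈-++⁺ˡ y∈as
      ... | inj₂ (here refl)  = contradiction y∈xs (Unique[x∷xs]⇒x∉xs x∷xs!)
      ... | inj₂ (there y∈bs) = ∈-++⁺ʳ as y∈bs

      lengths : suc (length (as ++ bs)) ≡ length (as ++ x ∷ bs)
      lengths =
        trans (cong suc (List.length-++ as)) (trans (sym (ℕ.+-suc (length as) (length bs))) (sym (List.length-++ as)))

    -- Makes the `image` of an injective map the plain `map` of its elements, so that lengths and
    -- counts can be computed.
    deduplicate-unique : (_≟_ : DecidableEquality A) → ∀ {xs} → Unique xs → deduplicate _≟_ xs ≡ xs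
    deduplicate-unique _≟_ []              = refl
    deduplicate-unique _≟_ {x ∷ xs} (x∉xs ∷ xs!) = cong (x ∷_)
      (trans (cong (filter (¬? ∘ (x ≟_))) (deduplicate-unique _≟_ xs!)) (List.filter-all (¬? ∘ (x ≟_)) x∉xs))

  module _ {A B : Set} where

    filter-map : ∀ {P : Pred B 0ℓ} (P? : Decidable P) (f : A → B) xs →
                 filter P? (List.map f xs) ≡ List.map f (filter (P? ∘ f) xs)
    filter-map P? f []       = refl
    filter-map P? f (x ∷ xs) with P? (f x)
    ... | yes _ = cong (f x ∷_) (filter-map P? f xs)
    ... | no  _ = filter-map P? f xs

    count-map : ∀ {P : Pred B 0ℓ} (P? : Decidable P) (f : A → B) xs → count P? (List.map f xs) ≡ count (P? ∘ f) xs
    count-map P? f xs = trans (cong length (filter-map P? f xs)) (List.length-map f (filter (P? ∘ f) xs))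

  module _ {A B : Set} where

    count-cartesianProduct : ∀ {R : Pred (A × B) 0ℓ} (R? : Decidable R) k xs ys →
      (∀ {x} → x ∈ xs → count (λ y → R? (x , y)) ys ≡ k) → count R? (cartesianProduct xs ys) ≡ k * length xs
    count-cartesianProduct R? k []       ys rows = sym (ℕ.*-zeroʳ k)
    count-cartesianProduct R? k (x ∷ xs) ys rows = begin
      count R? (List.map (x ,_) ys ++ cartesianProduct xs ys)
        ≡⟨ count-++ R? (List.map (x ,_) ys) _ ⟩
      count R? (List.map (x ,_) ys) + count R? (cartesianProduct xs ys)
        ≡⟨ cong₂ _+_ (trans (count-map R? (x ,_) ys) (rows (here refl)))
                     (count-cartesianProduct R? k xs ys (rows ∘ there)) ⟩
      k + k * length xs
        ≡⟨ ℕ.*-suc k (length xs) ⟨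
      k * suc (length xs) ∎
      where open ≡-Reasoning

    InjectiveOn : (A → B) → FinSet A → Set
    InjectiveOn f X = ∀ {a a′} → a ∈ˢ X → a′ ∈ˢ X → f a ≡ f a′ → a ≡ a′

    map-unique : ∀ (f : A → B) {xs} → (∀ {a a′} → a ∈ xs → a′ ∈ xs → f a ≡ f a′ → a ≡ a′) →
                 Unique xs → Unique (List.map f xs)
    map-unique f inj []           = []
    map-unique f inj (x∉xs ∷ xs!) =
      All.map⁺ (All.tabulate λ y∈xs fx≡fy → All.lookup x∉xs y∈xs (inj (here refl) (there y∈xs) fx≡fy))
      ∷ map-unique f (λ a∈xs a′∈xs → inj (there a∈xs) (there a′∈xs)) xs!

    module _ (_≟_ : DecidableEquality B) {f : A → B} {X : FinSet A} (inj : InjectiveOn f X) where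

      elements-image : elements (image _≟_ f X) ≡ List.map f (elements X)
      elements-image = deduplicate-unique _≟_ (map-unique f inj (unique X))

      card-image : card (image _≟_ f X) ≡ card X
      card-image = trans (cong length elements-image) (List.length-map f (elements X))

      image-bijective : BijectiveOn f X (image _≟_ f X)
      image-bijective = record
        { maps-to    = λ a∈X → ∈-deduplicate⁺ _≟_ (∈-map⁺ f a∈X)
        ; injective  = inj
        ; surjective = λ b∈fX → let a , a∈X , b≡fa = ∈-map⁻ f (∈-deduplicate⁻ _≟_ _ b∈fX) in a , a∈X , sym b≡fa
        }

  -- Subsets of a finite index set.

  ∈-allSubsets : ∀ {n} (A : Subset n) → A ∈ allSubsets n
  ∈-allSubsets Vec.[]                = here refl
  ∈-allSubsets (outside Vec.∷ A)     = ∈-++⁺ˡ (∈-map⁺ (outside Vec.∷_) (∈-allSubsets A))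
  ∈-allSubsets {suc n} (inside Vec.∷ A) =
    ∈-++⁺ʳ (List.map (outside Vec.∷_) (allSubsets n)) (∈-map⁺ (inside Vec.∷_) (∈-allSubsets A))

  indices : ∀ {n} → Subset n → List (Fin n)
  indices {n} A = filter (_∈? A) (allFin n)

  -- The tail of `allFin (suc n)` is `tabulate suc`, and membership there does not see the head bit
  -- b; this makes `indices` recursive in both cases.
  filter-∷-∈? : ∀ {n} b (A : Subset n) → filter (_∈? b Vec.∷ A) (List.tabulate Fin.suc) ≡ List.map Fin.suc (indices A)
  filter-∷-∈? {n} b A = begin
    filter (_∈? b Vec.∷ A) (List.tabulate Fin.suc)
      ≡⟨ cong (filter (_∈? b Vec.∷ A)) (List.map-tabulate id Fin.suc) ⟨
    filter (_∈? b Vec.∷ A) (List.map Fin.suc (allFin n))      ≡⟨ filter-map (_∈? b Vec.∷ A) Fin.suc (allFin n) ⟩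
    List.map Fin.suc (filter (λ i → Fin.suc i ∈? b Vec.∷ A) (allFin n))
      ≡⟨ cong (List.map Fin.suc) (List.filter-≐ (λ i → Fin.suc i ∈? b Vec.∷ A) (_∈? A) (drop-there , Vec.there) (allFin n)) ⟩
    List.map Fin.suc (indices A)                              ∎
    where open ≡-Reasoning

  indices-outside : ∀ {n} (A : Subset n) → indices (outside Vec.∷ A) ≡ List.map Fin.suc (indices A)
  indices-outside A = filter-∷-∈? outside A

  indices-inside : ∀ {n} (A : Subset n) → indices (inside Vec.∷ A) ≡ Fin.zero ∷ List.map Fin.suc (indices A)
  indices-inside A = cong (Fin.zero ∷_) (filter-∷-∈? inside A)

  length-indices : ∀ {n} (A : Subset n) → length (indices A) ≡ ∣ A ∣
  length-indices Vec.[]            = refl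
  length-indices (outside Vec.∷ A) =
    trans (cong length (indices-outside A)) (trans (List.length-map Fin.suc (indices A)) (length-indices A))
  length-indices (inside Vec.∷ A)  =
    trans (cong length (indices-inside A)) (cong suc (trans (List.length-map Fin.suc (indices A)) (length-indices A)))

  count-allSubsets : ∀ {n} {P : Pred (Subset (suc n)) 0ℓ} (P? : Decidable P) →
    count P? (allSubsets (suc n)) ≡ count (P? ∘ (outside Vec.∷_)) (allSubsets n) + count (P? ∘ (inside Vec.∷_)) (allSubsets n)
  count-allSubsets {n} P? = trans (count-++ P? (List.map (outside Vec.∷_) (allSubsets n)) _)
    (cong₂ _+_ (count-map P? (outside Vec.∷_) (allSubsets n)) (count-map P? (inside Vec.∷_) (allSubsets n)))

  -- Bounds for binomial coefficients.

  nC0≡1 : ∀ n → n C 0 ≡ 1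
  nC0≡1 n = trans (nCk≡nC[n∸k] {0} {n} z≤n) (nCn≡1 n)

  -- Subtraction-free form of (k + 1) C(n, k + 1) = (n - k) C(n, k), which therefore also covers k >
  -- n. Pascal's rule on each binomial with upper index n + 1 reduces it to the cases (n, k + 1) and
  -- (n, k).
  [k+1]nC[k+1]+k*nCk≡n*nCk : ∀ n k → suc k * (n C suc k) + k * (n C k) ≡ n * (n C k)
  [k+1]nC[k+1]+k*nCk≡n*nCk n zero    = begin
    1 * (n C 1) + 0  ≡⟨ ℕ.+-identityʳ _ ⟩
    1 * (n C 1)      ≡⟨ ℕ.*-identityˡ _ ⟩
    n C 1            ≡⟨ nC1≡n n ⟩
    n                ≡⟨ ℕ.*-identityʳ n ⟨
    n * 1            ≡⟨ cong (n *_) (nC0≡1 n) ⟨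
    n * (n C 0)      ∎
    where open ≡-Reasoning
  [k+1]nC[k+1]+k*nCk≡n*nCk zero (suc k) = trans
    (cong₂ (λ x y → suc (suc k) * x + suc k * y) (k>n⇒nCk≡0 {0} {suc (suc k)} (s≤s z≤n)) (k>n⇒nCk≡0 {0} {suc k} (s≤s z≤n)))
    (cong₂ _+_ (ℕ.*-zeroʳ k) (ℕ.*-zeroʳ k))
  [k+1]nC[k+1]+k*nCk≡n*nCk (suc n) (suc k) = begin
    suc (suc k) * (suc n C suc (suc k)) + suc k * (suc n C suc k)
      ≡⟨ cong₂ (λ x y → suc (suc k) * x + suc k * y) (nCk+nC[k+1]≡[n+1]C[k+1] n (suc k)) (nCk+nC[k+1]≡[n+1]C[k+1] n k) ⟨
    suc (suc k) * (b + c) + suc k * (a + b)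
      ≡⟨ solve 4 (λ a b c k → (con 2 :+ k) :* (b :+ c) :+ (con 1 :+ k) :* (a :+ b)
                    := ((con 2 :+ k) :* c :+ (con 1 :+ k) :* b) :+ b :+ (((con 1 :+ k) :* b :+ k :* a) :+ a)) refl a b c k ⟩
    (suc (suc k) * c + suc k * b) + b + ((suc k * b + k * a) + a)
      ≡⟨ cong₂ (λ x y → x + b + (y + a)) ([k+1]nC[k+1]+k*nCk≡n*nCk n (suc k)) ([k+1]nC[k+1]+k*nCk≡n*nCk n k) ⟩
    n * b + b + (n * a + a)
      ≡⟨ solve 3 (λ a b n → n :* b :+ b :+ (n :* a :+ a) := (con 1 :+ n) :* (a :+ b)) refl a b n ⟩
    suc n * (a + b)
      ≡⟨ cong (suc n *_) (nCk+nC[k+1]≡[n+1]C[k+1] n k) ⟩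
    suc n * (suc n C suc k) ∎
    where
    open ≡-Reasoning
    open +-*-Solver using (solve; con; _:=_; _:+_; _:*_)
    a b c : ℕ
    a = n C k
    b = n C suc k
    c = n C suc (suc k)

  nCk≤n^k : ∀ n k → n C k ≤ n ^ k
  nCk≤n^k n zero    = ℕ.≤-reflexive (nC0≡1 n)
  nCk≤n^k n (suc k) = begin
    n C suc k                          ≤⟨ ℕ.m≤m+n _ _ ⟩
    suc k * (n C suc k)                ≤⟨ ℕ.m≤m+n _ _ ⟩
    suc k * (n C suc k) + k * (n C k)  ≡⟨ [k+1]nC[k+1]+k*nCk≡n*nCk n k ⟩
    n * (n C k)                        ≤⟨ ℕ.*-monoʳ-≤ n (nCk≤n^k n k) ⟩
    n * n ^ k                          ∎
    where open ℕ.≤-Reasoning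

  -- k! C(n, k) is the falling factorial n (n - 1) ... (n - k + 1), and each of its factors is at
  -- least n - D.
  [n∸k]^k≤k!*nCk : ∀ n D k → k ≤ D → (n ∸ D) ^ k ≤ k ! * (n C k)
  [n∸k]^k≤k!*nCk n D zero    k≤D = ℕ.≤-reflexive (sym (trans (ℕ.*-identityˡ _) (nC0≡1 n)))
  [n∸k]^k≤k!*nCk n D (suc k) k<D = begin
    (n ∸ D) * (n ∸ D) ^ k              ≤⟨ ℕ.*-mono-≤ (ℕ.∸-monoʳ-≤ n k≤D) ([n∸k]^k≤k!*nCk n D k k≤D) ⟩
    (n ∸ k) * (k ! * (n C k))          ≡⟨ x∙yz≈y∙xz (n ∸ k) (k !) (n C k) ⟩
    k ! * ((n ∸ k) * (n C k))          ≡⟨ cong (k ! *_) (ℕ.*-distribʳ-∸ (n C k) n k) ⟩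
    k ! * (n * (n C k) ∸ k * (n C k))  ≡⟨ cong (λ x → k ! * (x ∸ k * (n C k))) ([k+1]nC[k+1]+k*nCk≡n*nCk n k) ⟨
    k ! * (suc k * (n C suc k) + k * (n C k) ∸ k * (n C k))
                                         ≡⟨ cong (k ! *_) (ℕ.m+n∸n≡m (suc k * (n C suc k)) (k * (n C k))) ⟩
    k ! * (suc k * (n C suc k))  ≡⟨ x∙yz≈yx∙z (k !) (suc k) (n C suc k) ⟩
    suc k ! * (n C suc k)        ∎
    where
    open ℕ.≤-Reasoning
    k≤D : k ≤ D
    k≤D = ℕ.<⇒≤ k<D

  -- Put d = j + 1. As d C(n, d) = (n - j) C(n, j), the hypothesis gives d c ≥ (n - j - d) C(n, j) ≥
  -- (n - 2d) C(n, j). Multiplying by j! and bounding j! C(n, j) below by (n - 2d)^j produces the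
  -- power d.
  nC[k+1]≤c+nCk⇒[n∸2[k+1]]^[k+1]≤[k+1]!*c : ∀ n j c → n C suc j ≤ c + n C j → (n ∸ 2 * suc j) ^ suc j ≤ suc j ! * c
  nC[k+1]≤c+nCk⇒[n∸2[k+1]]^[k+1]≤[k+1]!*c n j c excluded = begin
    (n ∸ D) * (n ∸ D) ^ j
      ≤⟨ ℕ.*-monoʳ-≤ (n ∸ D) ([n∸k]^k≤k!*nCk n D j (ℕ.≤-trans (ℕ.n≤1+n j) (ℕ.m≤m+n d (d + 0)))) ⟩
    (n ∸ D) * (j ! * (n C j))
      ≡⟨ x∙yz≈y∙xz (n ∸ D) (j !) (n C j) ⟩
    j ! * ((n ∸ D) * (n C j))
      ≤⟨ ℕ.*-monoʳ-≤ (j !) bound ⟩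
    j ! * (d * c)
      ≡⟨ x∙yz≈yx∙z (j !) d c ⟩
    d ! * c ∎
    where
    open ℕ.≤-Reasoning
    d = suc j
    D = 2 * d

    total : n * (n C j) ≤ d * c + D * (n C j)
    total = begin
      n * (n C j)                          ≡⟨ [k+1]nC[k+1]+k*nCk≡n*nCk n j ⟨
      d * (n C d) + j * (n C j)            ≤⟨ ℕ.+-monoˡ-≤ _ (ℕ.*-monoʳ-≤ d excluded) ⟩
      d * (c + n C j) + j * (n C j)        ≡⟨ cong (_+ j * (n C j)) (ℕ.*-distribˡ-+ d c (n C j)) ⟩
      d * c + d * (n C j) + j * (n C j)    ≡⟨ ℕ.+-assoc (d * c) _ _ ⟩
      d * c + (d * (n C j) + j * (n C j))  ≡⟨ cong (d * c +_) (ℕ.*-distribʳ-+ (n C j) d j) ⟨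
      d * c + (d + j) * (n C j)
        ≤⟨ ℕ.+-monoʳ-≤ (d * c) (ℕ.*-monoˡ-≤ (n C j) (ℕ.+-monoʳ-≤ d (ℕ.≤-trans (ℕ.n≤1+n j) (ℕ.m≤m+n d 0)))) ⟩
      d * c + D * (n C j)                     ∎

    bound : (n ∸ D) * (n C j) ≤ d * c
    bound = begin
      (n ∸ D) * (n C j)                  ≡⟨ ℕ.*-distribʳ-∸ (n C j) n D ⟩
      n * (n C j) ∸ D * (n C j)          ≤⟨ ℕ.∸-monoˡ-≤ (D * (n C j)) total ⟩
      d * c + D * (n C j) ∸ D * (n C j)  ≡⟨ ℕ.m+n∸n≡m (d * c) (D * (n C j)) ⟩
      d * c                              ∎

  -- Splitting the subsets by whether they contain the first index is Pascal's rule.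
  count-ofSize : ∀ n k → count (λ A → ∣ A ∣ ℕ.≟ k) (allSubsets n) ≡ n C k
  count-ofSize zero    zero    = refl
  count-ofSize zero    (suc k) = sym (k>n⇒nCk≡0 {0} {suc k} (s≤s z≤n))
  count-ofSize (suc n) zero    = begin
    count (λ A → ∣ A ∣ ℕ.≟ 0) (allSubsets (suc n))
      ≡⟨ count-allSubsets {n} (λ A → ∣ A ∣ ℕ.≟ 0) ⟩
    count (λ A → ∣ A ∣ ℕ.≟ 0) (allSubsets n) + count (λ A → suc ∣ A ∣ ℕ.≟ 0) (allSubsets n)
      ≡⟨ cong₂ _+_ (count-ofSize n 0) (count-none (λ A → suc ∣ A ∣ ℕ.≟ 0) (λ ()) (allSubsets n)) ⟩
    n C 0 + 0
      ≡⟨ ℕ.+-identityʳ _ ⟩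
    n C 0
      ≡⟨ trans (nC0≡1 n) (sym (nC0≡1 (suc n))) ⟩
    suc n C 0 ∎
    where open ≡-Reasoning
  count-ofSize (suc n) (suc k) = begin
    count (λ A → ∣ A ∣ ℕ.≟ suc k) (allSubsets (suc n))
      ≡⟨ count-allSubsets {n} (λ A → ∣ A ∣ ℕ.≟ suc k) ⟩
    count (λ A → ∣ A ∣ ℕ.≟ suc k) (allSubsets n) + count (λ A → suc ∣ A ∣ ℕ.≟ suc k) (allSubsets n)
      ≡⟨ cong₂ _+_ (count-ofSize n (suc k))
           (trans (count-≐ (λ A → suc ∣ A ∣ ℕ.≟ suc k) (λ A → ∣ A ∣ ℕ.≟ k) ℕ.suc-injective (cong suc) (allSubsets n)) (count-ofSize n k)) ⟩
    n C suc k + n C k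
      ≡⟨ ℕ.+-comm (n C suc k) (n C k) ⟩
    n C k + n C suc k
      ≡⟨ nCk+nC[k+1]≡[n+1]C[k+1] n k ⟩
    suc n C suc k ∎
    where open ≡-Reasoning

  -- Pigeonhole: if y were missed, punching it out would embed `Fin (suc n)` into `Fin n`.
  injective⇒surjective : ∀ {n} (f : Fin n → Fin n) → Injective _≡_ _≡_ f → ∀ y → ∃[ x ] f x ≡ y
  injective⇒surjective {suc n} f f-inj y with Fin.any? (λ x → f x Fin.≟ y)
  ... | yes ∃x = ∃x
  ... | no  ∄x = contradiction (Fin.injective⇒≤ punch-inj) ℕ.1+n≰n
    where
    y≢f : ∀ x → y ≢ f x
    y≢f x y≡fx = ∄x (x , sym y≡fx)

    punch-inj : Injective _≡_ _≡_ (λ x → punchOut (y≢f x))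
    punch-inj {x} {x′} eq = f-inj (Fin.punchOut-injective (y≢f x) (y≢f x′) eq)

  funToFin-cong : ∀ {m n} {f g : Fin m → Fin n} → (∀ i → f i ≡ g i) → funToFin f ≡ funToFin g
  funToFin-cong {zero}  f≗g = refl
  funToFin-cong {suc m} f≗g = cong₂ Fin.combine (f≗g Fin.zero) (funToFin-cong (f≗g ∘ Fin.suc))

  -- Exhausts the exponents of a polynomial `Ψ` of degree d = 3 + k: the constant term, the degrees
  -- `deg j` from 1 to k + 1, then d - 1, d and everything above.
  degrees : ∀ {k} (P : ℕ → Set) → P 0 → (∀ (j : Fin (suc k)) → P (suc (toℕ j))) →
    P (2 ℕ.+ k) → P (3 ℕ.+ k) → (∀ {n} → 3 ℕ.+ k ℕ.< n → P n) → ∀ n → P n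
  degrees P P₀ Pdeg P₂₊ₖ P₃₊ₖ P> zero = P₀
  degrees {k} P P₀ Pdeg P₂₊ₖ P₃₊ₖ P> (suc n) with ℕ.<-cmp n (suc k)
  ... | tri< n<1+k _ _ = subst (λ n → P (suc n)) (Fin.toℕ-fromℕ< n<1+k) (Pdeg (fromℕ< n<1+k))
  ... | tri≈ _ refl _  = P₂₊ₖ
  ... | tri> _ _ 1+k<n with ℕ.<-cmp n (suc (suc k))
  ...   | tri< n<2+k _ _ = contradiction (ℕ.≤-trans n<2+k 1+k<n) ℕ.1+n≰n
  ...   | tri≈ _ refl _  = P₃₊ₖ
  ...   | tri> _ _ 2+k<n = P> (s≤s 2+k<n)

open Arithmetic
open Combinatorics

-- Finite fields.

module FiniteFieldProperties {q} (F : FiniteField q) where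
  open ≡ using (refl; sym; trans; cong; cong₂; subst)
  open FiniteField F
  open CommutativeRing commutativeRing using
    ( +-comm; +-identityˡ; +-identityʳ; *-comm; *-assoc; *-identityˡ; zeroˡ; zeroʳ; -‿inverseʳ
    ; ring; +-commutativeMonoid; semiring )
  open RingProperties ring using (-‿involutive; -0#≈0#; x∙y⁻¹≈ε⇒x≈y) public
  open Sum +-commutativeMonoid using (sum; ∑-distrib-+; sum-permute; sum-replicate; sum-cong-≗; sum-replicate-zero)
  open IntegerSolver commutativeRing using (solve; con; _:=_; _:+_; _:*_; _:-_; :-_)
  open Polynomials F
  open Mult semiring using (×1-homo-*) renaming (_×_ to _·_)
  open ≡-Reasoning

  index-element : ∀ i → index (element i) ≡ i
  index-element = Inverse.strictlyInverseʳ enumeration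

  element-index : ∀ x → element (index x) ≡ x
  element-index = Inverse.strictlyInverseˡ enumeration

  element-injective : ∀ {i j} → element i ≡ element j → i ≡ j
  element-injective {i} {j} eq = trans (sym (index-element i)) (trans (cong index eq) (index-element j))

  *-inverseˡ : ∀ {x} → x ≢ 0# → x ⁻¹ * x ≡ 1#
  *-inverseˡ x≢0 = trans (*-comm _ _) (*-inverse x≢0)

  xy≡0⇒y≡0 : ∀ {x y} → x ≢ 0# → x * y ≡ 0# → y ≡ 0#
  xy≡0⇒y≡0 {x} {y} x≢0 xy≡0 = begin
    y               ≡⟨ *-identityˡ y ⟨
    1# * y          ≡⟨ cong (_* y) (*-inverseˡ x≢0) ⟨
    x ⁻¹ * x * y    ≡⟨ *-assoc _ _ _ ⟩
    x ⁻¹ * (x * y)  ≡⟨ cong (x ⁻¹ *_) xy≡0 ⟩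
    x ⁻¹ * 0#       ≡⟨ zeroʳ _ ⟩
    0#              ∎

  *-cancelˡ : ∀ {x y z} → x ≢ 0# → x * y ≡ x * z → y ≡ z
  *-cancelˡ {x} {y} {z} x≢0 xy≡xz = begin
    y               ≡⟨ *-identityˡ y ⟨
    1# * y          ≡⟨ cong (_* y) (*-inverseˡ x≢0) ⟨
    x ⁻¹ * x * y    ≡⟨ *-assoc _ _ _ ⟩
    x ⁻¹ * (x * y)  ≡⟨ cong (x ⁻¹ *_) xy≡xz ⟩
    x ⁻¹ * (x * z)  ≡⟨ *-assoc _ _ _ ⟨
    x ⁻¹ * x * z    ≡⟨ cong (_* z) (*-inverseˡ x≢0) ⟩
    1# * z          ≡⟨ *-identityˡ z ⟩
    z               ∎

  +-cancelˡ : ∀ x {y z} → x + y ≡ x + z → y ≡ z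
  +-cancelˡ x {y} {z} eq = begin
    y          ≡⟨ solve 2 (λ x y → y := x :+ y :- x) refl x y ⟩
    x + y - x  ≡⟨ cong (_- x) eq ⟩
    x + z - x  ≡⟨ solve 2 (λ x z → x :+ z :- x := z) refl x z ⟩
    z          ∎

  -- Translation by 1 permutes the field, so the sum of all elements is
  -- unchanged by adding q · 1.
  q·1≡0 : q · 1# ≡ 0#
  q·1≡0 = +-cancelˡ (sum element) (begin
    sum element + q · 1#                       ≡⟨ cong (sum element +_) (sum-replicate q) ⟨
    sum element + sum (Vector.replicate q 1#)  ≡⟨ ∑-distrib-+ element (Vector.replicate q 1#) ⟨
    sum (λ i → element i + 1#)
      ≡⟨ sum-cong-≗ {q} {λ i → element i + 1#} {element ∘ (Perm._⟨$⟩ʳ_ shift)} (λ i → sym (element-index _)) ⟩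
    sum (element ∘ (Perm._⟨$⟩ʳ_ shift))  ≡⟨ sum-permute element shift ⟨
    sum element                          ≡⟨ +-identityʳ _ ⟨
    sum element + 0#                     ∎)
    where
    shift : Perm.Permutation q q
    shift = Perm.permutation (λ i → index (element i + 1#)) (λ i → index (element i - 1#))
      (λ i → trans (cong (λ x → index (x + 1#)) (element-index _))
        (trans (cong index (solve 2 (λ x y → x :- y :+ y := x) refl (element i) 1#)) (index-element i)))
      (λ i → trans (cong (λ x → index (x - 1#)) (element-index _))
        (trans (cong index (solve 2 (λ x y → x :+ y :- y := x) refl (element i) 1#)) (index-element i)))

  -- An odd q is 1 + 2j, so 2 = 0 would give q · 1 = 1, while q · 1 = 0.
  2#≢0 : OddPrimePower q → 2# ≢ 0#
  2#≢0 q-odd 2≡0 with oddPrimePower-odd q-odd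
  ... | j , q≡1+2j = 0≢1 (begin
    0#                      ≡⟨ q·1≡0 ⟨
    q · 1#                  ≡⟨ cong (_· 1#) q≡1+2j ⟩
    1# + (j ℕ.* 2) · 1#     ≡⟨ cong (λ x → 1# + x) (×1-homo-* j 2) ⟩
    1# + j · 1# * (2 · 1#)  ≡⟨ cong (λ x → 1# + j · 1# * x) (trans (cong (λ x → 1# + x) (+-identityʳ 1#)) 2≡0) ⟩
    1# + j · 1# * 0#        ≡⟨ cong (λ x → 1# + x) (zeroʳ _) ⟩
    1# + 0#                 ≡⟨ +-identityʳ _ ⟩
    1#                      ∎)

  sum-single : ∀ {n} (h : Fin n → Carrier) i → (∀ j → j ≢ i → h j ≡ 0#) → sum h ≡ h i
  sum-single {suc n} h Fin.zero    h≡0 = begin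
    h Fin.zero + sum (h ∘ Fin.suc)
      ≡⟨ cong (h Fin.zero +_) (sum-cong-≗ {n} {h ∘ Fin.suc} {λ _ → 0#} (λ j → h≡0 (Fin.suc j) λ ())) ⟩
    h Fin.zero + sum (Vector.replicate n 0#)  ≡⟨ cong (h Fin.zero +_) (sum-replicate-zero n) ⟩
    h Fin.zero + 0#                           ≡⟨ +-identityʳ _ ⟩
    h Fin.zero                                ∎
  sum-single {suc n} h (Fin.suc i) h≡0 = begin
    h Fin.zero + sum (h ∘ Fin.suc)
      ≡⟨ cong₂ _+_ (h≡0 Fin.zero λ ()) (sum-single (h ∘ Fin.suc) i (λ j j≢i → h≡0 (Fin.suc j) λ { refl → j≢i refl })) ⟩
    0# + h (Fin.suc i)  ≡⟨ +-identityˡ _ ⟩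
    h (Fin.suc i)       ∎

  -- Coefficients, values and roots of polynomials.

  coeff-+ₚ : ∀ f g n → coeff (f +ₚ g) n ≡ coeff f n + coeff g n
  coeff-+ₚ []      g       n       = sym (+-identityˡ _)
  coeff-+ₚ (a ∷ f) []      n       = sym (+-identityʳ _)
  coeff-+ₚ (a ∷ f) (b ∷ g) zero    = refl
  coeff-+ₚ (a ∷ f) (b ∷ g) (suc n) = coeff-+ₚ f g n

  coeff-scale : ∀ a f n → coeff (List.map (a *_) f) n ≡ a * coeff f n
  coeff-scale a []      n       = sym (zeroʳ a)
  coeff-scale a (b ∷ f) zero    = refl
  coeff-scale a (b ∷ f) (suc n) = coeff-scale a f n

  coeff-sumₚ : ∀ {m} (h : Fin m → Poly) n → coeff (sumₚ h) n ≡ sum (λ j → coeff (h j) n)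
  coeff-sumₚ {zero}  h n = refl
  coeff-sumₚ {suc m} h n =
    trans (coeff-+ₚ (h Fin.zero) _ n) (cong (coeff (h Fin.zero) n +_) (coeff-sumₚ (h ∘ Fin.suc) n))

  coeff-T^ : ∀ a n → coeff (a T^ n) n ≡ a
  coeff-T^ a zero    = refl
  coeff-T^ a (suc n) = coeff-T^ a n

  coeff-T^-≢ : ∀ a {k n} → n ≢ k → coeff (a T^ k) n ≡ 0#
  coeff-T^-≢ a {zero}  {zero}  n≢k = contradiction refl n≢k
  coeff-T^-≢ a {zero}  {suc n} n≢k = refl
  coeff-T^-≢ a {suc k} {zero}  n≢k = refl
  coeff-T^-≢ a {suc k} {suc n} n≢k = coeff-T^-≢ a {k} {n} (n≢k ∘ cong suc)

  eval : Poly → Carrier → Carrier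
  eval []      t = 0#
  eval (a ∷ f) t = a + t * eval f t

  eval-+ₚ : ∀ f g t → eval (f +ₚ g) t ≡ eval f t + eval g t
  eval-+ₚ []      g       t = sym (+-identityˡ _)
  eval-+ₚ (a ∷ f) []      t = sym (+-identityʳ _)
  eval-+ₚ (a ∷ f) (b ∷ g) t = trans (cong (λ x → a + b + t * x) (eval-+ₚ f g t))
    (solve 5 (λ a b t x y → a :+ b :+ t :* (x :+ y) := a :+ t :* x :+ (b :+ t :* y)) refl a b t (eval f t) (eval g t))

  eval-scale : ∀ a f t → eval (List.map (a *_) f) t ≡ a * eval f t
  eval-scale a []      t = sym (zeroʳ a)
  eval-scale a (b ∷ f) t = trans (cong (λ x → a * b + t * x) (eval-scale a f t))
    (solve 4 (λ a b t x → a :* b :+ t :* (a :* x) := a :* (b :+ t :* x)) refl a b t (eval f t))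

  eval-*ₚ : ∀ f g t → eval (f *ₚ g) t ≡ eval f t * eval g t
  eval-*ₚ []      g t = sym (zeroˡ _)
  eval-*ₚ (a ∷ f) g t = begin
    eval (List.map (a *_) g +ₚ (0# ∷ f *ₚ g)) t           ≡⟨ eval-+ₚ (List.map (a *_) g) _ t ⟩
    eval (List.map (a *_) g) t + (0# + t * eval (f *ₚ g) t)
      ≡⟨ cong₂ (λ x y → x + (0# + t * y)) (eval-scale a g t) (eval-*ₚ f g t) ⟩
    a * eval g t + (0# + t * (eval f t * eval g t))
      ≡⟨ solve 4 (λ a t x y → a :* y :+ (con 0ℤ :+ t :* (x :* y)) := (a :+ t :* x) :* y) refl a t (eval f t) (eval g t) ⟩
    (a + t * eval f t) * eval g t ∎

  eval-sumₚ : ∀ {m} (h : Fin m → Poly) t → eval (sumₚ h) t ≡ sum (λ j → eval (h j) t)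
  eval-sumₚ {zero}  h t = refl
  eval-sumₚ {suc m} h t = trans (eval-+ₚ (h Fin.zero) _ t) (cong (eval (h Fin.zero) t +_) (eval-sumₚ (h ∘ Fin.suc) t))

  eval-T^ : ∀ a n t → eval (a T^ n) t ≡ a * t ^ n
  eval-T^ a zero    t = solve 2 (λ a t → a :+ t :* con 0ℤ := a :* con 1ℤ) refl a t
  eval-T^ a (suc n) t = trans (cong (λ x → 0# + t * x) (eval-T^ a n t))
    (solve 3 (λ a t x → con 0ℤ :+ t :* (a :* x) := a :* (t :* x)) refl a t (t ^ n))

  eval-0 : ∀ f t → (∀ n → coeff f n ≡ 0#) → eval f t ≡ 0#
  eval-0 []      t f≈0 = refl
  eval-0 (a ∷ f) t f≈0 = trans (cong₂ (λ x y → x + t * y) (f≈0 0) (eval-0 f t (f≈0 ∘ suc)))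
    (trans (+-identityˡ _) (zeroʳ t))

  eval-cong : ∀ f g t → f ≈ₚ g → eval f t ≡ eval g t
  eval-cong []      g       t f≈g = sym (eval-0 g t (sym ∘ f≈g))
  eval-cong (a ∷ f) []      t f≈g = eval-0 (a ∷ f) t f≈g
  eval-cong (a ∷ f) (b ∷ g) t f≈g = cong₂ (λ x y → x + t * y) (f≈g 0) (eval-cong f g t (f≈g ∘ suc))

  T- : Carrier → Poly
  T- a = 1# T^ 1 +ₚ (- a) T^ 0

  coeff-T-* : ∀ a f n → coeff (T- a *ₚ f) (suc n) ≡ - a * coeff f (suc n) + coeff f n
  coeff-T-* a f n = begin
    -- `T- a` computes to the list with entries `0# - a` and `1#`; the final `0# ∷ []` is the
    -- shifted empty product.
    coeff (List.map ((0# - a) *_) f +ₚ (0# ∷ (List.map (1# *_) f +ₚ (0# ∷ [])))) (suc n)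
      ≡⟨ coeff-+ₚ (List.map ((0# - a) *_) f) _ (suc n) ⟩
    coeff (List.map ((0# - a) *_) f) (suc n) + coeff (List.map (1# *_) f +ₚ (0# ∷ [])) n
      ≡⟨ cong₂ _+_ (coeff-scale (0# - a) f (suc n)) (trans (coeff-+ₚ (List.map (1# *_) f) _ n) (cong₂ _+_ (coeff-scale 1# f n) (coeff-0 n))) ⟩
    (0# - a) * coeff f (suc n) + (1# * coeff f n + 0#)
      ≡⟨ solve 3 (λ a x y → (con 0ℤ :- a) :* x :+ (con 1ℤ :* y :+ con 0ℤ) := :- a :* x :+ y) refl a (coeff f (suc n)) (coeff f n) ⟩
    - a * coeff f (suc n) + coeff f n ∎
    where
    coeff-0 : ∀ n → coeff (0# ∷ []) n ≡ 0#
    coeff-0 zero    = refl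
    coeff-0 (suc n) = refl

  coeff-T-*-zero : ∀ a f → coeff (T- a *ₚ f) 0 ≡ - a * coeff f 0
  coeff-T-*-zero a f = trans (coeff-+ₚ (List.map ((0# - a) *_) f) _ 0)
    (trans (+-identityʳ _) (trans (coeff-scale (0# - a) f 0) (cong (_* coeff f 0) (+-identityˡ (- a)))))

  eval-T- : ∀ a t → eval (T- a) t ≡ t - a
  eval-T- a t = solve 2 (λ a t → con 0ℤ :- a :+ t :* (con 1ℤ :+ t :* con 0ℤ) := t :- a) refl a t

  -- Taken over lists so that induction is possible; `∏T- (members A)` is `fromRoots A` by
  -- computation.
  ∏T- : List Carrier → Poly
  ∏T- = foldr (λ a f → T- a *ₚ f) (1# T^ 0)

  coeff-∏-> : ∀ as {n} → length as ℕ.< n → coeff (∏T- as) n ≡ 0#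
  coeff-∏-> []       {suc n} _             = refl
  coeff-∏-> (a ∷ as) {suc n} (s≤s |as|<n)  = begin
    coeff (T- a *ₚ ∏T- as) (suc n)                        ≡⟨ coeff-T-* a (∏T- as) n ⟩
    - a * coeff (∏T- as) (suc n) + coeff (∏T- as) n
      ≡⟨ cong₂ (λ x y → - a * x + y) (coeff-∏-> as (ℕ.m<n⇒m<1+n |as|<n)) (coeff-∏-> as |as|<n) ⟩
    - a * 0# + 0#
      ≡⟨ solve 1 (λ a → :- a :* con 0ℤ :+ con 0ℤ := con 0ℤ) refl a ⟩
    0#                                                    ∎

  coeff-∏-leading : ∀ as → coeff (∏T- as) (length as) ≡ 1#
  coeff-∏-leading []       = refl
  coeff-∏-leading (a ∷ as) = begin
    coeff (T- a *ₚ ∏T- as) (suc (length as))              ≡⟨ coeff-T-* a (∏T- as) (length as) ⟩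
    - a * coeff (∏T- as) (suc (length as)) + coeff (∏T- as) (length as)
                                                          ≡⟨ cong₂ (λ x y → - a * x + y) (coeff-∏-> as ℕ.≤-refl) (coeff-∏-leading as) ⟩
    - a * 0# + 1#
      ≡⟨ solve 1 (λ a → :- a :* con 0ℤ :+ con 1ℤ := con 1ℤ) refl a ⟩
    1#                                                    ∎

  -- Vieta's formula for the sum of the roots; it turns the condition on `sumOver` in `𝔄` into one
  -- on a coefficient of `fromRoots A`.
  coeff-∏-subleading : ∀ as {n} → length as ≡ suc n → coeff (∏T- as) n ≡ - foldr _+_ 0# as
  coeff-∏-subleading (a ∷ [])     {zero} refl  = trans (coeff-T-*-zero a (1# ∷ []))
    (solve 1 (λ a → :- a :* con 1ℤ := :- (a :+ con 0ℤ)) refl a)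
  coeff-∏-subleading (a ∷ b ∷ as) {suc n} refl = begin
    coeff (T- a *ₚ ∏T- (b ∷ as)) (suc (length as))
      ≡⟨ coeff-T-* a (∏T- (b ∷ as)) (length as) ⟩
    - a * coeff (∏T- (b ∷ as)) (suc (length as)) + coeff (∏T- (b ∷ as)) (length as)
      ≡⟨ cong₂ (λ x y → - a * x + y) (coeff-∏-leading (b ∷ as)) (coeff-∏-subleading (b ∷ as) refl) ⟩
    - a * 1# - foldr _+_ 0# (b ∷ as)
      ≡⟨ solve 2 (λ a x → :- a :* con 1ℤ :- x := :- (a :+ x)) refl a (foldr _+_ 0# (b ∷ as)) ⟩
    - (a + foldr _+_ 0# (b ∷ as)) ∎

  eval-T-* : ∀ a f t → eval (T- a *ₚ f) t ≡ (t - a) * eval f t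
  eval-T-* a f t = trans (eval-*ₚ (T- a) f t) (cong (_* eval f t) (eval-T- a t))

  -- A product in a field vanishes only if one of its factors does.
  ∏T-≡0⇔∈ : ∀ as t → eval (∏T- as) t ≡ 0# ⇔ t ∈ as
  ∏T-≡0⇔∈ as t = mk⇔ (to as) (from as)
    where
    to : ∀ as → eval (∏T- as) t ≡ 0# → t ∈ as
    to []       1≡0 = contradiction (trans (sym 1≡0) (solve 1 (λ t → con 1ℤ :+ t :* con 0ℤ := con 1ℤ) refl t)) 0≢1
    to (a ∷ as) ev≡0 with t ≟ a
    ... | yes t≡a = here t≡a
    ... | no  t≢a = there (to as (xy≡0⇒y≡0 (t≢a ∘ x∙y⁻¹≈ε⇒x≈y t a) (trans (sym (eval-T-* a (∏T- as) t)) ev≡0)))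

    from : ∀ as → t ∈ as → eval (∏T- as) t ≡ 0#
    from (a ∷ as) (here refl)  =
      trans (eval-T-* a (∏T- as) t) (trans (cong (_* eval (∏T- as) t) (-‿inverseʳ t)) (zeroˡ _))
    from (a ∷ as) (there t∈as) = trans (eval-T-* a (∏T- as) t) (trans (cong ((t - a) *_) (from as t∈as)) (zeroʳ _))

  ∈-members⇔∈ᶠ : ∀ A t → t ∈ members A ⇔ t ∈ᶠ A
  ∈-members⇔∈ᶠ A t = mk⇔ to from
    where
    to : t ∈ members A → t ∈ᶠ A
    to t∈ with ∈-map⁻ element t∈
    ... | i , i∈ , refl = subst (Subset._∈ A) (sym (index-element i)) (proj₂ (∈-filter⁻ (_∈? A) {xs = allFin q} i∈))

    from : t ∈ᶠ A → t ∈ members A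
    from i∈A = subst (_∈ members A) (element-index t) (∈-map⁺ element (∈-filter⁺ (_∈? A) (∈-allFin (index t)) i∈A))

  length-members : ∀ A → length (members A) ≡ ∣ A ∣
  length-members A = trans (List.length-map element (indices A)) (length-indices A)

  -- Counting subsets of given size and given element sum.

  -- `weight element A` is `sumOver A` by computation. Arbitrary weights are allowed because
  -- deleting the first index replaces w by `w ∘ suc`, which no longer enumerates the field.
  weight : ∀ {n} → (Fin n → Carrier) → Subset n → Carrier
  weight w A = foldr _+_ 0# (List.map w (indices A))

  weight-outside : ∀ {n} (w : Fin (suc n) → Carrier) A → weight w (outside Vec.∷ A) ≡ weight (w ∘ Fin.suc) A
  weight-outside w A =
    cong (foldr _+_ 0#) (trans (cong (List.map w) (indices-outside A)) (sym (List.map-∘ (indices A))))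

  weight-inside : ∀ {n} (w : Fin (suc n) → Carrier) A → weight w (inside Vec.∷ A) ≡ w Fin.zero + weight (w ∘ Fin.suc) A
  weight-inside w A =
    cong (foldr _+_ 0#) (trans (cong (List.map w) (indices-inside A)) (cong (w Fin.zero ∷_) (sym (List.map-∘ (indices A)))))

  weight-empty : ∀ {n} (w : Fin n → Carrier) A → ∣ A ∣ ≡ 0 → weight w A ≡ 0#
  weight-empty w Vec.[]            _    = refl
  weight-empty w (outside Vec.∷ A) |A|≡0 = trans (weight-outside w A) (weight-empty (w ∘ Fin.suc) A |A|≡0)

  weight-singleton : ∀ {n} (w : Fin n → Carrier) A → ∣ A ∣ ≡ 1 → ∃[ i ] weight w A ≡ w i
  weight-singleton w (outside Vec.∷ A) |A|≡1 with weight-singleton (w ∘ Fin.suc) A |A|≡1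
  ... | i , eq = Fin.suc i , trans (weight-outside w A) eq
  weight-singleton w (inside Vec.∷ A)  |A|≡1 = Fin.zero ,
    trans (weight-inside w A) (trans (cong (w Fin.zero +_) (weight-empty (w ∘ Fin.suc) A (ℕ.suc-injective |A|≡1))) (+-identityʳ _))

  ofSize-weight? : ∀ {n} (w : Fin n → Carrier) k s A → Dec (∣ A ∣ ≡ k × weight w A ≡ s)
  ofSize-weight? w k s A = (∣ A ∣ ℕ.≟ k) ×-dec (weight w A ≟ s)

  count-ofSize-weight-suc : ∀ {n} (w : Fin (suc n) → Carrier) k s →
    count (ofSize-weight? w (suc k) s) (allSubsets (suc n)) ≡
    count (ofSize-weight? (w ∘ Fin.suc) (suc k) s) (allSubsets n) ℕ.+ count (ofSize-weight? (w ∘ Fin.suc) k (s - w Fin.zero)) (allSubsets n)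
  count-ofSize-weight-suc {n} w k s = trans (count-allSubsets (ofSize-weight? w (suc k) s)) (cong₂ ℕ._+_
    (count-≐ (ofSize-weight? w (suc k) s ∘ (outside Vec.∷_)) (ofSize-weight? (w ∘ Fin.suc) (suc k) s)
      (λ {A} (size , wt) → size , trans (sym (weight-outside w A)) wt)
      (λ {A} (size , wt) → size , trans (weight-outside w A) wt) (allSubsets n))
    (count-≐ (ofSize-weight? w (suc k) s ∘ (inside Vec.∷_)) (ofSize-weight? (w ∘ Fin.suc) k (s - w Fin.zero))
      (λ {A} (size , wt) → ℕ.suc-injective size ,
        trans (solve 2 (λ x y → y := x :+ y :- x) refl (w Fin.zero) (weight (w ∘ Fin.suc) A))
              (cong (_- w Fin.zero) (trans (sym (weight-inside w A)) wt)))
      (λ {A} (size , wt) → cong suc size , trans (weight-inside w A) (trans (cong (w Fin.zero +_) wt)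
        (solve 2 (λ x s → x :+ (s :- x) := s) refl (w Fin.zero) s))) (allSubsets n)))

  -- One element of A is determined by the others and the weight of A.
  count-ofSize-weight : ∀ {n} (w : Fin n → Carrier) → Injective _≡_ _≡_ w → ∀ k s →
    count (ofSize-weight? w (suc k) s) (allSubsets n) ℕ.≤ n C k
  count-ofSize-weight {zero}  w w-inj k s = z≤n
  count-ofSize-weight {suc n} w w-inj (suc k) s = ℕ.≤-trans
    (ℕ.≤-reflexive (count-ofSize-weight-suc w (suc k) s))
    (ℕ.≤-trans
      (ℕ.+-mono-≤ (count-ofSize-weight (w ∘ Fin.suc) (w∘suc-inj w-inj) (suc k) s)
                  (count-ofSize-weight (w ∘ Fin.suc) (w∘suc-inj w-inj) k (s - w Fin.zero)))
      (ℕ.≤-reflexive (trans (ℕ.+-comm (n C suc k) (n C k)) (nCk+nC[k+1]≡[n+1]C[k+1] n k))))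
    where
    w∘suc-inj : ∀ {w : Fin (suc n) → Carrier} → Injective _≡_ _≡_ w → Injective _≡_ _≡_ (w ∘ Fin.suc)
    w∘suc-inj inj eq with inj eq
    ... | refl = refl
  count-ofSize-weight {suc n} w w-inj zero s = ℕ.≤-trans
    (ℕ.≤-reflexive (count-ofSize-weight-suc w zero s)) (ℕ.≤-trans bound (ℕ.≤-reflexive (sym (nC0≡1 (suc n)))))
    where
    w′ = w ∘ Fin.suc

    w′-inj : Injective _≡_ _≡_ w′
    w′-inj eq with w-inj eq
    ... | refl = refl

    bound : count (ofSize-weight? w′ 1 s) (allSubsets n) ℕ.+ count (ofSize-weight? w′ 0 (s - w Fin.zero)) (allSubsets n) ℕ.≤ 1
    -- At most one singleton has weight s: if w 0 is not s, the singleton of 0 fails and induction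
    -- handles the others; if w 0 = s, injectivity excludes the others.
    bound with s ≟ w Fin.zero
    ... | no s≢w₀ = ℕ.≤-trans
      (ℕ.+-mono-≤ (count-ofSize-weight w′ w′-inj 0 s)
        (ℕ.≤-reflexive (count-none (ofSize-weight? w′ 0 (s - w Fin.zero))
          (λ {A} (size , wt) → s≢w₀ (x∙y⁻¹≈ε⇒x≈y s _ (trans (sym wt) (weight-empty w′ A size)))) (allSubsets n))))
      (ℕ.≤-reflexive (trans (ℕ.+-identityʳ _) (nC0≡1 n)))
    ... | yes s≡w₀ = ℕ.≤-trans
      (ℕ.+-mono-≤
        (ℕ.≤-reflexive (count-none (ofSize-weight? w′ 1 s)
          (λ {A} (size , wt) → let i , wt≡wi = weight-singleton w′ A size in
            Fin.0≢1+n (w-inj (trans (sym s≡w₀) (trans (sym wt) wt≡wi)))) (allSubsets n)))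
        (count-⊆ (ofSize-weight? w′ 0 (s - w Fin.zero)) (λ A → ∣ A ∣ ℕ.≟ 0) proj₁ (allSubsets n)))
      (ℕ.≤-reflexive (trans (count-ofSize n 0) (nC0≡1 n)))

  -- Vectors over a finite field.

  module VectorProperties (d : ℕ) where
    open Space F d

    -- Without function extensionality, Fin n → Carrier is finite only up to
    -- pointwise equality.
    injective⇒surjectiveᶠ : ∀ {n} (Φ : (Fin n → Carrier) → (Fin n → Carrier)) →
      (∀ a a′ → (∀ j → Φ a j ≡ Φ a′ j) → ∀ j → a j ≡ a′ j) → ∀ b → ∃[ a ] (∀ j → Φ a j ≡ b j)
    injective⇒surjectiveᶠ {n} Φ Φ-inj b =
      let k , ψk≡b = injective⇒surjective ψ ψ-inj (encode b) in decode k , encode-injective (Φ (decode k)) b ψk≡b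
      where
      encode : (Fin n → Carrier) → Fin (q ℕ.^ n)
      encode a = funToFin (index ∘ a)

      decode : Fin (q ℕ.^ n) → (Fin n → Carrier)
      decode k = element ∘ finToFun k

      encode-injective : ∀ a a′ → encode a ≡ encode a′ → ∀ j → a j ≡ a′ j
      encode-injective a a′ eq j = begin
        a j                               ≡⟨ element-index (a j) ⟨
        element (index (a j))             ≡⟨ cong element (Fin.finToFun-funToFin (index ∘ a) j) ⟨
        element (finToFun (encode a) j)   ≡⟨ cong (λ k → element (finToFun {q} {n} k j)) eq ⟩
        element (finToFun (encode a′) j)  ≡⟨ cong element (Fin.finToFun-funToFin (index ∘ a′) j) ⟩
        element (index (a′ j))            ≡⟨ element-index (a′ j) ⟩
        a′ j                              ∎

      ψ : Fin (q ℕ.^ n) → Fin (q ℕ.^ n)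
      ψ k = encode (Φ (decode k))

      ψ-inj : Injective _≡_ _≡_ ψ
      ψ-inj {k} {l} eq = begin
        k                              ≡⟨ Fin.funToFin-finToFin {n} {q} k ⟨
        funToFin (finToFun {q} {n} k)  ≡⟨ funToFin-cong (λ j → element-injective
                                            (Φ-inj (decode k) (decode l) (encode-injective _ _ eq) j)) ⟩
        funToFin (finToFun {q} {n} l)  ≡⟨ Fin.funToFin-finToFin {n} {q} l ⟩
        l                              ∎

    -- Reduces vector identities to coordinates, where the ring solver applies.
    V-ext : ∀ {v w : V} → (∀ i → lookup v i ≡ lookup w i) → v ≡ w
    V-ext {v} {w} v≗w = trans (sym (Vec.tabulate∘lookup v)) (trans (Vec.tabulate-cong v≗w) (Vec.tabulate∘lookup w))

    lookup-+ᵛ : ∀ v w i → lookup (v +ᵛ w) i ≡ lookup v i + lookup w i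
    lookup-+ᵛ v w i = Vec.lookup-zipWith _+_ i v w

    lookup--ᵛ : ∀ v w i → lookup (v -ᵛ w) i ≡ lookup v i - lookup w i
    lookup--ᵛ v w i = Vec.lookup-zipWith _-_ i v w

    lookup-∙ : ∀ a v i → lookup (a ∙ v) i ≡ a * lookup v i
    lookup-∙ a v i = Vec.lookup-map i (a *_) v

    lookup-0ᵛ : ∀ i → lookup 0ᵛ i ≡ 0#
    lookup-0ᵛ i = Vec.lookup-replicate i 0#

    +ᵛ-comm : ∀ v w → v +ᵛ w ≡ w +ᵛ v
    +ᵛ-comm v w = Vec.zipWith-comm +-comm v w

    +ᵛ-identityˡ : ∀ v → 0ᵛ +ᵛ v ≡ v
    +ᵛ-identityˡ v = Vec.zipWith-identityˡ +-identityˡ v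

    0∙v≡0 : ∀ v → 0# ∙ v ≡ 0ᵛ
    0∙v≡0 v = V-ext λ i → trans (lookup-∙ 0# v i) (trans (zeroˡ _) (sym (lookup-0ᵛ i)))

    -ᵛ≡+ᵛ : ∀ v w → v -ᵛ w ≡ v +ᵛ (- 1#) ∙ w
    -ᵛ≡+ᵛ v w = V-ext λ i → begin
      lookup (v -ᵛ w) i                   ≡⟨ lookup--ᵛ v w i ⟩
      lookup v i - lookup w i
        ≡⟨ solve 2 (λ x y → x :- y := x :+ :- con 1ℤ :* y) refl (lookup v i) (lookup w i) ⟩
      lookup v i + - 1# * lookup w i    ≡⟨ cong (lookup v i +_) (lookup-∙ (- 1#) w i) ⟨
      lookup v i + lookup (- 1# ∙ w) i  ≡⟨ lookup-+ᵛ v _ i ⟨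
      lookup (v +ᵛ (- 1#) ∙ w) i        ∎

    v-w≡0⇒v≡w : ∀ {v w} → v -ᵛ w ≡ 0ᵛ → v ≡ w
    v-w≡0⇒v≡w {v} {w} eq = V-ext λ i → x∙y⁻¹≈ε⇒x≈y _ _
      (trans (sym (lookup--ᵛ v w i)) (trans (cong (λ v → lookup v i) eq) (lookup-0ᵛ i)))

    v≡w⇒v-w≡0 : ∀ {v w} → v ≡ w → v -ᵛ w ≡ 0ᵛ
    v≡w⇒v-w≡0 {v} refl = V-ext λ i → trans (lookup--ᵛ v v i)
      (trans (solve 1 (λ x → x :- x := con 0ℤ) refl (lookup v i)) (sym (lookup-0ᵛ i)))

    linearCombination₂ : ∀ x y x′ y′ e f z z′ →
      (x ∙ e +ᵛ y ∙ f +ᵛ z) -ᵛ (x′ ∙ e +ᵛ y′ ∙ f +ᵛ z′) ≡ (x - x′) ∙ e +ᵛ (y - y′) ∙ f +ᵛ (z -ᵛ z′)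
    linearCombination₂ x y x′ y′ e f z z′ = V-ext λ i → begin
      lookup ((x ∙ e +ᵛ y ∙ f +ᵛ z) -ᵛ (x′ ∙ e +ᵛ y′ ∙ f +ᵛ z′)) i
        ≡⟨ lookup--ᵛ (x ∙ e +ᵛ y ∙ f +ᵛ z) _ i ⟩
      lookup (x ∙ e +ᵛ y ∙ f +ᵛ z) i - lookup (x′ ∙ e +ᵛ y′ ∙ f +ᵛ z′) i
        ≡⟨ cong₂ _-_ (lookup-combination x y z i) (lookup-combination x′ y′ z′ i) ⟩
      (x * lookup e i + y * lookup f i + lookup z i) - (x′ * lookup e i + y′ * lookup f i + lookup z′ i)
        ≡⟨ solve 8 (λ x y x′ y′ e f z z′ → (x :* e :+ y :* f :+ z) :- (x′ :* e :+ y′ :* f :+ z′)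
                      := (x :- x′) :* e :+ (y :- y′) :* f :+ (z :- z′)) refl
             x y x′ y′ (lookup e i) (lookup f i) (lookup z i) (lookup z′ i) ⟩
      (x - x′) * lookup e i + (y - y′) * lookup f i + (lookup z i - lookup z′ i)
        ≡⟨ cong (λ w → (x - x′) * lookup e i + (y - y′) * lookup f i + w) (lookup--ᵛ z z′ i) ⟨
      (x - x′) * lookup e i + (y - y′) * lookup f i + lookup (z -ᵛ z′) i
        ≡⟨ lookup-combination (x - x′) (y - y′) (z -ᵛ z′) i ⟨
      lookup ((x - x′) ∙ e +ᵛ (y - y′) ∙ f +ᵛ (z -ᵛ z′)) i ∎
      where
      lookup-combination : ∀ x y z i → lookup (x ∙ e +ᵛ y ∙ f +ᵛ z) i ≡ x * lookup e i + y * lookup f i + lookup z i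
      lookup-combination x y z i = trans (lookup-+ᵛ (x ∙ e +ᵛ y ∙ f) z i)
        (cong (_+ lookup z i) (trans (lookup-+ᵛ (x ∙ e) (y ∙ f) i) (cong₂ _+_ (lookup-∙ x e i) (lookup-∙ y f i))))

    lookup-sumᵛ : ∀ {n} (h : Fin n → V) i → lookup (sumᵛ h) i ≡ sum (λ j → lookup (h j) i)
    lookup-sumᵛ {zero}  h i = lookup-0ᵛ i
    lookup-sumᵛ {suc n} h i =
      trans (lookup-+ᵛ (h Fin.zero) _ i) (cong (lookup (h Fin.zero) i +_) (lookup-sumᵛ (h ∘ Fin.suc) i))

    sumᵛ--ᵛ : ∀ {n} (a b : Fin n → Carrier) (u : Fin n → V) →
      sumᵛ (λ j → a j ∙ u j) -ᵛ sumᵛ (λ j → b j ∙ u j) ≡ sumᵛ (λ j → (a j - b j) ∙ u j)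
    sumᵛ--ᵛ {zero}  a b u = v≡w⇒v-w≡0 refl
    sumᵛ--ᵛ {suc n} a b u = V-ext λ i → begin
      lookup ((a₀ ∙ u₀ +ᵛ s) -ᵛ (b₀ ∙ u₀ +ᵛ t)) i
        ≡⟨ lookup--ᵛ (a₀ ∙ u₀ +ᵛ s) _ i ⟩
      lookup (a₀ ∙ u₀ +ᵛ s) i - lookup (b₀ ∙ u₀ +ᵛ t) i
        ≡⟨ cong₂ _-_ (lookup-step a₀ s i) (lookup-step b₀ t i) ⟩
      (a₀ * lookup u₀ i + lookup s i) - (b₀ * lookup u₀ i + lookup t i)
        ≡⟨ solve 5 (λ a b u s t → (a :* u :+ s) :- (b :* u :+ t) := (a :- b) :* u :+ (s :- t)) refl
             a₀ b₀ (lookup u₀ i) (lookup s i) (lookup t i) ⟩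
      (a₀ - b₀) * lookup u₀ i + (lookup s i - lookup t i)
        ≡⟨ cong (λ w → (a₀ - b₀) * lookup u₀ i + w) (lookup--ᵛ s t i) ⟨
      (a₀ - b₀) * lookup u₀ i + lookup (s -ᵛ t) i
        ≡⟨ cong (λ w → (a₀ - b₀) * lookup u₀ i + lookup w i) (sumᵛ--ᵛ (a ∘ Fin.suc) (b ∘ Fin.suc) (u ∘ Fin.suc)) ⟩
      (a₀ - b₀) * lookup u₀ i + lookup (sumᵛ (λ j → (a (Fin.suc j) - b (Fin.suc j)) ∙ u (Fin.suc j))) i
        ≡⟨ lookup-step (a₀ - b₀) _ i ⟨
      lookup (sumᵛ (λ j → (a j - b j) ∙ u j)) i ∎
      where
      a₀ = a Fin.zero
      b₀ = b Fin.zero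
      u₀ = u Fin.zero
      s = sumᵛ (λ j → a (Fin.suc j) ∙ u (Fin.suc j))
      t = sumᵛ (λ j → b (Fin.suc j) ∙ u (Fin.suc j))

      lookup-step : ∀ a s i → lookup (a ∙ u₀ +ᵛ s) i ≡ a * lookup u₀ i + lookup s i
      lookup-step a s i = trans (lookup-+ᵛ (a ∙ u₀) s i) (cong (_+ lookup s i) (lookup-∙ a u₀ i))

    -- Quadratic forms and polarization.

    module QuadraticFormProperties (Q : V → Carrier) (2≢0 : 2# ≢ 0#) (isQuadraticForm : Space.Form.IsQuadraticForm F d Q) where
      open Form Q
      open IsQuadraticForm isQuadraticForm

      polarization : ∀ x y → Q (x +ᵛ y) ≡ Q x + Q y + 2# * ⟨ x , y ⟩
      polarization x y = begin
        Q (x +ᵛ y)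
          -- The factor 1 is inserted in order to be replaced by 2 · 2⁻¹, which supplies the halving
          -- contained in the bilinear form.
          ≡⟨ solve 3 (λ s x y → s := x :+ y :+ con 1ℤ :* (s :- x :- y)) refl (Q (x +ᵛ y)) (Q x) (Q y) ⟩
        Q x + Q y + 1# * (Q (x +ᵛ y) - Q x - Q y)
          ≡⟨ cong (λ w → Q x + Q y + w * (Q (x +ᵛ y) - Q x - Q y)) (*-inverse 2≢0) ⟨
        Q x + Q y + 2# * 2# ⁻¹ * (Q (x +ᵛ y) - Q x - Q y)
          ≡⟨ solve 5 (λ p b i x y → x :+ y :+ b :* i :* p := x :+ y :+ b :* (p :* i)) refl (Q (x +ᵛ y) - Q x - Q y) 2# (2# ⁻¹) (Q x) (Q y) ⟩
        Q x + Q y + 2# * ⟨ x , y ⟩ ∎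

      ⟨⟩-sym : ∀ x y → ⟨ x , y ⟩ ≡ ⟨ y , x ⟩
      ⟨⟩-sym x y = cong (_* 2# ⁻¹) (trans (cong (λ v → Q v - Q x - Q y) (+ᵛ-comm x y))
        (solve 3 (λ s x y → s :- x :- y := s :- y :- x) refl (Q (y +ᵛ x)) (Q x) (Q y)))

      ⟨⟩-zeroˡ : ∀ y → ⟨ 0ᵛ , y ⟩ ≡ 0#
      ⟨⟩-zeroˡ y = trans (cong (λ v → ⟨ v , y ⟩) (sym (0∙v≡0 0ᵛ))) (trans (⟨⟩-homogeneous 0# 0ᵛ y) (zeroˡ _))

      ⟨⟩-sumᵛʳ : ∀ {n} z (a : Fin n → Carrier) (u : Fin n → V) → ⟨ z , sumᵛ (λ j → a j ∙ u j) ⟩ ≡ sum (λ j → a j * ⟨ z , u j ⟩)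
      ⟨⟩-sumᵛʳ {zero}  z a u = trans (⟨⟩-sym z 0ᵛ) (⟨⟩-zeroˡ z)
      ⟨⟩-sumᵛʳ {suc n} z a u = begin
        ⟨ z , a₀ ∙ u₀ +ᵛ s ⟩         ≡⟨ ⟨⟩-sym z _ ⟩
        ⟨ a₀ ∙ u₀ +ᵛ s , z ⟩         ≡⟨ ⟨⟩-additive (a₀ ∙ u₀) s z ⟩
        ⟨ a₀ ∙ u₀ , z ⟩ + ⟨ s , z ⟩  ≡⟨ cong₂ _+_ (trans (⟨⟩-homogeneous a₀ u₀ z) (cong (a₀ *_) (⟨⟩-sym u₀ z)))
                                           (trans (⟨⟩-sym s z) (⟨⟩-sumᵛʳ z (a ∘ Fin.suc) (u ∘ Fin.suc))) ⟩
        a₀ * ⟨ z , u₀ ⟩ + sum (λ j → a (Fin.suc j) * ⟨ z , u (Fin.suc j) ⟩) ∎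
        where
        a₀ = a Fin.zero
        u₀ = u Fin.zero
        s = sumᵛ (λ j → a (Fin.suc j) ∙ u (Fin.suc j))

      ⟨⟩--ᵛ : ∀ x y z → ⟨ x -ᵛ y , z ⟩ ≡ ⟨ x , z ⟩ - ⟨ y , z ⟩
      ⟨⟩--ᵛ x y z = begin
        ⟨ x -ᵛ y , z ⟩                  ≡⟨ cong (λ v → ⟨ v , z ⟩) (-ᵛ≡+ᵛ x y) ⟩
        ⟨ x +ᵛ (- 1#) ∙ y , z ⟩         ≡⟨ ⟨⟩-additive x _ z ⟩
        ⟨ x , z ⟩ + ⟨ (- 1#) ∙ y , z ⟩  ≡⟨ cong (⟨ x , z ⟩ +_) (⟨⟩-homogeneous (- 1#) y z) ⟩
        ⟨ x , z ⟩ + - 1# * ⟨ y , z ⟩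
          ≡⟨ solve 2 (λ x y → x :+ :- con 1ℤ :* y := x :- y) refl ⟨ x , z ⟩ ⟨ y , z ⟩ ⟩
        ⟨ x , z ⟩ - ⟨ y , z ⟩           ∎

      Q--ᵛ : ∀ x y → Q (x -ᵛ y) ≡ Q x + Q y - 2# * ⟨ x , y ⟩
      Q--ᵛ x y = begin
        Q (x -ᵛ y)
          ≡⟨ cong Q (-ᵛ≡+ᵛ x y) ⟩
        Q (x +ᵛ (- 1#) ∙ y)
          ≡⟨ polarization x _ ⟩
        Q x + Q ((- 1#) ∙ y) + 2# * ⟨ x , (- 1#) ∙ y ⟩
          ≡⟨ cong₂ (λ s t → Q x + s + 2# * t) (homogeneous (- 1#) y)
               (trans (⟨⟩-sym x _) (trans (⟨⟩-homogeneous (- 1#) y x) (cong (- 1# *_) (⟨⟩-sym y x)))) ⟩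
        Q x + - 1# * - 1# * Q y + 2# * (- 1# * ⟨ x , y ⟩)
          ≡⟨ solve 4 (λ x y b p → x :+ :- con 1ℤ :* :- con 1ℤ :* y :+ b :* (:- con 1ℤ :* p) := x :+ y :- b :* p) refl (Q x) (Q y) 2# ⟨ x , y ⟩ ⟩
        Q x + Q y - 2# * ⟨ x , y ⟩ ∎

-- The spheres `S[ t ]` and the points p_A.

module ConstructionProperties (k : ℕ) (𝒞 : Construction (3 ℕ.+ k)) where
  open ≡ using (refl; sym; trans; cong; cong₂; subst)
  -- The form 3 + k lets `d ∸ 1` and `d ∸ 2` compute to 2 + k and 1 + k, so the basis of `V₀`
  -- visibly has a first vector.
  d : ℕ
  d = 3 ℕ.+ k

  open Construction 𝒞
  open FiniteField F
  open FiniteFieldProperties F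
  open VectorProperties d
  open QuadraticFormProperties Q (2#≢0 oddPrimePower) isQuadraticForm
  open CommutativeRing commutativeRing using
    ( *-identityˡ; *-identityʳ; *-assoc; *-comm; zeroʳ; -‿inverseʳ
    ; +-commutativeMonoid; semiring)
  open Sum +-commutativeMonoid using (sum; sum-cong-≗; sum-replicate-zero)
  open SemiringSum semiring using (*-distribˡ-sum)
  open IntegerSolver commutativeRing using (solve; con; _:=_; _:+_; _:*_; _:-_; :-_)
  open Polynomials F
  open Space F d using (_+ᵛ_; _-ᵛ_; _∙_; 0ᵛ; sumᵛ; module Form)
  open Form Q using (⟨_,_⟩; module WittDecomposition; module IsBasis)
  open WittDecomposition witt using (f; e; V₀; V₀-zero; V₀-+; V₀-∙; combine; direct; Q-split) renaming (nondegenerate to V₀-nondegenerate)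
  open IsBasis isBasis
  open ≡-Reasoning

  V₀--ᵛ : ∀ {x y} → V₀ x → V₀ y → V₀ (x -ᵛ y)
  V₀--ᵛ {x} {y} x∈V₀ y∈V₀ = subst V₀ (sym (-ᵛ≡+ᵛ x y)) (V₀-+ x∈V₀ (V₀-∙ (- 1#) y∈V₀))

  V₀-sumᵛ : ∀ {n} (h : Fin n → V) → (∀ j → V₀ (h j)) → V₀ (sumᵛ h)
  V₀-sumᵛ {zero}  h h∈V₀ = V₀-zero
  V₀-sumᵛ {suc n} h h∈V₀ = V₀-+ (h∈V₀ Fin.zero) (V₀-sumᵛ (h ∘ Fin.suc) (h∈V₀ ∘ Fin.suc))

  V₀-combination : ∀ (a : Fin (d ℕ.∸ 2) → Carrier) → V₀ (sumᵛ (λ j → a j ∙ u j))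
  V₀-combination a = V₀-sumᵛ (λ j → a j ∙ u j) (λ j → V₀-∙ (a j) (inW j))

  z∈V₀ : ∀ t → V₀ z[ t ]
  z∈V₀ t = V₀-combination (λ j → t ^ deg j)

  -- Exhibits the centre as a vector with zero e-coordinate, the shape to which `Q-split` and
  -- `direct` apply.
  c≡combine : ∀ t → c[ t ] ≡ combine 0# (t ^ (d ℕ.∸ 1)) z[ t ]
  c≡combine t = cong (_+ᵛ z[ t ]) (sym (trans (cong (_+ᵛ (t ^ (d ℕ.∸ 1)) ∙ f) (0∙v≡0 e)) (+ᵛ-identityˡ _)))

  combine-injective : ∀ {x y z x′ y′ z′} → V₀ z → V₀ z′ → combine x y z ≡ combine x′ y′ z′ → x ≡ x′ × y ≡ y′ × z ≡ z′
  combine-injective {x} {y} {z} {x′} {y′} {z′} z∈V₀ z′∈V₀ eq =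
    let x-x′≡0 , y-y′≡0 , z-z′≡0 = direct {x - x′} {y - y′} {z -ᵛ z′} (V₀--ᵛ z∈V₀ z′∈V₀)
          (trans (sym (linearCombination₂ x y x′ y′ e f z z′)) (v≡w⇒v-w≡0 eq))
    in x∙y⁻¹≈ε⇒x≈y _ _ x-x′≡0 , x∙y⁻¹≈ε⇒x≈y _ _ y-y′≡0 , v-w≡0⇒v≡w z-z′≡0

  -- The centres already differ: the coefficient of the first basis vector in `z[ t ]` is `t ^ 1`,
  -- so t can be read off from `c[ t ]`.
  S-injective : ∀ {t t′} → S[ t ] ≡ S[ t′ ] → t ≡ t′
  S-injective {t} {t′} eq =
    let _ , _ , zt≡zt′ = combine-injective (z∈V₀ t) (z∈V₀ t′)
          (trans (sym (c≡combine t)) (trans (cong proj₁ eq) (c≡combine t′)))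
        t¹-t′¹≡0 = independent (λ j → t ^ deg j - t′ ^ deg j)
          (trans (sym (sumᵛ--ᵛ (λ j → t ^ deg j) (λ j → t′ ^ deg j) u)) (v≡w⇒v-w≡0 zt≡zt′)) Fin.zero
    in trans (sym (*-identityʳ t)) (trans (x∙y⁻¹≈ε⇒x≈y _ _ t¹-t′¹≡0) (*-identityʳ t′))

  orthogonal-basis⇒0 : ∀ {z} → V₀ z → (∀ j → ⟨ z , u j ⟩ ≡ 0#) → z ≡ 0ᵛ
  orthogonal-basis⇒0 {z} z∈V₀ z⊥u = V₀-nondegenerate z∈V₀ λ y y∈V₀ →
    let a , y≡ = spans y∈V₀ in begin
      ⟨ z , y ⟩                       ≡⟨ cong (λ v → ⟨ z , v ⟩) y≡ ⟩
      ⟨ z , sumᵛ (λ j → a j ∙ u j) ⟩  ≡⟨ ⟨⟩-sumᵛʳ z a u ⟩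
      sum (λ j → a j * ⟨ z , u j ⟩)
        ≡⟨ sum-cong-≗ {d ℕ.∸ 2} (λ j → trans (cong (a j *_) (z⊥u j)) (zeroʳ (a j))) ⟩
      sum {d ℕ.∸ 2} (λ _ → 0#)  ≡⟨ sum-replicate-zero (d ℕ.∸ 2) ⟩
      0#                        ∎

  dual-injective : ∀ {z z′} → V₀ z → V₀ z′ → (∀ j → 2# * ⟨ z , u j ⟩ ≡ 2# * ⟨ z′ , u j ⟩) → z ≡ z′
  dual-injective {z} {z′} z∈V₀ z′∈V₀ eq = v-w≡0⇒v≡w (orthogonal-basis⇒0 (V₀--ᵛ z∈V₀ z′∈V₀) λ j → begin
    ⟨ z -ᵛ z′ , u j ⟩            ≡⟨ ⟨⟩--ᵛ z z′ (u j) ⟩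
    ⟨ z , u j ⟩ - ⟨ z′ , u j ⟩   ≡⟨ cong (_- ⟨ z′ , u j ⟩) (*-cancelˡ (2#≢0 oddPrimePower) (eq j)) ⟩
    ⟨ z′ , u j ⟩ - ⟨ z′ , u j ⟩  ≡⟨ -‿inverseʳ _ ⟩
    0#                           ∎)

  -- In coordinates with respect to u the dual map becomes an endomap of coefficient tuples. It is
  -- injective by nondegeneracy on `V₀`, by 2 ≠ 0 and by independence of u.
  dual-surjective : ∀ (b : Fin (d ℕ.∸ 2) → Carrier) → ∃[ z ] (V₀ z × (∀ j → 2# * ⟨ z , u j ⟩ ≡ b j))
  dual-surjective b =
    let a , Φa≡b = injective⇒surjectiveᶠ (λ a j → 2# * ⟨ sumᵛ (λ i → a i ∙ u i) , u j ⟩)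
          (λ a a′ eq → λ j → x∙y⁻¹≈ε⇒x≈y _ _ (independent (λ j → a j - a′ j)
            (trans (sym (sumᵛ--ᵛ a a′ u)) (v≡w⇒v-w≡0 (dual-injective (V₀-combination a) (V₀-combination a′) eq))) j))
          b
    in sumᵛ (λ i → a i ∙ u i) , V₀-combination a , Φa≡b

  module _ (x y : Carrier) (z : V) where

    -- The four groups of terms of `Ψ` live in disjoint degrees, so in each of the lemmas below at
    -- most one of the four summands survives.
    coeff-Ψ : ∀ n → coeff (Ψ x y z) n ≡
      coeff (1# T^ d) n + coeff ((x + γ) T^ (d ℕ.∸ 1)) n
        + sum (λ j → coeff ((2# * ⟨ z , u j ⟩) T^ deg j) n) + coeff ((κ - Q (combine x y z)) T^ 0) n
    coeff-Ψ n = trans (coeff-+ₚ (top +ₚ mid) ((κ - Q (combine x y z)) T^ 0) n)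
      (cong (_+ coeff ((κ - Q (combine x y z)) T^ 0) n) (trans (coeff-+ₚ top mid n)
        (cong₂ _+_ (coeff-+ₚ (1# T^ d) ((x + γ) T^ (d ℕ.∸ 1)) n) (coeff-sumₚ (λ j → (2# * ⟨ z , u j ⟩) T^ deg j) n))))
      where
      top = 1# T^ d +ₚ (x + γ) T^ (d ℕ.∸ 1)
      mid = sumₚ (λ j → (2# * ⟨ z , u j ⟩) T^ deg j)

    private
      no-deg : ∀ n → (∀ j → n ≢ deg j) → sum (λ j → coeff ((2# * ⟨ z , u j ⟩) T^ deg j) n) ≡ 0#
      no-deg n n≢deg =
        trans (sum-cong-≗ {d ℕ.∸ 2} (λ j → coeff-T^-≢ (2# * ⟨ z , u j ⟩) (n≢deg j))) (sum-replicate-zero (d ℕ.∸ 2))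

      deg≤ : ∀ j → deg j ℕ.≤ suc k
      deg≤ j = Fin.toℕ<n j

      0+0+0+0≡0 : 0# + 0# + 0# + 0# ≡ 0#
      0+0+0+0≡0 = solve 0 (con 0ℤ :+ con 0ℤ :+ con 0ℤ :+ con 0ℤ := con 0ℤ) refl

      sum₄ : ∀ {a a′ b b′ c c′ d d′} → a ≡ a′ → b ≡ b′ → c ≡ c′ → d ≡ d′ → a + b + c + d ≡ a′ + b′ + c′ + d′
      sum₄ refl refl refl refl = refl

    coeff-Ψ-constant : coeff (Ψ x y z) 0 ≡ κ - Q (combine x y z)
    coeff-Ψ-constant = trans (coeff-Ψ 0) (trans (sum₄ refl refl (no-deg 0 (λ _ ())) refl)
      (solve 1 (λ w → con 0ℤ :+ con 0ℤ :+ con 0ℤ :+ w := w) refl (κ - Q (combine x y z))))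

    coeff-Ψ-deg : ∀ j → coeff (Ψ x y z) (deg j) ≡ 2# * ⟨ z , u j ⟩
    coeff-Ψ-deg j = trans (coeff-Ψ (deg j)) (trans
      (sum₄ (coeff-T^-≢ 1# {d} (ℕ.<⇒≢ (ℕ.m<n⇒m<1+n (s≤s (deg≤ j))))) (coeff-T^-≢ (x + γ) {suc (suc k)} (ℕ.<⇒≢ (s≤s (deg≤ j))))
        (trans (sum-single (λ i → coeff ((2# * ⟨ z , u i ⟩) T^ deg i) (deg j)) j
                  (λ i i≢j → coeff-T^-≢ _ {deg i} (λ deg≡ → i≢j (Fin.toℕ-injective (sym (ℕ.suc-injective deg≡))))))
               (coeff-T^ _ (deg j)))
        refl)
      (solve 1 (λ w → con 0ℤ :+ con 0ℤ :+ w :+ con 0ℤ := w) refl (2# * ⟨ z , u j ⟩)))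

    coeff-Ψ-subleading : coeff (Ψ x y z) (d ℕ.∸ 1) ≡ x + γ
    coeff-Ψ-subleading = trans (coeff-Ψ (d ℕ.∸ 1)) (trans
      (sum₄ (coeff-T^-≢ 1# {d} {suc (suc k)} (ℕ.<⇒≢ ℕ.≤-refl)) (coeff-T^ (x + γ) (suc (suc k)))
        (no-deg (suc (suc k)) (λ j eq → ℕ.<⇒≢ (s≤s (deg≤ j)) (sym eq))) refl)
      (solve 1 (λ w → con 0ℤ :+ w :+ con 0ℤ :+ con 0ℤ := w) refl (x + γ)))

    coeff-Ψ-leading : coeff (Ψ x y z) d ≡ 1#
    coeff-Ψ-leading = trans (coeff-Ψ d) (trans
      (sum₄ (coeff-T^ 1# d) (coeff-T^-≢ (x + γ) {suc (suc k)} {d} (ℕ.<⇒≢ ℕ.≤-refl ∘ sym))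
        (no-deg d (λ j eq → ℕ.<⇒≢ (ℕ.m<n⇒m<1+n (s≤s (deg≤ j))) (sym eq))) refl)
      (solve 0 (con 1ℤ :+ con 0ℤ :+ con 0ℤ :+ con 0ℤ := con 1ℤ) refl))

    coeff-Ψ-> : ∀ {n} → d ℕ.< n → coeff (Ψ x y z) n ≡ 0#
    coeff-Ψ-> {suc n} d<n = trans (coeff-Ψ (suc n)) (trans
      (sum₄ (coeff-T^-≢ 1# {d} (ℕ.<⇒≢ d<n ∘ sym)) (coeff-T^-≢ (x + γ) {suc (suc k)} (ℕ.<⇒≢ (ℕ.<-trans ℕ.≤-refl d<n) ∘ sym))
        (no-deg (suc n) (λ j eq → ℕ.<⇒≢ (ℕ.≤-<-trans (deg≤ j) (ℕ.<-trans (ℕ.n<1+n _) (ℕ.<-trans (ℕ.n<1+n _) d<n))) (sym eq))) refl)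
      0+0+0+0≡0)

    eval-Ψ : ∀ t → eval (Ψ x y z) t ≡ t ^ d + (x + γ) * t ^ (d ℕ.∸ 1) + 2# * ⟨ z , z[ t ] ⟩ + (κ - Q (combine x y z))
    eval-Ψ t = begin
      eval (Ψ x y z) t
        ≡⟨ trans (eval-+ₚ (top +ₚ mid) (last T^ 0) t) (cong (_+ eval (last T^ 0) t)
             (trans (eval-+ₚ top mid t) (cong (_+ eval mid t) (eval-+ₚ (1# T^ d) ((x + γ) T^ (d ℕ.∸ 1)) t)))) ⟩
      eval (1# T^ d) t + eval ((x + γ) T^ (d ℕ.∸ 1)) t + eval mid t + eval (last T^ 0) t
        ≡⟨ sum₄ (trans (eval-T^ 1# d t) (*-identityˡ _)) (eval-T^ (x + γ) (d ℕ.∸ 1) t) eval-mid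
             (trans (eval-T^ last 0 t) (trans (*-comm last 1#) (*-identityˡ last))) ⟩
      t ^ d + (x + γ) * t ^ (d ℕ.∸ 1) + 2# * ⟨ z , z[ t ] ⟩ + last ∎
      where
      last = κ - Q (combine x y z)
      top = 1# T^ d +ₚ (x + γ) T^ (d ℕ.∸ 1)
      mid = sumₚ (λ j → (2# * ⟨ z , u j ⟩) T^ deg j)

      eval-mid : eval mid t ≡ 2# * ⟨ z , z[ t ] ⟩
      eval-mid = begin
        eval mid t
          ≡⟨ eval-sumₚ (λ j → (2# * ⟨ z , u j ⟩) T^ deg j) t ⟩
        sum (λ j → eval ((2# * ⟨ z , u j ⟩) T^ deg j) t)
          ≡⟨ sum-cong-≗ {d ℕ.∸ 2} (λ j → trans (eval-T^ (2# * ⟨ z , u j ⟩) (deg j) t)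
               (solve 3 (λ a b c → a :* b :* c := a :* (c :* b)) refl 2# ⟨ z , u j ⟩ (t ^ deg j))) ⟩
        sum (λ j → 2# * (t ^ deg j * ⟨ z , u j ⟩))
          ≡⟨ *-distribˡ-sum {d ℕ.∸ 2} 2# (λ j → t ^ deg j * ⟨ z , u j ⟩) ⟨
        2# * sum (λ j → t ^ deg j * ⟨ z , u j ⟩)
          ≡⟨ cong (2# *_) (⟨⟩-sumᵛʳ z (λ j → t ^ deg j) u) ⟨
        2# * ⟨ z , z[ t ] ⟩ ∎

  -- `c[ t ]` has no e-component, so Q(c_t) = Q(z_t), and this cancels against the Q(c_t) inside
  -- `r t`. There remain Q(v) = xy + Q(z), the cross terms - x t^(d-1) - 2⟨z , z_t⟩, and - b_t,
  -- which brings in the monic term and γ.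
  sphere-equation : ∀ x y {z} t → V₀ z → Q (combine x y z -ᵛ c[ t ]) - r t ≡ - eval (Ψ x y z) t
  sphere-equation x y {z} t z∈ = begin
    Q (combine x y z -ᵛ c[ t ]) - r t
      ≡⟨ cong₂ (λ v w → v - (w + b t)) Q-difference Q-center ⟩
    ((x - 0#) * (y - s) + (Q z + Q zt - p)) - (0# * s + Q zt + (td + γ * s + κ))
      ≡⟨ solve 9 (λ x y s qz qzt p td γ κ →
           ((x :- con 0ℤ) :* (y :- s) :+ (qz :+ qzt :- p)) :- (con 0ℤ :* s :+ qzt :+ (td :+ γ :* s :+ κ))
             := :- (td :+ (x :+ γ) :* s :+ p :+ (κ :- (x :* y :+ qz)))) refl x y s (Q z) (Q zt) p td γ κ ⟩
    - (td + (x + γ) * s + p + (κ - (x * y + Q z)))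
      ≡⟨ cong (λ w → - (td + (x + γ) * s + p + (κ - w))) (Q-split x y z∈) ⟨
    - (td + (x + γ) * s + p + (κ - Q (combine x y z)))
      ≡⟨ cong -_ (eval-Ψ x y z t) ⟨
    - eval (Ψ x y z) t ∎
    where
    s = t ^ (d ℕ.∸ 1)
    td = t ^ d
    zt = z[ t ]
    p = 2# * ⟨ z , zt ⟩

    Q-center : Q c[ t ] ≡ 0# * s + Q zt
    Q-center = trans (cong Q (c≡combine t)) (Q-split 0# s (z∈V₀ t))

    Q-difference : Q (combine x y z -ᵛ c[ t ]) ≡ (x - 0#) * (y - s) + (Q z + Q zt - p)
    Q-difference = begin
      Q (combine x y z -ᵛ c[ t ])             ≡⟨ cong (λ c → Q (combine x y z -ᵛ c)) (c≡combine t) ⟩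
      Q (combine x y z -ᵛ combine 0# s zt)    ≡⟨ cong Q (linearCombination₂ x y 0# s e f z zt) ⟩
      Q (combine (x - 0#) (y - s) (z -ᵛ zt))  ≡⟨ Q-split (x - 0#) (y - s) (V₀--ᵛ z∈ (z∈V₀ t)) ⟩
      (x - 0#) * (y - s) + Q (z -ᵛ zt)        ≡⟨ cong ((x - 0#) * (y - s) +_) (Q--ᵛ z zt) ⟩
      (x - 0#) * (y - s) + (Q z + Q zt - p)   ∎

  incidence : ∀ {A v} → IsPoint A v → ∀ t → v ∈ₛ S[ t ] ⇔ t ∈ᶠ A
  incidence {A} (x , y , z , _ , z∈ , refl , Ψ≈A) t = mk⇔
    (λ v∈S → Equivalence.to (∈-members⇔∈ᶠ A t) (Equivalence.to (∏T-≡0⇔∈ (members A) t)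
      (trans (sym eval-eq) (trans (sym (-‿involutive _)) (trans (cong -_ (trans (sym (sphere-equation x y t z∈)) (x≡y⇒x-y≡0 v∈S))) -0#≈0#)))))
    (λ t∈A → x∙y⁻¹≈ε⇒x≈y _ _ (trans (sphere-equation x y t z∈)
      (trans (cong -_ (trans eval-eq (Equivalence.from (∏T-≡0⇔∈ (members A) t) (Equivalence.from (∈-members⇔∈ᶠ A t) t∈A)))) -0#≈0#)))
    where
    eval-eq : eval (Ψ x y z) t ≡ eval (fromRoots A) t
    eval-eq = eval-cong (Ψ x y z) (fromRoots A) t Ψ≈A

    x≡y⇒x-y≡0 : ∀ {x y} → x ≡ y → x - y ≡ 0#
    x≡y⇒x-y≡0 {x} refl = -‿inverseʳ x

  -- The coefficients are matched group by group: degree d - 1 gives x, the degrees 1 to d - 2 give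
  -- z through the dual map, and the constant term is then a linear equation for y with leading
  -- coefficient x.
  point-exists : ∀ {A} → 𝔄 A → ∃[ v ] IsPoint A v
  point-exists {A} (|A|≡d , -ΣA≢γ) = combine x y z , x , y , z , x≢0 , z∈ , refl , Ψ≈A
    where
    a : ℕ → Carrier
    a = coeff (fromRoots A)

    length≡d : length (members A) ≡ d
    length≡d = trans (length-members A) |A|≡d

    x : Carrier
    x = a (d ℕ.∸ 1) - γ

    x≢0 : x ≢ 0#
    -- By Vieta, x = 0 would say - ΣA = γ, which `𝔄` excludes; this makes the equation for y
    -- solvable.
    x≢0 x≡0 = -ΣA≢γ (trans (sym (coeff-∏-subleading (members A) length≡d)) (x∙y⁻¹≈ε⇒x≈y _ _ x≡0))

    dual = dual-surjective (λ j → a (deg j))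
    z = proj₁ dual
    z∈ = proj₁ (proj₂ dual)

    y : Carrier
    y = x ⁻¹ * (κ - a 0 - Q z)

    constant : κ - Q (combine x y z) ≡ a 0
    constant = begin
      κ - Q (combine x y z)                     ≡⟨ cong (λ w → κ - w) (Q-split x y z∈) ⟩
      κ - (x * (x ⁻¹ * (κ - a 0 - Q z)) + Q z)  ≡⟨ cong (λ w → κ - (w + Q z)) (*-assoc x (x ⁻¹) _) ⟨
      κ - (x * x ⁻¹ * (κ - a 0 - Q z) + Q z)
        ≡⟨ cong (λ w → κ - (w * (κ - a 0 - Q z) + Q z)) (*-inverse x≢0) ⟩
      κ - (1# * (κ - a 0 - Q z) + Q z)
        ≡⟨ solve 3 (λ κ a q → κ :- (con 1ℤ :* (κ :- a :- q) :+ q) := a) refl κ (a 0) (Q z) ⟩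
      a 0                                                 ∎

    Ψ≈A : Ψ x y z ≈ₚ fromRoots A
    Ψ≈A = degrees (λ n → coeff (Ψ x y z) n ≡ coeff (fromRoots A) n)
      (trans (coeff-Ψ-constant x y z) constant)
      (λ j → trans (coeff-Ψ-deg x y z j) (proj₂ (proj₂ dual) j))
      (trans (coeff-Ψ-subleading x y z) (solve 2 (λ a γ → a :- γ :+ γ := a) refl (a (d ℕ.∸ 1)) γ))
      (trans (coeff-Ψ-leading x y z) (sym (subst (λ n → coeff (fromRoots A) n ≡ 1#) length≡d (coeff-∏-leading (members A)))))
      (λ {n} d<n → trans (coeff-Ψ-> x y z d<n) (sym (coeff-∏-> (members A) (subst (ℕ._< n) (sym length≡d) d<n))))

  -- The coefficients determine x + γ, the pairings of z with the basis, and the value of Q. Given x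
  -- and z, the last determines xy, from which x ≠ 0 is cancelled.
  point-unique : ∀ {A v v′} → IsPoint A v → IsPoint A v′ → v ≡ v′
  point-unique (x , y , z , x≢0 , z∈ , refl , Ψ≈A) (x′ , y′ , z′ , x′≢0 , z′∈ , refl , Ψ′≈A) = helper x≡x′ z≡z′
    where
    Ψ≈Ψ′ : Ψ x y z ≈ₚ Ψ x′ y′ z′
    Ψ≈Ψ′ n = trans (Ψ≈A n) (sym (Ψ′≈A n))

    x≡x′ : x ≡ x′
    x≡x′ = begin
      x             ≡⟨ solve 2 (λ x γ → x := x :+ γ :- γ) refl x γ ⟩
      x + γ - γ
        ≡⟨ cong (_- γ) (trans (sym (coeff-Ψ-subleading x y z)) (trans (Ψ≈Ψ′ (d ℕ.∸ 1)) (coeff-Ψ-subleading x′ y′ z′))) ⟩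
      x′ + γ - γ  ≡⟨ solve 2 (λ x γ → x :+ γ :- γ := x) refl x′ γ ⟩
      x′          ∎

    z≡z′ : z ≡ z′
    z≡z′ =
      dual-injective z∈ z′∈ λ j → trans (sym (coeff-Ψ-deg x y z j)) (trans (Ψ≈Ψ′ (deg j)) (coeff-Ψ-deg x′ y′ z′ j))

    Q≡Q′ : Q (combine x y z) ≡ Q (combine x′ y′ z′)
    Q≡Q′ = begin
      Q (combine x y z)               ≡⟨ solve 2 (λ q κ → q := κ :- (κ :- q)) refl (Q (combine x y z)) κ ⟩
      κ - (κ - Q (combine x y z))
        ≡⟨ cong (λ w → κ - w) (trans (sym (coeff-Ψ-constant x y z)) (trans (Ψ≈Ψ′ 0) (coeff-Ψ-constant x′ y′ z′))) ⟩
      κ - (κ - Q (combine x′ y′ z′))  ≡⟨ solve 2 (λ q κ → κ :- (κ :- q) := q) refl (Q (combine x′ y′ z′)) κ ⟩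
      Q (combine x′ y′ z′)            ∎

    helper : x ≡ x′ → z ≡ z′ → combine x y z ≡ combine x′ y′ z′
    helper refl refl = cong (λ y → combine x y z) (*-cancelˡ x≢0 (+-cancelˡ (Q z) (begin
      Q z + x * y   ≡⟨ solve 2 (λ p q → q :+ p := p :+ q) refl (x * y) (Q z) ⟩
      x * y + Q z   ≡⟨ trans (sym (Q-split x y z∈)) (trans Q≡Q′ (Q-split x y′ z∈)) ⟩
      x * y′ + Q z  ≡⟨ solve 2 (λ p q → p :+ q := q :+ p) refl (x * y′) (Q z) ⟩
      Q z + x * y′  ∎)))

  point-∃! : ∀ {A} → 𝔄 A → ∃! _≡_ (IsPoint A)
  point-∃! A∈𝔄 = let v , v-point = point-exists A∈𝔄 in v , v-point , point-unique v-point

-- The size of 𝔄.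

module CardinalityBounds (j : ℕ) (𝒞 : Construction (suc j)) where
  open ≡ using (sym; trans; cong)
  open Construction 𝒞
  open FiniteField F using (_≟_; -_; element; sumOver)
  open FiniteFieldProperties using (weight; ofSize-weight?; count-ofSize-weight; element-injective; -‿involutive)

  card𝔄-upper : card𝔄 ℕ.≤ q ℕ.^ suc j
  card𝔄-upper = ℕ.≤-trans (count-⊆ 𝔄? (λ A → ∣ A ∣ ℕ.≟ suc j) proj₁ (allSubsets q))
    (ℕ.≤-trans (ℕ.≤-reflexive (count-ofSize q (suc j))) (nCk≤n^k q (suc j)))

  card𝔄-excluded : q C suc j ℕ.≤ card𝔄 ℕ.+ q C j
  card𝔄-excluded = ℕ.≤-trans (ℕ.≤-reflexive (sym (count-ofSize q (suc j))))
    (ℕ.≤-trans (count-⊎ (λ A → ∣ A ∣ ℕ.≟ suc j) 𝔄? (ofSize-weight? F element (suc j) (- γ)) split (allSubsets q))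
      (ℕ.+-monoʳ-≤ card𝔄 (count-ofSize-weight F element (element-injective F) j (- γ))))
    where
    -- A d-set outside `𝔄` has `- sumOver A ≡ γ`; negating prescribes its weight, since `sumOver A`
    -- is `weight F element A` by computation.
    split : ∀ {A} → ∣ A ∣ ≡ suc j → 𝔄 A ⊎ (∣ A ∣ ≡ suc j × weight F element A ≡ - γ)
    split {A} |A|≡d with (- sumOver A) ≟ γ
    ... | no  -ΣA≢γ = inj₁ (|A|≡d , -ΣA≢γ)
    ... | yes -ΣA≡γ = inj₂ (|A|≡d , trans (sym (-‿involutive F _)) (cong -_ -ΣA≡γ))

  card𝔄-lower : (q ℕ.∸ 2 ℕ.* suc j) ℕ.^ suc j ℕ.≤ suc j ! ℕ.* card𝔄
  card𝔄-lower = nC[k+1]≤c+nCk⇒[n∸2[k+1]]^[k+1]≤[k+1]!*c q j card𝔄 card𝔄-excluded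

-- Incidences of a system.

module SystemProperties (k : ℕ) (𝒳 : System (3 ℕ.+ k)) where
  open ≡ using (refl; sym; trans; cong; cong₂; subst)
  open System 𝒳
  open FiniteField F using (all; element; index)

  d : ℕ
  d = 3 ℕ.+ k

  index-element : ∀ i → index (element i) ≡ i
  index-element = FiniteFieldProperties.index-element F
  open Space.Form F (3 ℕ.+ k) Q using (_∈ₛ?_)

  p-incidence : ∀ {A} → A ∈ˢ 𝒢 → ∀ t → p A ∈ₛ S[ t ] ⇔ t ∈ᶠ A
  p-incidence A∈𝒢 = ConstructionProperties.incidence k construction (isPoint (𝒢⊆𝔄 A∈𝒢))

  -- A is recovered from `p A` as the set of labels t for which `p A` lies on `S[ t ]`.
  p-injectiveOn : InjectiveOn p 𝒢
  p-injectiveOn {A} {A′} A∈𝒢 A′∈𝒢 pA≡pA′ = ⊆-antisym (⊆-from A∈𝒢 A′∈𝒢 pA≡pA′) (⊆-from A′∈𝒢 A∈𝒢 (sym pA≡pA′))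
    where
    ⊆-from : ∀ {A A′} → A ∈ˢ 𝒢 → A′ ∈ˢ 𝒢 → p A ≡ p A′ → ∀ {i} → i Subset.∈ A → i Subset.∈ A′
    ⊆-from {A} {A′} A∈𝒢 A′∈𝒢 eq {i} i∈A = subst (Subset._∈ A′) (index-element i)
      (Equivalence.to (p-incidence A′∈𝒢 (element i)) (subst (_∈ₛ S[ element i ]) eq
        (Equivalence.from (p-incidence A∈𝒢 (element i)) (subst (Subset._∈ A) (sym (index-element i)) i∈A))))

  S-injectiveOn : InjectiveOn S[_] all
  S-injectiveOn _ _ = ConstructionProperties.S-injective k construction

  graphIsomorphism : IsGraphIsomorphism membershipGraph incidenceGraph p S[_]
  graphIsomorphism = record
    { lefts-bijective  = image-bijective _≟ᵛ_ {X = 𝒢} p-injectiveOn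
    ; rights-bijective = image-bijective _≟ₛ_ {X = all} S-injectiveOn
    ; adjacency        = λ {A} {t} A∈𝒢 _ →
        mk⇔ (Equivalence.from (p-incidence A∈𝒢 t)) (Equivalence.to (p-incidence A∈𝒢 t))
    }

  card-P : card P𝒢 ≡ m
  card-P = card-image _≟ᵛ_ {X = 𝒢} p-injectiveOn

  card-𝒮 : card 𝒮rn ≡ q
  card-𝒮 =
    trans (card-image _≟ₛ_ {X = all} S-injectiveOn) (trans (List.length-map element (allFin q)) (List.length-tabulate {n = q} (λ i → i)))

  -- Counting by points: the spheres through `p A` are the `S[ t ]` with t in A, so every row of the
  -- incidence table has d entries.
  incidences≡dm : incidences P𝒢 𝒮rn ≡ d ℕ.* m
  incidences≡dm = begin
    count incident? (cartesianProduct (elements P𝒢) (elements 𝒮rn))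
      ≡⟨ cong₂ (λ ps ss → count incident? (cartesianProduct ps ss)) (elements-image _≟ᵛ_ {X = 𝒢} p-injectiveOn) (elements-image _≟ₛ_ {X = all} S-injectiveOn) ⟩
    count incident? (cartesianProduct (List.map p (elements 𝒢)) (List.map S[_] (elements all)))
      ≡⟨ count-cartesianProduct incident? d (List.map p (elements 𝒢)) (List.map S[_] (elements all)) row ⟩
    d ℕ.* length (List.map p (elements 𝒢))
      ≡⟨ cong (d ℕ.*_) (List.length-map p (elements 𝒢)) ⟩
    d ℕ.* m ∎
    where
    open ≡-Reasoning
    incident? = λ ((x , S) : V × Sphere) → x ∈ₛ? S

    row : ∀ {v} → v ∈ List.map p (elements 𝒢) → count (λ S → v ∈ₛ? S) (List.map S[_] (elements all)) ≡ d
    row v∈P with ∈-map⁻ p v∈P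
    ... | A , A∈𝒢 , refl = begin
      count (λ S → p A ∈ₛ? S) (List.map S[_] (elements all))
        ≡⟨ count-map (λ S → p A ∈ₛ? S) S[_] (elements all) ⟩
      count (λ t → p A ∈ₛ? S[ t ]) (List.map element (allFin q))
        ≡⟨ count-map (λ t → p A ∈ₛ? S[ t ]) element (allFin q) ⟩
      count (λ i → p A ∈ₛ? S[ element i ]) (allFin q)
        ≡⟨ count-≐ (λ i → p A ∈ₛ? S[ element i ]) (_∈? A)
             (λ {i} h → subst (Subset._∈ A) (index-element i) (Equivalence.to (p-incidence A∈𝒢 (element i)) h))
             (λ {i} h → Equivalence.from (p-incidence A∈𝒢 (element i)) (subst (Subset._∈ A) (sym (index-element i)) h))
             (allFin q) ⟩
      length (indices A)
        ≡⟨ trans (length-indices A) (proj₁ (𝒢⊆𝔄 A∈𝒢)) ⟩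
      d ∎

  m≤card𝔄 : m ℕ.≤ card𝔄
  m≤card𝔄 = unique-⊆⇒length-≤ (unique 𝒢) (λ {A} A∈𝒢 → ∈-filter⁺ 𝔄? (∈-allSubsets A) (𝒢⊆𝔄 A∈𝒢))

-- Constructive order arithmetic in the reals.

module RealFieldProperties {c ℓ₁ ℓ₂} (ℝ : RealField c ℓ₁ ℓ₂) where
  open RealField ℝ
  open CommutativeRing commutativeRing using (semiring)
  open Mult semiring using (×-homo-+; ×1-homo-*)
  open IntegerSolver commutativeRing using (solve; con; _:=_; _:+_; _:*_; _:-_; :-_) public

  -- Apartness is cotransitive and apart elements are comparable. This stands in for trichotomy in
  -- chains that mix `<` and `≤`.
  <-cotrans : ∀ {x y} → x < y → ∀ z → x < z ⊎ z < y
  <-cotrans {x} {y} x<y z with #-cotrans (<⇒# x<y) z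
  ... | inj₁ x#z with #⇒<⊎> x#z
  ...   | inj₁ x<z = inj₁ x<z
  ...   | inj₂ z<x = inj₂ (<-trans z<x x<y)
  <-cotrans {x} {y} x<y z | inj₂ z#y with #⇒<⊎> z#y
  ...   | inj₁ z<y = inj₂ z<y
  ...   | inj₂ y<z = inj₁ (<-trans x<y y<z)

  <⇒≤ : ∀ {x y} → x < y → x ≤ y
  <⇒≤ x<y y<x = <-asym x<y y<x

  ≤-reflexive : ∀ {x y} → x ≈ y → x ≤ y
  ≤-reflexive x≈y = <-irrefl (sym x≈y)

  ≤-trans : ∀ {x y z} → x ≤ y → y ≤ z → x ≤ z
  ≤-trans {y = y} x≤y y≤z z<x with <-cotrans z<x y
  ... | inj₁ z<y = y≤z z<y
  ... | inj₂ y<x = x≤y y<x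

  <-≤-trans : ∀ {x y z} → x < y → y ≤ z → x < z
  <-≤-trans {z = z} x<y y≤z with <-cotrans x<y z
  ... | inj₁ x<z = x<z
  ... | inj₂ z<y = ⊥-elim (y≤z z<y)

  ≤-<-trans : ∀ {x y z} → x ≤ y → y < z → x < z
  ≤-<-trans {x} x≤y y<z with <-cotrans y<z x
  ... | inj₁ y<x = ⊥-elim (x≤y y<x)
  ... | inj₂ x<z = x<z

  -- Apartness is tight: elements that are not apart are equal.
  ≤-antisym : ∀ {x y} → x ≤ y → y ≤ x → x ≈ y
  ≤-antisym {x} {y} x≤y y≤x = proj₁ (tight x y) λ x#y → apart (#⇒<⊎> x#y)
    where
    apart : ¬ (x < y ⊎ y < x)
    apart (inj₁ x<y) = y≤x x<y
    apart (inj₂ y<x) = x≤y y<x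

  ≤-isPreorder : IsPreorder _≈_ _≤_
  ≤-isPreorder = record
    { isEquivalence = isEquivalence
    ; reflexive     = ≤-reflexive
    ; trans         = ≤-trans
    }

  module ≤-Reasoning = Triple ≤-isPreorder <-asym <-trans <-resp-≈ <⇒≤ <-≤-trans ≤-<-trans
    hiding (step-≈; step-≈˘)
  open ≤-Reasoning

  x<y⇒0<y-x : ∀ {x y} → x < y → 0# < y - x
  x<y⇒0<y-x {x} {y} x<y = begin-strict
    0#     ≈⟨ solve 1 (λ x → con 0ℤ := x :- x) refl x ⟩
    x - x  <⟨ +-mono-< (- x) x<y ⟩
    y - x  ∎

  0<y-x⇒x<y : ∀ {x y} → 0# < y - x → x < y
  0<y-x⇒x<y {x} {y} 0<y-x = begin-strict
    x          ≈⟨ solve 1 (λ x → x := con 0ℤ :+ x) refl x ⟩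
    0# + x     <⟨ +-mono-< x 0<y-x ⟩
    y - x + x  ≈⟨ solve 2 (λ x y → y :- x :+ x := y) refl x y ⟩
    y          ∎

  *-monoˡ-< : ∀ {x y z} → 0# < x → y < z → x * y < x * z
  *-monoˡ-< {x} {y} {z} 0<x y<z = 0<y-x⇒x<y (begin-strict
    0#             <⟨ *-pos 0<x (x<y⇒0<y-x y<z) ⟩
    x * (z - y)    ≈⟨ solve 3 (λ x y z → x :* (z :- y) := x :* z :- x :* y) refl x y z ⟩
    x * z - x * y  ∎)

  infix 8 1/_
  -- The same inverse as in `_/_[_]`, so `x / y [ 0<y ]` is `x * 1/ 0<y` by computation.
  1/_ : ∀ {x} → 0# < x → Carrier
  1/ 0<x = proj₁ (#⇒invertible (#-sym (<⇒# 0<x)))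

  private
    x-0≈x : ∀ x → x - 0# ≈ x
    x-0≈x = solve 1 (λ x → x :- con 0ℤ := x) refl

  *-inverseʳ : ∀ {x} (0<x : 0# < x) → x * 1/ 0<x ≈ 1#
  *-inverseʳ {x} 0<x = trans (*-congʳ (sym (x-0≈x x))) (proj₂ (proj₂ (#⇒invertible (#-sym (<⇒# 0<x)))))

  *-inverseˡ : ∀ {x} (0<x : 0# < x) → 1/ 0<x * x ≈ 1#
  *-inverseˡ 0<x = trans (*-comm _ _) (*-inverseʳ 0<x)

  -- An invertible element is apart from 0, hence positive or negative; a negative inverse would
  -- give 1 < 0.
  1/-pos : ∀ {x} (0<x : 0# < x) → 0# < 1/ 0<x
  1/-pos {x} 0<x with #⇒<⊎> (invertible⇒# {1/ 0<x} {0#} (x , trans (*-congˡ (x-0≈x _)) (*-inverseʳ 0<x) , trans (*-congʳ (x-0≈x _)) (*-inverseˡ 0<x)))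
  ... | inj₂ 0<1/x = 0<1/x
  ... | inj₁ 1/x<0 = ⊥-elim (<-asym 0<1 (begin-strict
    1#          ≈⟨ *-inverseʳ 0<x ⟨
    x * 1/ 0<x  <⟨ *-monoˡ-< 0<x 1/x<0 ⟩
    x * 0#      ≈⟨ zeroʳ x ⟩
    0#          ∎))

  1/x*[x*y]≈y : ∀ {x} (0<x : 0# < x) y → 1/ 0<x * (x * y) ≈ y
  1/x*[x*y]≈y 0<x y = trans (sym (*-assoc _ _ _)) (trans (*-congʳ (*-inverseˡ 0<x)) (*-identityˡ y))

  *-cancelˡ-< : ∀ {x y z} → 0# < x → x * y < x * z → y < z
  *-cancelˡ-< {x} {y} {z} 0<x xy<xz = begin-strict
    y                 ≈⟨ 1/x*[x*y]≈y 0<x y ⟨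
    1/ 0<x * (x * y)  <⟨ *-monoˡ-< (1/-pos 0<x) xy<xz ⟩
    1/ 0<x * (x * z)  ≈⟨ 1/x*[x*y]≈y 0<x z ⟩
    z                 ∎

  -- As `≤` is a negated `<`, this is the contrapositive of cancellation for `<`; likewise
  -- `*-cancelˡ-≤` is that of `*-monoˡ-<`.
  *-monoˡ-≤ : ∀ {x y z} → 0# < x → y ≤ z → x * y ≤ x * z
  *-monoˡ-≤ 0<x y≤z xz<xy = y≤z (*-cancelˡ-< 0<x xz<xy)

  *-monoʳ-≤ : ∀ {x y z} → 0# < x → y ≤ z → y * x ≤ z * x
  *-monoʳ-≤ {x} {y} {z} 0<x y≤z = begin
    y * x  ≈⟨ *-comm y x ⟩
    x * y  ≤⟨ *-monoˡ-≤ 0<x y≤z ⟩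
    x * z  ≈⟨ *-comm x z ⟩
    z * x  ∎

  *-cancelˡ-≤ : ∀ {x y z} → 0# < x → x * y ≤ x * z → y ≤ z
  *-cancelˡ-≤ 0<x xy≤xz z<y = xy≤xz (*-monoˡ-< 0<x z<y)

  *-cancelˡ-≈ : ∀ {x y z} → 0# < x → x * y ≈ x * z → y ≈ z
  *-cancelˡ-≈ {x} {y} {z} 0<x xy≈xz = trans (sym (1/x*[x*y]≈y 0<x y)) (trans (*-congˡ xy≈xz) (1/x*[x*y]≈y 0<x z))

  +-monoˡ-≤ : ∀ x {y z} → y ≤ z → y + x ≤ z + x
  +-monoˡ-≤ x {y} {z} y≤z z+x<y+x = y≤z (0<y-x⇒x<y (<-respʳ-≈
    (solve 3 (λ x y z → y :+ x :- (z :+ x) := y :- z) refl x y z) (x<y⇒0<y-x z+x<y+x)))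

  +-cancelʳ-≤ : ∀ x {y z} → y + x ≤ z + x → y ≤ z
  +-cancelʳ-≤ x y+x≤z+x z<y = y+x≤z+x (+-mono-< x z<y)

  square-< : ∀ {x y} → 0# < x → x < y → x * x < y * y
  square-< {x} {y} 0<x x<y = begin-strict
    x * x  <⟨ *-monoˡ-< 0<x x<y ⟩
    x * y  ≈⟨ *-comm x y ⟩
    y * x  <⟨ *-monoˡ-< (<-trans 0<x x<y) x<y ⟩
    y * y  ∎

  -- Contrapositive of `square-<`: from y < x with y positive the squares would be strictly ordered
  -- the other way.
  square-cancel-≤ : ∀ {x y} → 0# < y → x * x ≤ y * y → x ≤ y
  square-cancel-≤ 0<y xx≤yy y<x = xx≤yy (square-< 0<y y<x)

  square-cancel-≈ : ∀ {x y} → 0# < x → 0# < y → x * x ≈ y * y → x ≈ y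
  square-cancel-≈ 0<x 0<y xx≈yy =
    ≤-antisym (square-cancel-≤ 0<y (≤-reflexive xx≈yy)) (square-cancel-≤ 0<x (≤-reflexive (sym xx≈yy)))

  √-square⁺ : ∀ {x} → 0# < x → √ x * √ x ≈ x
  √-square⁺ 0<x = √-square (<⇒≤ 0<x)

  ≈⇒/≈ : ∀ {x y z} (0<y : 0# < y) → x ≈ z * y → x / y [ 0<y ] ≈ z
  ≈⇒/≈ {x} {y} {z} 0<y x≈zy =
    trans (*-congʳ x≈zy) (trans (*-assoc z y _) (trans (*-congˡ (*-inverseʳ 0<y)) (*-identityʳ z)))

  x/y*y≈x : ∀ x {y} (0<y : 0# < y) → x / y [ 0<y ] * y ≈ x
  x/y*y≈x x 0<y = trans (*-assoc x _ _) (trans (*-congˡ (*-inverseˡ 0<y)) (*-identityʳ x))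

  ≤⇒/≤ : ∀ {x y z} (0<y : 0# < y) → x ≤ z * y → x / y [ 0<y ] ≤ z
  ≤⇒/≤ {x} {y} {z} 0<y x≤zy = ≤-trans (*-monoʳ-≤ (1/-pos 0<y) x≤zy) (≤-reflexive (≈⇒/≈ 0<y refl))

  /-pos : ∀ {x y} → 0# < x → (0<y : 0# < y) → 0# < x / y [ 0<y ]
  /-pos 0<x 0<y = *-pos 0<x (1/-pos 0<y)

  fromℕ-+ : ∀ m n → fromℕ (m ℕ.+ n) ≈ fromℕ m + fromℕ n
  fromℕ-+ = ×-homo-+ 1#

  fromℕ-* : ∀ m n → fromℕ (m ℕ.* n) ≈ fromℕ m * fromℕ n
  fromℕ-* = ×1-homo-*

  fromℕ-nonneg : ∀ n → 0# ≤ fromℕ n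
  fromℕ-nonneg zero    = ≤-reflexive refl
  fromℕ-nonneg (suc n) = <⇒≤ (fromℕ-pos (suc n))

  fromℕ-mono : ∀ {m n} → m ℕ.≤ n → fromℕ m ≤ fromℕ n
  fromℕ-mono {m} {n} m≤n = begin
    fromℕ m                    ≈⟨ +-identityˡ _ ⟨
    0# + fromℕ m               ≤⟨ +-monoˡ-≤ (fromℕ m) (fromℕ-nonneg (n ℕ.∸ m)) ⟩
    fromℕ (n ℕ.∸ m) + fromℕ m  ≈⟨ fromℕ-+ (n ℕ.∸ m) m ⟨
    fromℕ (n ℕ.∸ m ℕ.+ m)      ≡⟨ ≡.cong fromℕ (ℕ.m∸n+n≡m m≤n) ⟩
    fromℕ n                    ∎

  fromℕ-pos⇒pos : ∀ n → 0# < fromℕ n → 0 ℕ.< n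
  fromℕ-pos⇒pos zero    0<0 = ⊥-elim (<-irrefl refl 0<0)
  fromℕ-pos⇒pos (suc n) _   = s≤s z≤n

  -- Source of the thresholds on q that depend on ρ or C₁: one n serves every q ≥ n.
  archimedean-≤ : ∀ x → ∃[ n ] (∀ {q} → n ℕ.≤ q → x ≤ fromℕ q)
  archimedean-≤ x = let n , x<n = archimedean x in n , λ n≤q → <⇒≤ (<-≤-trans x<n (fromℕ-mono n≤q))

module RealProperties {c ℓ₁ ℓ₂} (ℝ : RealField c ℓ₁ ℓ₂) where
  open RealField ℝ
  open RealFieldProperties ℝ
  open ≤-Reasoning

  fromℕ-N>0 : ∀ d → 0# < fromℕ (N d)
  fromℕ-N>0 d = fromℕ-pos (N d) {{N≢0 d}}

  -- The deviation σ and the constant K of a single system.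

  module SystemQuantities (k : ℕ) (𝒳 : System (3 ℕ.+ k)) where
    open System 𝒳
    open Quantities ℝ 𝒳
    open SystemProperties k 𝒳 using (card-P; card-𝒮; incidences≡dm; m≤card𝔄)
    open CardinalityBounds (2 ℕ.+ k) construction using (card𝔄-upper; card𝔄-lower)

    M D : Carrier
    M = fromℕ m
    D = fromℕ (2 ℕ.+ k)

    q>0 : 0# < fromℕ q
    q>0 = fromℕ-pos q {{q-nonZero}}

    D>0 : 0# < D
    D>0 = fromℕ-pos (2 ℕ.+ k)

    ∣P∣≈M : ∣P∣ ≈ M
    ∣P∣≈M = reflexive (≡.cong fromℕ card-P)

    ∣𝒮∣≈q : ∣𝒮∣ ≈ fromℕ q
    ∣𝒮∣≈q = reflexive (≡.cong fromℕ card-𝒮)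

    q^d≈q*q^[d-1] : q^ (3 ℕ.+ k) ≈ fromℕ q * q^ (2 ℕ.+ k)
    q^d≈q*q^[d-1] = fromℕ-* q (q ℕ.^ (2 ℕ.+ k))

    -- Since |S| = q, the main term |P| |S| / q is just m, and dm - m = (d - 1) m.
    σ≈DM : σ ≈ D * M
    σ≈DM = begin-equality
      fromℕ (incidences P𝒢 𝒮rn) - (∣P∣ * ∣𝒮∣) / fromℕ q [ fromℕ-pos q {{q-nonZero}} ]
        ≈⟨ +-cong (reflexive (≡.cong fromℕ incidences≡dm)) (-‿cong (≈⇒/≈ q>0 (*-cong ∣P∣≈M ∣𝒮∣≈q))) ⟩
      fromℕ (m ℕ.+ (2 ℕ.+ k) ℕ.* m) - M
        ≈⟨ +-congʳ (trans (fromℕ-+ m ((2 ℕ.+ k) ℕ.* m)) (+-congˡ (fromℕ-* (2 ℕ.+ k) m))) ⟩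
      M + D * M - M
        ≈⟨ solve 2 (λ d m → m :+ d :* m :- m := d :* m) refl D M ⟩
      D * M ∎

    -- Gives away the factor (d - 1)² in estimates where constants do not matter.
    M≤DDM : M ≤ D * D * M
    M≤DDM = begin
      M                                      ≤⟨ fromℕ-mono (ℕ.m≤n*m m ((2 ℕ.+ k) ℕ.* (2 ℕ.+ k))) ⟩
      fromℕ ((2 ℕ.+ k) ℕ.* (2 ℕ.+ k) ℕ.* m)  ≈⟨ fromℕ-* ((2 ℕ.+ k) ℕ.* (2 ℕ.+ k)) m ⟩
      fromℕ ((2 ℕ.+ k) ℕ.* (2 ℕ.+ k)) * M    ≈⟨ *-congʳ (fromℕ-* (2 ℕ.+ k) (2 ℕ.+ k)) ⟩
      D * D * M                              ∎

    4M≤DDM : fromℕ 4 * M ≤ D * D * M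
    4M≤DDM = begin
      fromℕ 4 * M                                 ≈⟨ fromℕ-* 4 m ⟨
      fromℕ (4 ℕ.* m)
        ≤⟨ fromℕ-mono (ℕ.*-monoˡ-≤ m (ℕ.*-mono-≤ (ℕ.m≤m+n 2 k) (ℕ.m≤m+n 2 k))) ⟩
      fromℕ ((2 ℕ.+ k) ℕ.* (2 ℕ.+ k) ℕ.* m)  ≈⟨ fromℕ-* ((2 ℕ.+ k) ℕ.* (2 ℕ.+ k)) m ⟩
      fromℕ ((2 ℕ.+ k) ℕ.* (2 ℕ.+ k)) * M    ≈⟨ *-congʳ (fromℕ-* (2 ℕ.+ k) (2 ℕ.+ k)) ⟩
      D * D * M                              ∎

    module Nonempty (m>0 : 0 ℕ.< m) where

      M>0 : 0# < M
      M>0 = fromℕ-pos m {{ℕ.>-nonZero m>0}}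

      ∣P∣∣𝒮∣>0 : 0# < ∣P∣ * ∣𝒮∣
      ∣P∣∣𝒮∣>0 = *-pos (<-respʳ-≈ (sym ∣P∣≈M) M>0) (<-respʳ-≈ (sym ∣𝒮∣≈q) q>0)

      W : Carrier
      W = q^½ (2 ℕ.+ k) * √ (∣P∣ * ∣𝒮∣)

      W>0 : 0# < W
      W>0 = *-pos (q^½-pos (2 ℕ.+ k)) (√-pos ∣P∣∣𝒮∣>0)

      √M>0 : 0# < √ M
      √M>0 = √-pos M>0

      -- `W` is the factor multiplying K in its defining equation. Its square is q^(d-1) · m · q = m
      -- q^d because |S| = q.
      W≈√M√q^d : W ≈ √ M * q^½ (3 ℕ.+ k)
      W≈√M√q^d = square-cancel-≈ W>0 (*-pos √M>0 (q^½-pos (3 ℕ.+ k))) (begin-equality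
        (a * s) * (a * s)
          ≈⟨ solve 2 (λ a s → (a :* s) :* (a :* s) := (a :* a) :* (s :* s)) refl a s ⟩
        (a * a) * (s * s)
          ≈⟨ *-cong (√-square⁺ (q^-pos (2 ℕ.+ k))) (trans (√-square⁺ ∣P∣∣𝒮∣>0) (*-cong ∣P∣≈M ∣𝒮∣≈q)) ⟩
        q^ (2 ℕ.+ k) * (M * fromℕ q)
          ≈⟨ solve 3 (λ p m q → p :* (m :* q) := m :* (q :* p)) refl (q^ (2 ℕ.+ k)) M (fromℕ q) ⟩
        M * (fromℕ q * q^ (2 ℕ.+ k))
          ≈⟨ *-cong (√-square⁺ M>0) (trans (√-square⁺ (q^-pos (3 ℕ.+ k))) q^d≈q*q^[d-1]) ⟨
        (√ M * √ M) * (β * β)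
          ≈⟨ solve 2 (λ a s → (a :* a) :* (s :* s) := (a :* s) :* (a :* s)) refl (√ M) β ⟩
        (√ M * β) * (√ M * β) ∎)
        where
        a = q^½ (2 ℕ.+ k)
        β = q^½ (3 ℕ.+ k)
        s = √ (∣P∣ * ∣𝒮∣)

      K-exists : ∃[ K ] IsK K
      K-exists = K , record { nonempty = m>0 ; equation = begin-equality
        σ                                  ≈⟨ σ≈DM ⟩
        D * M                              ≈⟨ x/y*y≈x (D * M) W>0 ⟨
        K * W                              ≈⟨ *-assoc K _ _ ⟨
        K * q^½ (2 ℕ.+ k) * √ (∣P∣ * ∣𝒮∣)  ∎ }
        where
        K = (D * M) / W [ W>0 ]

    module _ {K : Carrier} (isK : IsK K) where
      open IsK isK
      open Nonempty nonempty

      -- The defining equation now reads K √m q^(d/2) = (d - 1) √m √m, and one factor √m is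
      -- cancelled.
      K√q^d≈D√M : K * q^½ (3 ℕ.+ k) ≈ D * √ M
      K√q^d≈D√M = *-cancelˡ-≈ √M>0 (begin-equality
        √ M * (K * q^½ (3 ℕ.+ k))
          ≈⟨ solve 3 (λ s k b → s :* (k :* b) := k :* (s :* b)) refl (√ M) K (q^½ (3 ℕ.+ k)) ⟩
        K * (√ M * q^½ (3 ℕ.+ k))          ≈⟨ *-congˡ W≈√M√q^d ⟨
        K * W                              ≈⟨ *-assoc K _ _ ⟨
        K * q^½ (2 ℕ.+ k) * √ (∣P∣ * ∣𝒮∣)  ≈⟨ equation ⟨
        σ                                  ≈⟨ σ≈DM ⟩
        D * M                              ≈⟨ *-congˡ (√-square⁺ M>0) ⟨
        D * (√ M * √ M)                    ≈⟨ solve 2 (λ d s → d :* (s :* s) := s :* (d :* s)) refl D (√ M) ⟩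
        √ M * (D * √ M)                    ∎)

      K-value : K ≈ D * √ M / q^½ (3 ℕ.+ k) [ q^½-pos (3 ℕ.+ k) ]
      K-value = sym (≈⇒/≈ (q^½-pos (3 ℕ.+ k)) (sym K√q^d≈D√M))

      K>0 : 0# < K
      K>0 = <-respʳ-≈ (sym K-value) (/-pos (*-pos D>0 √M>0) (q^½-pos (3 ℕ.+ k)))

      KKq^d≈DDM : K * K * q^ (3 ℕ.+ k) ≈ D * D * M
      KKq^d≈DDM = begin-equality
        K * K * q^ (3 ℕ.+ k)   ≈⟨ *-congˡ (√-square⁺ (q^-pos (3 ℕ.+ k))) ⟨
        K * K * (β * β)        ≈⟨ solve 2 (λ k b → k :* k :* (b :* b) := (k :* b) :* (k :* b)) refl K β ⟩
        (K * β) * (K * β)      ≈⟨ *-cong K√q^d≈D√M K√q^d≈D√M ⟩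
        (D * √ M) * (D * √ M)  ≈⟨ solve 2 (λ d s → (d :* s) :* (d :* s) := d :* d :* (s :* s)) refl D (√ M) ⟩
        D * D * (√ M * √ M)    ≈⟨ *-congˡ (√-square⁺ M>0) ⟩
        D * D * M              ∎
        where β = q^½ (3 ℕ.+ k)

      KKq^[d-1]∣𝒮∣≈DDM : K * K * q^ (2 ℕ.+ k) * ∣𝒮∣ ≈ D * D * M
      KKq^[d-1]∣𝒮∣≈DDM = begin-equality
        K * K * q^ (2 ℕ.+ k) * ∣𝒮∣            ≈⟨ *-congˡ ∣𝒮∣≈q ⟩
        K * K * q^ (2 ℕ.+ k) * fromℕ q
          ≈⟨ solve 3 (λ k p q → k :* k :* p :* q := k :* k :* (q :* p)) refl K (q^ (2 ℕ.+ k)) (fromℕ q) ⟩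
        K * K * (fromℕ q * q^ (2 ℕ.+ k))  ≈⟨ *-congˡ q^d≈q*q^[d-1] ⟨
        K * K * q^ (3 ℕ.+ k)              ≈⟨ KKq^d≈DDM ⟩
        D * D * M                         ∎

      4∣P∣≤KKq^[d-1]∣𝒮∣ : fromℕ 4 * ∣P∣ ≤ K * K * q^ (2 ℕ.+ k) * ∣𝒮∣
      4∣P∣≤KKq^[d-1]∣𝒮∣ = begin
        fromℕ 4 * ∣P∣               ≈⟨ *-congˡ ∣P∣≈M ⟩
        fromℕ 4 * M                 ≤⟨ 4M≤DDM ⟩
        D * D * M                   ≈⟨ KKq^[d-1]∣𝒮∣≈DDM ⟨
        K * K * q^ (2 ℕ.+ k) * ∣𝒮∣  ∎

      -- m ≤ |𝔄| ≤ q^d, hence K² q^d = (d - 1)² m ≤ (d - 1)² q^d.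
      K≤D : K ≤ D
      K≤D = square-cancel-≤ D>0 (*-cancelˡ-≤ (q^-pos (3 ℕ.+ k)) (begin
        q^ (3 ℕ.+ k) * (K * K)  ≈⟨ *-comm _ _ ⟩
        K * K * q^ (3 ℕ.+ k)    ≈⟨ KKq^d≈DDM ⟩
        D * D * M               ≤⟨ *-monoˡ-≤ (*-pos D>0 D>0) (fromℕ-mono (ℕ.≤-trans m≤card𝔄 card𝔄-upper)) ⟩
        D * D * q^ (3 ℕ.+ k)    ≈⟨ *-comm _ _ ⟩
        q^ (3 ℕ.+ k) * (D * D)  ∎))

      -- Besides squaring, the upper bound is multiplied by q, which completes K² q^(d-1) to K² q^d.
      inModerateRange : ∀ {C₁} → 0# < C₁ → fromℕ (q ℕ.^ 3) ≤ C₁ * C₁ * (D * D * M) → InModerateRange C₁ K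
      inModerateRange {C₁} 0<C₁ q^3≤ = K>0
        , ≤⇒/≤ _ (≤-trans 4∣P∣≤KKq^[d-1]∣𝒮∣ (≤-reflexive (*-comm _ _)))
        , ≤-trans (≤-reflexive ∣𝒮∣≈q) (square-cancel-≤ (*-pos (*-pos 0<C₁ K>0) (q^½-pos (2 ℕ.+ k))) (*-cancelˡ-≤ q>0 (begin
            qᴿ * (qᴿ * qᴿ)
              -- `q ℕ.^ 2` computes to `q ℕ.* (q ℕ.* 1)`, and `fromℕ 1` is `1# + 0#`.
              ≈⟨ *-congˡ (trans (*-congˡ (trans (sym (*-identityʳ qᴿ)) (*-congˡ (sym (+-identityʳ 1#))))) (trans (*-congˡ (sym (fromℕ-* q 1))) (sym (fromℕ-* q (q ℕ.* 1))))) ⟩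
            qᴿ * fromℕ (q ℕ.^ 2)   ≈⟨ fromℕ-* q (q ℕ.^ 2) ⟨
            fromℕ (q ℕ.^ 3)        ≤⟨ q^3≤ ⟩
            C₁ * C₁ * (D * D * M)  ≈⟨ *-congˡ KKq^d≈DDM ⟨
            C₁ * C₁ * (K * K * q^ (3 ℕ.+ k))
              ≈⟨ *-congˡ (*-congˡ (trans q^d≈q*q^[d-1] (*-congˡ (sym (√-square⁺ (q^-pos (2 ℕ.+ k))))))) ⟩
            C₁ * C₁ * (K * K * (qᴿ * (α * α)))
              ≈⟨ solve 4 (λ c k q a → c :* c :* (k :* k :* (q :* (a :* a))) := q :* ((c :* k :* a) :* (c :* k :* a))) refl C₁ K qᴿ α ⟩
            qᴿ * ((C₁ * K * α) * (C₁ * K * α))   ∎)))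
        where
        qᴿ = fromℕ q
        α = q^½ (2 ℕ.+ k)

    module Dense {ρ : Carrier} (ρ>0 : 0# < ρ) (dense : ρ * fromℕ card𝔄 ≤ M) where

      -- Transfers a counting bound in terms of |𝔄| to m through the density hypothesis.
      ρ*fromℕ≤ : ∀ x a → x ℕ.≤ a ℕ.* card𝔄 → ρ * fromℕ x ≤ fromℕ a * M
      -- The factor 0 is treated apart because `*-monoˡ-≤` asks for a positive factor.
      ρ*fromℕ≤ x zero x≤0 = begin
        ρ * fromℕ x  ≤⟨ *-monoˡ-≤ ρ>0 (fromℕ-mono x≤0) ⟩
        ρ * 0#       ≈⟨ trans (zeroʳ ρ) (sym (zeroˡ M)) ⟩
        0# * M       ∎
      ρ*fromℕ≤ x a@(suc _) x≤ac = begin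
        ρ * fromℕ x              ≤⟨ *-monoˡ-≤ ρ>0 (fromℕ-mono x≤ac) ⟩
        ρ * fromℕ (a ℕ.* card𝔄)  ≈⟨ *-congˡ (fromℕ-* a card𝔄) ⟩
        ρ * (fromℕ a * fromℕ card𝔄)
          ≈⟨ solve 3 (λ r a c → r :* (a :* c) := a :* (r :* c)) refl ρ (fromℕ a) (fromℕ card𝔄) ⟩
        fromℕ a * (ρ * fromℕ card𝔄)  ≤⟨ *-monoˡ-≤ (fromℕ-pos a) dense ⟩
        fromℕ a * M                  ∎

      ρq^d≤NM : 4 ℕ.* (3 ℕ.+ k) ℕ.≤ q → ρ * q^ (3 ℕ.+ k) ≤ fromℕ (N (3 ℕ.+ k)) * M
      ρq^d≤NM 4d≤q = ρ*fromℕ≤ (q ℕ.^ (3 ℕ.+ k)) (N (3 ℕ.+ k)) (q^d≤N*c q (3 ℕ.+ k) card𝔄 4d≤q card𝔄-lower)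

      -- Density alone would allow m = 0 for an empty `𝔄`; with q ≥ 4d, 0 < ρ q^d ≤ N m excludes it.
      m>0 : 4 ℕ.* (3 ℕ.+ k) ℕ.≤ q → 0 ℕ.< m
      m>0 4d≤q = fromℕ-pos⇒pos m (*-cancelˡ-< (fromℕ-N>0 (3 ℕ.+ k)) (begin-strict
        fromℕ (N (3 ℕ.+ k)) * 0#  ≈⟨ zeroʳ _ ⟩
        0#                        <⟨ *-pos ρ>0 (q^-pos (3 ℕ.+ k)) ⟩
        ρ * q^ (3 ℕ.+ k)          ≤⟨ ρq^d≤NM 4d≤q ⟩
        fromℕ (N (3 ℕ.+ k)) * M   ∎))

  -- Uniform estimates for dense systems.

  module _ (k : ℕ) {ρ : Carrier} (ρ>0 : 0# < ρ) where

    private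
      ν : Carrier
      ν = fromℕ (N (3 ℕ.+ k))

      ν>0 : 0# < ν
      ν>0 = fromℕ-N>0 (3 ℕ.+ k)

    -- The upper constant is d - 1. The lower one, √(ρ / N), comes from ρ q^d ≤ N m ≤ N (d - 1)² m =
    -- N K² q^d, with `N` taken at d.
    K-bounds : ∃[ lower ] ∃[ upper ] (0# < lower × 0# < upper × (∃[ q₀ ] ((𝒳 : System (3 ℕ.+ k)) →
      let
        open System 𝒳
        open Quantities ℝ 𝒳
      in
      q₀ ℕ.≤ q → ρ * fromℕ card𝔄 ≤ fromℕ m → ∃[ K ] (IsK K × lower ≤ K × K ≤ upper))))
    K-bounds = √ (ρ / ν [ ν>0 ]) , fromℕ (2 ℕ.+ k) , √-pos (/-pos ρ>0 ν>0) , fromℕ-pos (2 ℕ.+ k) , 4 ℕ.* (3 ℕ.+ k) , λ 𝒳 4d≤q dense →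
      let
          open SystemQuantities k 𝒳
          open Dense ρ>0 dense
          K , isK = Nonempty.K-exists (m>0 4d≤q)
      in K , isK , lower≤K 𝒳 4d≤q dense isK , K≤D isK
      where
      lower≤K : ∀ (𝒳 : System (3 ℕ.+ k)) →
        let
          open System 𝒳
          open Quantities ℝ 𝒳
        in
        4 ℕ.* (3 ℕ.+ k) ℕ.≤ q → ρ * fromℕ card𝔄 ≤ fromℕ m → ∀ {K} → IsK K → √ (ρ / ν [ ν>0 ]) ≤ K
      lower≤K 𝒳 4d≤q dense {K} isK = square-cancel-≤ (K>0 isK) (*-cancelˡ-≤ (*-pos ν>0 (q^-pos (3 ℕ.+ k))) (begin
        ν * q^ (3 ℕ.+ k) * (ℓ * ℓ)                    ≈⟨ *-congˡ (√-square⁺ (/-pos ρ>0 ν>0)) ⟩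
        ν * q^ (3 ℕ.+ k) * (ρ / ν [ ν>0 ])
          ≈⟨ solve 3 (λ n q r → n :* q :* r := r :* n :* q) refl ν (q^ (3 ℕ.+ k)) (ρ / ν [ ν>0 ]) ⟩
        (ρ / ν [ ν>0 ]) * ν * q^ (3 ℕ.+ k)  ≈⟨ *-congʳ (x/y*y≈x ρ ν>0) ⟩
        ρ * q^ (3 ℕ.+ k)                    ≤⟨ Dense.ρq^d≤NM ρ>0 dense 4d≤q ⟩
        ν * M                               ≤⟨ *-monoˡ-≤ ν>0 M≤DDM ⟩
        ν * (D * D * M)                     ≈⟨ *-congˡ (KKq^d≈DDM isK) ⟨
        ν * (K * K * q^ (3 ℕ.+ k))
          ≈⟨ solve 3 (λ n k q → n :* (k :* k :* q) := n :* q :* (k :* k)) refl ν K (q^ (3 ℕ.+ k)) ⟩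
        ν * q^ (3 ℕ.+ k) * (K * K)                    ∎))
        where
        open System 𝒳
        open Quantities ℝ 𝒳
        open SystemQuantities k 𝒳
        ℓ = √ (ρ / ν [ ν>0 ])

  -- Once q ≥ 4d and q ≥ N / ρ, N q³ ≤ ρ q⁴ ≤ ρ q^d ≤ N m, so q³ ≤ m ≤ (d - 1)² m.
  moderate-range-d≥4 : ∀ k {ρ} → 0# < ρ → 4 ℕ.≤ 3 ℕ.+ k → ∃[ q₀ ] ((𝒳 : System (3 ℕ.+ k)) →
    let
      open System 𝒳
      open Quantities ℝ 𝒳
    in
    q₀ ℕ.≤ q → ρ * fromℕ card𝔄 ≤ fromℕ m → ∃[ K ] (IsK K × InModerateRange 1# K))
  moderate-range-d≥4 zero    ρ>0 (s≤s (s≤s (s≤s ())))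
  moderate-range-d≥4 (suc k) {ρ} ρ>0 _ = 4 ℕ.* (4 ℕ.+ k) ℕ.+ n , λ 𝒳 q₀≤q dense →
    let 4d≤q = ℕ.≤-trans (ℕ.m≤m+n (4 ℕ.* (4 ℕ.+ k)) n) q₀≤q
        n≤q = ℕ.≤-trans (ℕ.m≤n+m n (4 ℕ.* (4 ℕ.+ k))) q₀≤q
        open SystemQuantities (suc k) 𝒳
        K , isK = Nonempty.K-exists (Dense.m>0 ρ>0 dense 4d≤q)
    in K , isK , inModerateRange isK 0<1 (q^3≤DDM 𝒳 4d≤q (ν/ρ≤ n≤q) dense)
    where
    ν : Carrier
    ν = fromℕ (N (4 ℕ.+ k))

    ν>0 : 0# < ν
    ν>0 = fromℕ-N>0 (4 ℕ.+ k)

    n = proj₁ (archimedean-≤ (ν / ρ [ ρ>0 ]))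
    ν/ρ≤ : ∀ {q} → n ℕ.≤ q → ν / ρ [ ρ>0 ] ≤ fromℕ q
    ν/ρ≤ = proj₂ (archimedean-≤ (ν / ρ [ ρ>0 ]))

    q^3≤DDM : ∀ (𝒳 : System (4 ℕ.+ k)) →
      let
        open System 𝒳
        open SystemQuantities (suc k) 𝒳
      in
      4 ℕ.* (4 ℕ.+ k) ℕ.≤ q → ν / ρ [ ρ>0 ] ≤ fromℕ q → ρ * fromℕ card𝔄 ≤ fromℕ m → fromℕ (q ℕ.^ 3) ≤ 1# * 1# * (D * D * M)
    q^3≤DDM 𝒳 4d≤q ν/ρ≤q dense = *-cancelˡ-≤ ν>0 (begin
      ν * q^ 3                     ≈⟨ *-congʳ (x/y*y≈x ν ρ>0) ⟨
      ν / ρ [ ρ>0 ] * ρ * q^ 3     ≤⟨ *-monoʳ-≤ (q^-pos 3) (*-monoʳ-≤ ρ>0 ν/ρ≤q) ⟩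
      fromℕ q * ρ * q^ 3           ≈⟨ solve 3 (λ q r p → q :* r :* p := r :* (q :* p)) refl (fromℕ q) ρ (q^ 3) ⟩
      ρ * (fromℕ q * q^ 3)         ≈⟨ *-congˡ (fromℕ-* q (q ℕ.^ 3)) ⟨
      ρ * q^ 4                     ≤⟨ *-monoˡ-≤ ρ>0 (fromℕ-mono (ℕ.^-monoʳ-≤ q {{q-nonZero}} (ℕ.m≤m+n 4 k))) ⟩
      ρ * q^ (4 ℕ.+ k)             ≤⟨ Dense.ρq^d≤NM ρ>0 dense 4d≤q ⟩
      ν * M                        ≤⟨ *-monoˡ-≤ ν>0 M≤DDM ⟩
      ν * (D * D * M)              ≈⟨ *-congˡ (solve 1 (λ x → x := con 1ℤ :* con 1ℤ :* x) refl (D * D * M)) ⟩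
      ν * (1# * 1# * (D * D * M))  ∎)
      where
      open System 𝒳
      open Quantities ℝ 𝒳
      open SystemQuantities (suc k) 𝒳

  -- The goal is q³ ≤ 4 C₁² m. From 6 m ≥ ρ (q - 6)³ follows 3 · 4 C₁² m ≥ θ (q - 6)³ with θ = 2 ρ
  -- C₁², so θ (q - 6)³ ≥ 3 q³ suffices, and this holds for large q because θ > 3.
  moderate-range-d≡3 : ∀ k {ρ} (ρ>0 : 0# < ρ) → 3 ℕ.+ k ≡ 3 → ∀ C₁ → √ (fromℕ 3 / (fromℕ 2 * ρ) [ *-pos (fromℕ-pos 2) ρ>0 ]) < C₁ →
    ∃[ q₀ ] ((𝒳 : System (3 ℕ.+ k)) →
    let
      open System 𝒳
      open Quantities ℝ 𝒳
    in
    q₀ ℕ.≤ q → ρ * fromℕ card𝔄 ≤ fromℕ m → ∃[ K ] (IsK K × InModerateRange C₁ K))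
  moderate-range-d≡3 zero {ρ} ρ>0 _ C₁ s<C₁ = 12 ℕ.+ n , λ 𝒳 q₀≤q dense →
    let 12≤q = ℕ.≤-trans (ℕ.m≤m+n 12 n) q₀≤q
        n≤q = ℕ.≤-trans (ℕ.m≤n+m n 12) q₀≤q
        open SystemQuantities 0 𝒳
        K , isK = Nonempty.K-exists (Dense.m>0 ρ>0 dense 12≤q)
    in K , isK , inModerateRange isK C₁>0 (q^3≤CCDDM 𝒳 12≤q (threshold n≤q) dense)
    where
    2ρ>0 : 0# < fromℕ 2 * ρ
    2ρ>0 = *-pos (fromℕ-pos 2) ρ>0

    3/2ρ : Carrier
    3/2ρ = fromℕ 3 / (fromℕ 2 * ρ) [ 2ρ>0 ]

    3/2ρ>0 : 0# < 3/2ρ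
    3/2ρ>0 = /-pos (fromℕ-pos 3) 2ρ>0

    C₁>0 : 0# < C₁
    C₁>0 = <-trans (√-pos 3/2ρ>0) s<C₁

    -- θ > 3 is the hypothesis C₁ > √(3 / (2ρ)) with the root removed.
    θ : Carrier
    θ = fromℕ 2 * ρ * (C₁ * C₁)

    3<θ : fromℕ 3 < θ
    3<θ = begin-strict
      fromℕ 3                          ≈⟨ x/y*y≈x (fromℕ 3) 2ρ>0 ⟨
      3/2ρ * (fromℕ 2 * ρ)             ≈⟨ *-comm _ _ ⟩
      fromℕ 2 * ρ * 3/2ρ               ≈⟨ *-congˡ (√-square⁺ 3/2ρ>0) ⟨
      fromℕ 2 * ρ * (√ 3/2ρ * √ 3/2ρ)  <⟨ *-monoˡ-< 2ρ>0 (square-< (√-pos 3/2ρ>0) s<C₁) ⟩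
      fromℕ 2 * ρ * (C₁ * C₁)          ∎

    θ>0 : 0# < θ
    θ>0 = <-trans (fromℕ-pos 3) 3<θ

    θ-3>0 : 0# < θ - fromℕ 3
    θ-3>0 = x<y⇒0<y-x 3<θ

    -- Solves q (θ - 3) ≥ 18 θ for q, the condition under which (θ - 3) q³ pays for the error term
    -- 18 θ q².
    n = proj₁ (archimedean-≤ (θ * fromℕ 18 / (θ - fromℕ 3) [ θ-3>0 ]))

    threshold : ∀ {q} → n ℕ.≤ q → θ * fromℕ 18 ≤ fromℕ q * (θ - fromℕ 3)
    threshold {q} n≤q = begin
      θ * fromℕ 18                                                  ≈⟨ x/y*y≈x _ θ-3>0 ⟨
      θ * fromℕ 18 / (θ - fromℕ 3) [ θ-3>0 ] * (θ - fromℕ 3)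
        ≤⟨ *-monoʳ-≤ θ-3>0 (proj₂ (archimedean-≤ _) n≤q) ⟩
      fromℕ q * (θ - fromℕ 3)                                       ∎

    -- The bound 6 |𝔄| ≥ (q − 6)³ loses only 18q² against q³, which the
    -- excess of θ over 3 absorbs for large q.
    q^3≤CCDDM : ∀ (𝒳 : System 3) →
      let
        open System 𝒳
        open SystemQuantities 0 𝒳
      in
      12 ℕ.≤ q → θ * fromℕ 18 ≤ fromℕ q * (θ - fromℕ 3) → ρ * fromℕ card𝔄 ≤ fromℕ m →
      fromℕ (q ℕ.^ 3) ≤ C₁ * C₁ * (D * D * M)
    q^3≤CCDDM 𝒳 12≤q 18θ≤q[θ-3] dense = *-cancelˡ-≤ (fromℕ-pos 3) (≤-trans 3q^3≤θy θy≤)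
      where
      open System 𝒳
      open Quantities ℝ 𝒳
      open SystemQuantities 0 𝒳
      open Dense ρ>0 dense
      y = fromℕ ((q ∸ 6) ℕ.^ 3)

      q^3≤y+18q^2 : q^ 3 ≤ y + fromℕ 18 * q^ 2
      q^3≤y+18q^2 = begin
        q^ 3
          ≤⟨ fromℕ-mono (q^3≤[q∸6]^3+18q^2 q (ℕ.≤-trans (ℕ.m≤m+n 6 6) 12≤q)) ⟩
        fromℕ ((q ∸ 6) ℕ.^ 3 ℕ.+ 18 ℕ.* q ℕ.^ 2)  ≈⟨ fromℕ-+ ((q ∸ 6) ℕ.^ 3) (18 ℕ.* q ℕ.^ 2) ⟩
        y + fromℕ (18 ℕ.* q ℕ.^ 2)                ≈⟨ +-congˡ (fromℕ-* 18 (q ℕ.^ 2)) ⟩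
        y + fromℕ 18 * q^ 2                       ∎

      3q^3≤θy : fromℕ 3 * q^ 3 ≤ θ * y
      -- The error term is added on both sides, which avoids subtraction; on the right it completes
      -- θ times the bound for q³.
      3q^3≤θy = +-cancelʳ-≤ (θ * fromℕ 18 * q^ 2) (begin
        fromℕ 3 * q^ 3 + θ * fromℕ 18 * q^ 2
          ≈⟨ +-comm _ _ ⟩
        θ * fromℕ 18 * q^ 2 + fromℕ 3 * q^ 3
          ≤⟨ +-monoˡ-≤ (fromℕ 3 * q^ 3) (*-monoʳ-≤ (q^-pos 2) 18θ≤q[θ-3]) ⟩
        fromℕ q * (θ - fromℕ 3) * q^ 2 + fromℕ 3 * q^ 3
          ≈⟨ +-congˡ (*-congˡ (fromℕ-* q (q ℕ.^ 2))) ⟩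
        fromℕ q * (θ - fromℕ 3) * q^ 2 + fromℕ 3 * (fromℕ q * q^ 2)
          ≈⟨ solve 4 (λ q t a b → q :* (t :- a) :* b :+ a :* (q :* b) := t :* (q :* b)) refl (fromℕ q) θ (fromℕ 3) (q^ 2) ⟩
        θ * (fromℕ q * q^ 2)
          ≈⟨ *-congˡ (fromℕ-* q (q ℕ.^ 2)) ⟨
        θ * q^ 3
          ≤⟨ *-monoˡ-≤ θ>0 q^3≤y+18q^2 ⟩
        θ * (y + fromℕ 18 * q^ 2)
          ≈⟨ solve 4 (λ t y a b → t :* (y :+ a :* b) := t :* y :+ t :* a :* b) refl θ y (fromℕ 18) (q^ 2) ⟩
        θ * y + θ * fromℕ 18 * q^ 2 ∎)

      θy≤ : θ * y ≤ fromℕ 3 * (C₁ * C₁ * (D * D * M))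
      θy≤ = begin
        fromℕ 2 * ρ * (C₁ * C₁) * y
          ≈⟨ solve 4 (λ a r c y → a :* r :* (c :* c) :* y := a :* (c :* c) :* (r :* y)) refl (fromℕ 2) ρ C₁ y ⟩
        fromℕ 2 * (C₁ * C₁) * (ρ * y)
          ≤⟨ *-monoˡ-≤ (*-pos (fromℕ-pos 2) (*-pos C₁>0 C₁>0)) (ρ*fromℕ≤ ((q ∸ 6) ℕ.^ 3) 6 card𝔄-lower′) ⟩
        fromℕ 2 * (C₁ * C₁) * (fromℕ 6 * M)
          -- 6 = 3! is split so that its 2 joins the 2 of θ to form (d - 1)² = 4, leaving the factor
          -- 3 to be cancelled.
          ≈⟨ *-congˡ (*-congʳ (fromℕ-* 3 2)) ⟩
        fromℕ 2 * (C₁ * C₁) * (fromℕ 3 * fromℕ 2 * M)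
          ≈⟨ solve 4 (λ a b c m → a :* (c :* c) :* (b :* a :* m) := b :* (c :* c :* (a :* a :* m))) refl (fromℕ 2) (fromℕ 3) C₁ M ⟩
        fromℕ 3 * (C₁ * C₁ * (D * D * M)) ∎
        where
        card𝔄-lower′ : (q ∸ 6) ℕ.^ 3 ℕ.≤ 6 ℕ.* card𝔄
        card𝔄-lower′ = CardinalityBounds.card𝔄-lower 2 construction

theorem4p9 : ∀ {c ℓ₁ ℓ₂} (ℝ : RealField c ℓ₁ ℓ₂) (d : ℕ) → 3 ℕ.≤ d →
  let
    open RealField ℝ
  in
    -- the points p_A are well defined
    ((𝒞 : Construction d) →
      let
        open Construction 𝒞
      in
      ∀ {A} → 𝔄 A → ∃! _≡_ (IsPoint A))
  × ((𝒳 : System d) →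
      let
        open System 𝒳
        open Quantities ℝ 𝒳
      in
      (∀ {A} → A ∈ˢ 𝒢 → ∀ t → (p A ∈ₛ S[ t ]) ⇔ (t ∈ᶠ A))
    × IsGraphIsomorphism membershipGraph incidenceGraph p S[_]
    × incidences P𝒢 𝒮rn ≡ d ℕ.* m
    × σ ≈ fromℕ (d ∸ 1) * fromℕ m
    × (0 ℕ.< m → ∃[ K ] IsK K)
    × (∀ K → IsK K →
          K ≈ fromℕ (d ∸ 1) * √ (fromℕ m) / q^½ d [ q^½-pos d ]
        × K * K * q^ (d ∸ 1) * ∣𝒮∣ ≈ fromℕ (d ∸ 1) * fromℕ (d ∸ 1) * fromℕ m
        × fromℕ 4 * fromℕ m ≤ fromℕ (d ∸ 1) * fromℕ (d ∸ 1) * fromℕ m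
        × fromℕ 4 * ∣P∣ ≤ K * K * q^ (d ∸ 1) * ∣𝒮∣))
  × (∀ ρ → (0<ρ : 0# < ρ) →
      (∃[ lower ] ∃[ upper ] (0# < lower × 0# < upper × (∃[ q₀ ]
        ((𝒳 : System d) →
      let
        open System 𝒳
        open Quantities ℝ 𝒳
      in
          q₀ ℕ.≤ q → ρ * fromℕ card𝔄 ≤ fromℕ m →
          ∃[ K ] (IsK K × lower ≤ K × K ≤ upper)))))
    × (4 ℕ.≤ d → ∃[ q₀ ]
        ((𝒳 : System d) →
      let
        open System 𝒳
        open Quantities ℝ 𝒳
      in
          q₀ ℕ.≤ q → ρ * fromℕ card𝔄 ≤ fromℕ m →
          ∃[ K ] (IsK K × InModerateRange 1# K)))
    × (d ≡ 3 → ∀ C₁ → √ (fromℕ 3 / (fromℕ 2 * ρ) [ *-pos (fromℕ-pos 2) 0<ρ ]) < C₁ → ∃[ q₀ ]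
        ((𝒳 : System d) →
      let
        open System 𝒳
        open Quantities ℝ 𝒳
      in
          q₀ ℕ.≤ q → ρ * fromℕ card𝔄 ≤ fromℕ m →
          ∃[ K ] (IsK K × InModerateRange C₁ K))))
theorem4p9 ℝ (suc zero)       (s≤s ())
theorem4p9 ℝ (suc (suc zero)) (s≤s (s≤s ()))
theorem4p9 ℝ (suc (suc (suc k))) _ =
    (λ 𝒞 → ConstructionProperties.point-∃! k 𝒞)
  , (λ 𝒳 →
    let
      open SystemProperties k 𝒳
      open SystemQuantities k 𝒳
    in
        p-incidence
      , graphIsomorphism
      , incidences≡dm
      , σ≈DM
      , Nonempty.K-exists
      , λ K isK → K-value isK , KKq^[d-1]∣𝒮∣≈DDM isK , 4M≤DDM , 4∣P∣≤KKq^[d-1]∣𝒮∣ isK)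
  , λ ρ ρ>0 →
        K-bounds k ρ>0
      , moderate-range-d≥4 k ρ>0
      , moderate-range-d≡3 k ρ>0
  where
  open RealProperties ℝ
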